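{- A point in $U$ constitutes a vertex of $P_\lambda$ if and only if it has the form $\sum_{i=1}^n a_i\chi_{A_i}$ for a tuple of $\preceq$-antichains $(A_i\subset Q^C_i,\ 1\le i\le n)$ such that for all $1\le i\le n-1$ the point $\chi_{A_i}+\chi_{A_{i+1}}$ constitutes a vertex of the $\mathfrak{sl}_{2n}$ FFLV polytope $P_{\omega^A_i+\omega^A_{i+1}}$.
   Context: Let $\lambda$ be a dominant integral weight of $\mathfrak{sp}_{2n}$ with coordinates $(a_1,\ldots,a_n)$ in the basis of fundamental weights (simple roots $\alpha_1,\ldots,\alpha_n$ with $(\alpha_i,\alpha_{i+1})<0$ and $\alpha_n$ long). Let $U=\mathbb R^{n^2}$ with coordinates $x_{i,j}$ labeled by pairs $1\le i<j\le 2n+1-i$. A type $C$ Dyck path is a sequence $d=((i_1,j_1),\ldots,(i_N,j_N))$ of such pairs with $j_1-i_1=1$, each $(i_{k+1},j_{k+1})$ equal to $(i_k+1,j_k)$ or $(i_k,j_k+1)$, and either $j_N-i_N=1$ or $i_N+j_N=2n+1$. Set $S(x,d)=\sum_{(i,j)\in d}x_{i,j}$, and $M(\lambda,d)=a_{i_1}+\ldots+a_{i_N}$ if $j_N-i_N=1$, $M(\lambda,d)=a_{i_1}+\ldots+a_n$ otherwise. The type $C$ FFLV polytope $P_\lambda\subset U$ is the set of $x$ with all $x_{i,j}\ge 0$ and $S(x,d)\le M(\lambda,d)$ for every type $C$ Dyck path $d$. For $\mathfrak{sl}_{2n}$ with fundamental weights $\omega^A_1,\ldots,\omega^A_{2n-1}$,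 let $U_A=\mathbb R^{n(2n-1)}$ with coordinates labeled by pairs $1\le i<j\le 2n$; for a dominant integral weight $\mu=\sum b_i\omega^A_i$ the (type $A$) FFLV polytope $P_\mu\subset U_A$ is the set of $x$ with all $x_{i,j}\ge0$ and $\sum_{(i,j)\in d}x_{i,j}\le b_{i_1}+b_{i_1+1}+\ldots+b_{i_N}$ for every type $A$ Dyck path $d=((i_1,j_1),\ldots,(i_N,j_N))$ (pairs $1\le i<j\le 2n$, $j_1-i_1=j_N-i_N=1$, each step going to $(i_k+1,j_k)$ or $(i_k,j_k+1)$). $U$ is identified with the subspace of $U_A$ where all coordinates $x_{i,j}$ with $i+j>2n+1$ vanish. On pairs $1\le i<j\le 2n$ define the partial order $(i_1,j_1)\preceq(i_2,j_2)$ iff $i_1\le i_2$ and $j_1\le j_2$. For $1\le i\le 2n-1$ let $Q_i=\{(k,l):1\le k\le i,\ i+1\le l\le 2n\}$, and for $1\le i\le n$ let $Q^C_i=\{(k,l)\in Q_i: k+l\le 2n+1\}$. For a set $A$ of pairs, $\chi_A$ denotes its indicator function, viewed as a point of $U$ (or $U_A$).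
   Formalization: The points of U and U_A are taken with rational rather than real coordinates, and a vertex of P_λ or of P_{ω^A_i+ω^A_{i+1}} means a point that is not the midpoint of two distinct rational points of the polytope. -}

module Defs where

open import Data.Nat as ℕ using (ℕ; zero; suc; _≟_)
open import Data.Bool using (Bool; true; false; if_then_else_)
open import Data.Product using (_×_; _,_; proj₁; proj₂; Σ; ∃)
open import Data.Sum using (_⊎_)
open import Data.List using (List; []; _∷_)
open import Data.List.Relation.Unary.All using (All)
open import Data.Integer using (+_)
open import Data.Rational using (ℚ; _/_; _≤_; _+_; _*_; ½; 0ℚ)
open import Relation.Nullary using (yes; no)
open import Relation.Binary.PropositionalEquality using (_≡_)

ℕ→ℚ : ℕ → ℚ
ℕ→ℚ n = + n / 1

-- rsum a i k = a i + a (i+1) + ... + a k   (0 if k < i)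
rsumFrom : (ℕ → ℕ) → ℕ → ℕ → ℕ
rsumFrom a i zero      = 0
rsumFrom a i (suc len) = a i ℕ.+ rsumFrom a (suc i) len

rsum : (ℕ → ℕ) → ℕ → ℕ → ℕ
rsum a i k = rsumFrom a i (suc k ℕ.∸ i)

-- points of U / U_A : functions on pairs (only the valid pairs matter)
Point : Set
Point = ℕ → ℕ → ℚ

IdxC : ℕ → ℕ → ℕ → Set
IdxC n i j = (1 ℕ.≤ i) × (i ℕ.< j) × (i ℕ.+ j ℕ.≤ 2 ℕ.* n ℕ.+ 1)

IdxA : ℕ → ℕ → ℕ → Set
IdxA m i j = (1 ℕ.≤ i) × (i ℕ.< j) × (j ℕ.≤ m)

-- Dyck paths: a start pair together with a list of steps

data Step : Set where
  down  : Step
  right : Step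

next : Step → ℕ × ℕ → ℕ × ℕ
next down  (i , j) = (suc i , j)
next right (i , j) = (i , suc j)

walk : ℕ × ℕ → List Step → List (ℕ × ℕ)
walk p []       = p ∷ []
walk p (s ∷ ss) = p ∷ walk (next s p) ss

endpt : ℕ × ℕ → List Step → ℕ × ℕ
endpt p []       = p
endpt p (s ∷ ss) = endpt (next s p) ss

pathSum : Point → List (ℕ × ℕ) → ℚ
pathSum x []            = 0ℚ
pathSum x ((i , j) ∷ d) = x i j + pathSum x d

start : ℕ → ℕ × ℕ
start i₁ = (i₁ , suc i₁)

DyckC : ℕ → ℕ → List Step → Set
DyckC n i₁ ss =
  All (λ p → IdxC n (proj₁ p) (proj₂ p)) (walk (start i₁) ss) ×
  ((proj₂ (endpt (start i₁) ss) ≡ suc (proj₁ (endpt (start i₁) ss))) ⊎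
   (proj₁ (endpt (start i₁) ss) ℕ.+ proj₂ (endpt (start i₁) ss) ≡ 2 ℕ.* n ℕ.+ 1))

-- M(λ,d) where a i is the i-th coordinate of λ
MC : ℕ → (ℕ → ℕ) → ℕ → List Step → ℕ
MC n a i₁ ss with proj₂ (endpt (start i₁) ss) ≟ suc (proj₁ (endpt (start i₁) ss))
... | yes _ = rsum a i₁ (proj₁ (endpt (start i₁) ss))
... | no  _ = rsum a i₁ n

InPC : ℕ → (ℕ → ℕ) → Point → Set
InPC n a x =
  (∀ i j → IdxC n i j → 0ℚ ≤ x i j) ×
  (∀ i₁ ss → DyckC n i₁ ss → pathSum x (walk (start i₁) ss) ≤ ℕ→ℚ (MC n a i₁ ss))

-- vertex (extreme point) of P_λ : not the midpoint of two distinct points of P_λ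
IsVertexC : ℕ → (ℕ → ℕ) → Point → Set
IsVertexC n a x =
  InPC n a x ×
  (∀ y z → InPC n a y → InPC n a z →
     (∀ i j → IdxC n i j → x i j ≡ (y i j + z i j) * ½) →
     ∀ i j → IdxC n i j → y i j ≡ x i j)

-- Type A FFLV polytope for sl_m  (weight μ = Σ b i ω^A_i)

DyckA : ℕ → ℕ → List Step → Set
DyckA m i₁ ss =
  All (λ p → IdxA m (proj₁ p) (proj₂ p)) (walk (start i₁) ss) ×
  (proj₂ (endpt (start i₁) ss) ≡ suc (proj₁ (endpt (start i₁) ss)))

InPA : ℕ → (ℕ → ℕ) → Point → Set
InPA m b x =
  (∀ i j → IdxA m i j → 0ℚ ≤ x i j) ×
  (∀ i₁ ss → DyckA m i₁ ss →
     pathSum x (walk (start i₁) ss) ≤ ℕ→ℚ (rsum b i₁ (proj₁ (endpt (start i₁) ss))))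

IsVertexA : ℕ → (ℕ → ℕ) → Point → Set
IsVertexA m b x =
  InPA m b x ×
  (∀ y z → InPA m b y → InPA m b z →
     (∀ i j → IdxA m i j → x i j ≡ (y i j + z i j) * ½) →
     ∀ i j → IdxA m i j → y i j ≡ x i j)

-- coordinates of ω^A_i + ω^A_{i+1}
ωω : ℕ → ℕ → ℕ
ωω i t with t ≟ i | t ≟ suc i
... | yes _ | _     = 1
... | no _  | yes _ = 1
... | no _  | no _  = 0

PairSet : Set
PairSet = ℕ → ℕ → Bool

_∈ₚ_ : ℕ × ℕ → PairSet → Set
(k , l) ∈ₚ A = A k l ≡ true

_⪯_ : ℕ × ℕ → ℕ × ℕ → Set
(i₁ , j₁) ⪯ (i₂ , j₂) = (i₁ ℕ.≤ i₂) × (j₁ ℕ.≤ j₂)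

IsAntichain : PairSet → Set
IsAntichain A = ∀ p q → p ∈ₚ A → q ∈ₚ A → p ⪯ q → p ≡ q

InQC : ℕ → ℕ → ℕ × ℕ → Set
InQC n i (k , l) =
  (1 ℕ.≤ k) × (k ℕ.≤ i) × (suc i ℕ.≤ l) × (l ℕ.≤ 2 ℕ.* n) × (k ℕ.+ l ℕ.≤ 2 ℕ.* n ℕ.+ 1)

_⊆QC[_,_] : PairSet → ℕ → ℕ → Set
A ⊆QC[ n , i ] = ∀ p → p ∈ₚ A → InQC n i p

χ : PairSet → ℕ → ℕ → ℕ
χ A k l = if A k l then 1 else 0

χsum : PairSet → PairSet → Point
χsum A B k l = ℕ→ℚ (χ A k l ℕ.+ χ B k l)

combo : ℕ → (ℕ → ℕ) → (ℕ → PairSet) → ℕ → ℕ → ℕ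
combo n a A k l = rsumFrom (λ i → a i ℕ.* χ (A i) k l) 1 n

{-# OPTIONS --safe #-}
module Submission where

-- Extend a point x by zero to the grid ℕ × ℕ and let Y k l (`potential`) be the largest value of c i + (sum
-- of x along a path) over paths from a diagonal marker c i to (k , l), where consecutive markers differ by
-- the weights. Then x lies in the polytope iff x ≥ 0 and Y k l ≤ c l, and x is recovered from Y by
-- subtracting from Y k l the maximum over the two preceding cells.  Since a monotone map ψ commutes with
-- maxima, ψ ∘ Y is again the potential of a point `push ψ x`, and this point depends linearly on ψ.
--
-- Vertex ⇒ antichains: maps id ± (tent) fixing all markers exhibit x as a midpoint unless every value of Y
-- is a marker; the minimal elements of the level sets of Y are the antichains.  A perturbation of a pair
-- χ_{A i} + χ_{A (i+1)} can be glued into a window of Y around the level c (i+1), so the pair is a vertex.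
--
-- Antichains ⇒ vertex: a vertex decomposes uniquely as a Minkowski sum, which makes the up-sets of the A i
-- nested. Adding a large multiple of every χ_{A i} separates the levels, and then clamping the potential of
-- a perturbation to a window around one level yields a perturbation of a single pair.

open import Defs
open import Data.Nat as ℕ using (ℕ; zero; suc; z≤n; s≤s)
import Data.Nat.Properties as ℕ
open import Data.Bool as Bool using (true; false; if_then_else_)
open import Data.Bool.Properties using (¬-not)
import Data.Integer as ℤ
import Data.Integer.Properties as ℤ
open import Data.Rational
open import Data.Rational.Properties
import Data.Rational.Unnormalised as ℚᵘ
import Data.Rational.Unnormalised.Properties as ℚᵘ
open import Data.List using ([]; _∷_)
open import Data.List.Relation.Unary.All using (All; []; _∷_)
open import Data.Product using (_×_; _,_; proj₁; proj₂; Σ; ∃)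
open import Data.Sum as Sum using (_⊎_; inj₁; inj₂)
open import Data.Empty using (⊥; ⊥-elim)
open import Function.Bundles using (_⇔_; mk⇔)
open import Relation.Nullary using (¬_; Dec; yes; no; does)
open import Relation.Nullary.Decidable using (_×-dec_; ¬?; dec-true; dec-false; dec⇒maybe)
open import Relation.Binary using (Tri; tri<; tri≈; tri>)
open import Relation.Binary.PropositionalEquality
open import Tactic.RingSolver using (solve-∀)
open import Tactic.RingSolver.Core.AlmostCommutativeRing using (AlmostCommutativeRing; fromCommutativeRing)

-- Rational arithmetic

-- The obstacle is that the potential is only convex in the point. If x is halfway between u and w,
-- then 2X ≤ U + W for the potentials, in general strictly, so applying ψ to all three need not
-- preserve midpoints. For the first implication every push is a push of x itself and linearity in ψ
-- suffices. For the converse u and w are independent points: 2X = U + W has to be established on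
-- the cells where x is nonzero, and ψ has to be affine on an interval containing all three values.
-- The chains of antichain elements in `tight` serve the former, the added multiple `K` the latter.
-- Vanishing weights are the second complication. Markers then coincide and level sets alone no
-- longer determine the antichains; this explains the condition `i < l` in `Up` and the distinction
-- between `flat` and `Steep`. Both types live on one grid: beyond the antidiagonal a type C point
-- is zero, and from column n + 1 on its markers are constant.

ℚ-ring : AlmostCommutativeRing _ _
ℚ-ring = fromCommutativeRing +-*-commutativeRing (λ p → dec⇒maybe (0ℚ ≟ p))

+-cancelʳ-≤ : ∀ r {p q} → p + r ≤ q + r → p ≤ q
+-cancelʳ-≤ r {p} {q} h = subst₂ _≤_ (e p r) (e q r) (+-monoˡ-≤ (- r) h)
  where
  e : ∀ p r → p + r - r ≡ p
  e = solve-∀ ℚ-ring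

+-cancelʳ-≡ : ∀ r {p q} → p + r ≡ q + r → p ≡ q
+-cancelʳ-≡ r {p} {q} h = trans (sym (e p r)) (trans (cong (_- r) h) (e q r))
  where
  e : ∀ p r → p + r - r ≡ p
  e = solve-∀ ℚ-ring

-- Linear consequences: a ≤ b (or a ≡ b) because b − a equals q − p.
lin-≤ : ∀ {p q a b} → p ≤ q → b + p ≡ a + q → a ≤ b
lin-≤ {p} {q} {a} {b} h e =
  +-cancelʳ-≤ p (≤-trans (+-monoʳ-≤ a h) (≤-reflexive (sym e)))

lin-≡ : ∀ {p q a b} → p ≡ q → b + p ≡ a + q → a ≡ b
lin-≡ {p} {a = a} {b} refl e = +-cancelʳ-≡ p (sym e)

infixl 6 _⊞_
_⊞_ : ∀ {p q r s} → p ≤ q → r ≤ s → p + r ≤ q + s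
_⊞_ = +-mono-≤

infixl 6 _⊞≡_
_⊞≡_ : ∀ {p q r s} → p ≡ q → r ≡ s → p + r ≡ q + s
_⊞≡_ = cong₂ _+_

p≤p+q : ∀ {p q} → 0ℚ ≤ q → p ≤ p + q
p≤p+q {p} {q} h = lin-≤ h (e p q)
  where
  e : ∀ p q → p + q + 0ℚ ≡ p + q
  e = solve-∀ ℚ-ring

0≤p+q : ∀ {p q} → 0ℚ ≤ p → 0ℚ ≤ q → 0ℚ ≤ p + q
0≤p+q = +-mono-≤

p≤q⇒0≤q-p : ∀ {p q} → p ≤ q → 0ℚ ≤ q - p
p≤q⇒0≤q-p {p} {q} h = lin-≤ h (e p q)
  where
  e : ∀ p q → q - p + p ≡ 0ℚ + q
  e = solve-∀ ℚ-ring

0≤p*q : ∀ {p q} → 0ℚ ≤ p → 0ℚ ≤ q → 0ℚ ≤ p * q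
0≤p*q {p} {q} hp hq = ≤-trans (≤-reflexive (sym (*-zeroʳ p))) (*-monoˡ-≤-nonNeg p {{nonNegative hp}} hq)

+-zero-split : ∀ {p q} → 0ℚ ≤ p → 0ℚ ≤ q → p + q ≡ 0ℚ → p ≡ 0ℚ
+-zero-split {p} {q} hp hq e =
  ≤-antisym (≤-trans (p≤p+q hq) (≤-reflexive e)) hp

⊔-elim : ∀ {ℓ} (P : ℚ → Set ℓ) {p q} → P p → P q → P (p ⊔ q)
⊔-elim P {p} {q} hp hq with ⊔-sel p q
... | inj₁ e = subst P (sym e) hp
... | inj₂ e = subst P (sym e) hq

⊔-least : ∀ p q {r} → p ≤ r → q ≤ r → p ⊔ q ≤ r
⊔-least p q {r} = ⊔-lub {r} {p} {q}

*-⊔ : ∀ {s} → 0ℚ ≤ s → ∀ p q → s * (p ⊔ q) ≡ s * p ⊔ s * q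
*-⊔ {s} h p q = *-distribˡ-⊔-nonNeg s {{nonNegative h}} p q

2ℚ : ℚ
2ℚ = 1ℚ + 1ℚ

toℚᵘ-ℕ→ℚ : ∀ n → toℚᵘ (ℕ→ℚ n) ℚᵘ.≃ ℚᵘ.mkℚᵘ (ℤ.+ n) 0
toℚᵘ-ℕ→ℚ n = toℚᵘ-fromℚᵘ (ℚᵘ.mkℚᵘ (ℤ.+ n) 0)

ℕ→ℚ-+ : ∀ m n → ℕ→ℚ (m ℕ.+ n) ≡ ℕ→ℚ m + ℕ→ℚ n
ℕ→ℚ-+ m n = toℚᵘ-injective (begin
  toℚᵘ (ℕ→ℚ (m ℕ.+ n))                     ≈⟨ toℚᵘ-ℕ→ℚ (m ℕ.+ n) ⟩
  ℚᵘ.mkℚᵘ (ℤ.+ (m ℕ.+ n)) 0                  ≈⟨ ℚᵘ.*≡* (cong (ℤ._* ℤ.+ 1) (trans (ℤ.pos-+ m n) (sym (cong₂ ℤ._+_ (ℤ.*-identityʳ (ℤ.+ m)) (ℤ.*-identityʳ (ℤ.+ n)))))) ⟩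
  ℚᵘ.mkℚᵘ (ℤ.+ m) 0 ℚᵘ.+ ℚᵘ.mkℚᵘ (ℤ.+ n) 0     ≈⟨ ℚᵘ.+-cong (toℚᵘ-ℕ→ℚ m) (toℚᵘ-ℕ→ℚ n) ⟨
  toℚᵘ (ℕ→ℚ m) ℚᵘ.+ toℚᵘ (ℕ→ℚ n)           ≈⟨ toℚᵘ-homo-+ (ℕ→ℚ m) (ℕ→ℚ n) ⟨
  toℚᵘ (ℕ→ℚ m + ℕ→ℚ n)                     ∎)
  where open ℚᵘ.≃-Reasoning

ℕ→ℚ-* : ∀ m n → ℕ→ℚ (m ℕ.* n) ≡ ℕ→ℚ m * ℕ→ℚ n
ℕ→ℚ-* zero    n = sym (*-zeroˡ (ℕ→ℚ n))
ℕ→ℚ-* (suc m) n = trans (ℕ→ℚ-+ n (m ℕ.* n)) (trans (cong (ℕ→ℚ n +_) (ℕ→ℚ-* m n))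
  (trans (e (ℕ→ℚ m) (ℕ→ℚ n)) (cong (_* ℕ→ℚ n) (sym (ℕ→ℚ-+ 1 m)))))
  where
  e : ∀ p q → q + p * q ≡ (1ℚ + p) * q
  e = solve-∀ ℚ-ring

0≤1 : 0ℚ ≤ 1ℚ
0≤1 = *≤* (ℤ.+≤+ z≤n)

0≤ℕ→ℚ : ∀ n → 0ℚ ≤ ℕ→ℚ n
0≤ℕ→ℚ zero    = ≤-refl
0≤ℕ→ℚ (suc n) = ≤-trans (0≤p+q {1ℚ} {ℕ→ℚ n} 0≤1 (0≤ℕ→ℚ n)) (≤-reflexive (sym (ℕ→ℚ-+ 1 n)))

ℕ→ℚ-mono : ∀ {m n} → m ℕ.≤ n → ℕ→ℚ m ≤ ℕ→ℚ n
ℕ→ℚ-mono {m} {n} h = subst (λ t → ℕ→ℚ m ≤ ℕ→ℚ t) (ℕ.m+[n∸m]≡n h)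
  (≤-trans (p≤p+q (0≤ℕ→ℚ (n ℕ.∸ m))) (≤-reflexive (sym (ℕ→ℚ-+ m (n ℕ.∸ m)))))

1≰0 : ¬ (1ℚ ≤ 0ℚ)
1≰0 (*≤* (ℤ.+≤+ ()))

ℕ→ℚ-cancel : ∀ {m n} → ℕ→ℚ m ≤ ℕ→ℚ n → m ℕ.≤ n
ℕ→ℚ-cancel {m} {n} h with m ℕ.≤? n
... | yes m≤n = m≤n
... | no  m≰n = ⊥-elim (1≰0 (+-cancelʳ-≤ (ℕ→ℚ n)
      (≤-trans (≤-reflexive (sym (ℕ→ℚ-+ 1 n)))
      (≤-trans (ℕ→ℚ-mono (ℕ.≰⇒> m≰n)) (≤-trans h (≤-reflexive (sym (+-identityˡ _))))))))

-- An abstract copy of ℕ→ℚ, so that the gcd computation hidden in it is never unfolded.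
abstract

  ι : ℕ → ℚ
  ι = ℕ→ℚ

  ι-def : ∀ n → ι n ≡ ℕ→ℚ n
  ι-def n = refl

  ι-0 : ι 0 ≡ 0ℚ
  ι-0 = refl

  ι-1 : ι 1 ≡ 1ℚ
  ι-1 = refl

  ι-+ : ∀ m n → ι (m ℕ.+ n) ≡ ι m + ι n
  ι-+ = ℕ→ℚ-+

  0≤ι : ∀ n → 0ℚ ≤ ι n
  0≤ι = 0≤ℕ→ℚ

  ι-mono : ∀ {m n} → m ℕ.≤ n → ι m ≤ ι n
  ι-mono = ℕ→ℚ-mono

  ι-cancel : ∀ {m n} → ι m ≤ ι n → m ℕ.≤ n
  ι-cancel = ℕ→ℚ-cancel

ι-suc : ∀ n → ι (suc n) ≡ 1ℚ + ι n
ι-suc n = trans (ι-+ 1 n) (cong (_+ ι n) ι-1)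

sumTo : (ℕ → ℚ) → ℕ → ℚ
sumTo g zero    = 0ℚ
sumTo g (suc n) = sumTo g n + g (suc n)

sumTo-cong : ∀ {g h} n → (∀ i → 1 ℕ.≤ i → i ℕ.≤ n → g i ≡ h i) → sumTo g n ≡ sumTo h n
sumTo-cong zero    e = refl
sumTo-cong (suc n) e = cong₂ _+_ (sumTo-cong n (λ i h₁ h₂ → e i h₁ (ℕ.≤-trans h₂ (ℕ.n≤1+n n)))) (e (suc n) (s≤s z≤n) ℕ.≤-refl)

sumTo-+ : ∀ g h n → sumTo (λ i → g i + h i) n ≡ sumTo g n + sumTo h n
sumTo-+ g h zero    = refl
sumTo-+ g h (suc n) = trans (cong (_+ (g (suc n) + h (suc n))) (sumTo-+ g h n)) (e (sumTo g n) (sumTo h n) (g (suc n)) (h (suc n)))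
  where
  e : ∀ p q r s → p + q + (r + s) ≡ p + r + (q + s)
  e = solve-∀ ℚ-ring

rsumFrom-snoc : ∀ g i len → rsumFrom g i (suc len) ≡ rsumFrom g i len ℕ.+ g (i ℕ.+ len)
rsumFrom-snoc g i zero = trans (ℕ.+-identityʳ (g i)) (cong g (sym (ℕ.+-identityʳ i)))
rsumFrom-snoc g i (suc len) = trans (cong (g i ℕ.+_) (rsumFrom-snoc g (suc i) len))
  (trans (sym (ℕ.+-assoc (g i) _ _)) (cong (λ t → rsumFrom g i (suc len) ℕ.+ g t) (sym (ℕ.+-suc i len))))

ℕ→ℚ-rsumFrom : ∀ g n → ℕ→ℚ (rsumFrom g 1 n) ≡ sumTo (λ i → ℕ→ℚ (g i)) n
ℕ→ℚ-rsumFrom g zero    = refl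
ℕ→ℚ-rsumFrom g (suc n) = trans (cong ℕ→ℚ (rsumFrom-snoc g 1 n))
  (trans (ℕ→ℚ-+ (rsumFrom g 1 n) (g (suc n))) (cong (_+ ℕ→ℚ (g (suc n))) (ℕ→ℚ-rsumFrom g n)))

-- Monotone maps of the line and clamps

Monotone : (ℚ → ℚ) → Set
Monotone ψ = ∀ {s t} → s ≤ t → ψ s ≤ ψ t

abstract

  -- Length of the part of [α , α + δ] below s.
  clamp : ℚ → ℚ → ℚ → ℚ
  clamp α δ s = 0ℚ ⊔ ((s - α) ⊓ δ)

  clamp-mono : ∀ α δ → Monotone (clamp α δ)
  clamp-mono α δ h = ⊔-monoʳ-≤ 0ℚ (⊓-monoˡ-≤ δ (+-monoˡ-≤ (- α) h))

  0≤clamp : ∀ α δ s → 0ℚ ≤ clamp α δ s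
  0≤clamp α δ s = p≤p⊔q 0ℚ ((s - α) ⊓ δ)

  clamp-low : ∀ {α} δ {s} → s ≤ α → clamp α δ s ≡ 0ℚ
  clamp-low {α} δ {s} h = p≥q⇒p⊔q≡p (≤-trans (p⊓q≤p (s - α) δ) (lin-≤ h (e s α)))
    where
    e : ∀ s α → 0ℚ + s ≡ s - α + α
    e = solve-∀ ℚ-ring

  clamp-high : ∀ {α δ s} → 0ℚ ≤ δ → α + δ ≤ s → clamp α δ s ≡ δ
  clamp-high {α} {δ} {s} hδ h =
    trans (cong (0ℚ ⊔_) (p≥q⇒p⊓q≡q {s - α} {δ} (lin-≤ h (e s α δ)))) (p≤q⇒p⊔q≡q hδ)
    where
    e : ∀ s α δ → s - α + (α + δ) ≡ δ + s
    e = solve-∀ ℚ-ring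

  clamp-mid : ∀ {α δ s} → α ≤ s → s ≤ α + δ → clamp α δ s ≡ s - α
  clamp-mid {α} {δ} {s} h₁ h₂ =
    trans (cong (0ℚ ⊔_) (p≤q⇒p⊓q≡p {s - α} {δ} (lin-≤ h₂ (e s α δ)))) (p≤q⇒p⊔q≡q (p≤q⇒0≤q-p h₁))
    where
    e : ∀ s α δ → δ + s ≡ s - α + (α + δ)
    e = solve-∀ ℚ-ring

  clamp-contract : ∀ α δ {s t} → s ≤ t → clamp α δ t - clamp α δ s ≤ t - s
  clamp-contract α δ {s} {t} h = lin-≤ main (e₁ (clamp α δ s) (clamp α δ t) s t)
    where
    e₁ : ∀ p q s t → (t - s) + q ≡ q - p + (p + (t - s))
    e₁ = solve-∀ ℚ-ring
    e₂ : ∀ α s t → s - α + (t - s) ≡ t - α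
    e₂ = solve-∀ ℚ-ring
    m : ℚ
    m = (s - α) ⊓ δ
    upper : (t - α) ⊓ δ ≤ m + (t - s)
    upper with ⊓-sel (s - α) δ
    ... | inj₁ e = ≤-trans (p⊓q≤p (t - α) δ) (≤-reflexive (trans (sym (e₂ α s t)) (cong (_+ (t - s)) (sym e))))
    ... | inj₂ e = ≤-trans (p⊓q≤q (t - α) δ) (≤-trans (p≤p+q (p≤q⇒0≤q-p h)) (≤-reflexive (cong (_+ (t - s)) (sym e))))
    main : clamp α δ t ≤ clamp α δ s + (t - s)
    main = ⊔-lub (0≤p+q (0≤clamp α δ s) (p≤q⇒0≤q-p h))
                 (≤-trans upper (+-monoˡ-≤ (t - s) (p≤q⊔p 0ℚ m)))

-- The potential of a point

abstract

  -- Cells on and below the diagonal repeat the marker of their column and row zero repeats `c 0`,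
  -- so the bound `Y k l ≤ c l` makes sense on the whole grid. The three equations that follow are
  -- the interface of this abstract definition.
  potential : (ℕ → ℚ) → Point → ℕ → ℕ → ℚ
  potential c x zero    l       = c 0
  potential c x (suc k) zero    = c 0
  potential c x (suc k) (suc l) with k ℕ.<? l
  ... | yes _ = x (suc k) (suc l) + (potential c x k (suc l) ⊔ potential c x (suc k) l)
  ... | no  _ = c (suc l)

  potential-zero : ∀ c x l → potential c x 0 l ≡ c 0
  potential-zero c x l = refl

  potential-diag : ∀ c x {k l} → l ℕ.≤ k → potential c x k l ≡ c l
  potential-diag c x {zero}  {zero}  _ = refl
  potential-diag c x {suc k} {zero}  _ = refl
  potential-diag c x {suc k} {suc l} h with k ℕ.<? l
  ... | yes k<l = ⊥-elim (ℕ.<⇒≱ k<l (ℕ.≤-pred h))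
  ... | no  _   = refl

  potential-step : ∀ c x {k l} → k ℕ.< l →
    potential c x (suc k) (suc l) ≡ x (suc k) (suc l) + (potential c x k (suc l) ⊔ potential c x (suc k) l)
  potential-step c x {k} {l} h with k ℕ.<? l
  ... | yes _ = refl
  ... | no ¬h = ⊥-elim (¬h h)

below : (ℕ → ℚ) → Point → ℕ → ℕ → ℚ
below c x k l = potential c x (ℕ.pred k) l ⊔ potential c x k (ℕ.pred l)

potential-below : ∀ c x {k l} → 1 ℕ.≤ k → k ℕ.< l → potential c x k l ≡ x k l + below c x k l
potential-below c x {suc k} {suc l} _ h = potential-step c x (ℕ.≤-pred h)

grid-ind : ∀ {ℓ} (P : ℕ → ℕ → Set ℓ) → (∀ l → P 0 l) → (∀ {k l} → l ℕ.≤ k → P k l) →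
  (∀ {k l} → k ℕ.< l → P k (suc l) → P (suc k) l → P (suc k) (suc l)) → ∀ k l → P k l
grid-ind P P0 Pd Ps zero    l       = P0 l
grid-ind P P0 Pd Ps (suc k) zero    = Pd z≤n
grid-ind P P0 Pd Ps (suc k) (suc l) with k ℕ.<? l
... | yes h = Ps h (grid-ind P P0 Pd Ps k (suc l)) (grid-ind P P0 Pd Ps (suc k) l)
... | no ¬h = Pd (s≤s (ℕ.≮⇒≥ ¬h))

-- The recursion has one solution, so the potential of a pushed, scaled or layered point is found by
-- checking the recursion for a candidate.
potential-unique : ∀ c x (h : ℕ → ℕ → ℚ) → (∀ l → h 0 l ≡ c 0) → (∀ {k l} → l ℕ.≤ k → h k l ≡ c l) →
  (∀ {k l} → k ℕ.< l → h (suc k) (suc l) ≡ x (suc k) (suc l) + (h k (suc l) ⊔ h (suc k) l)) →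
  ∀ k l → potential c x k l ≡ h k l
potential-unique c x h h0 hd hs = grid-ind _ (λ l → trans (potential-zero c x l) (sym (h0 l)))
  (λ le → trans (potential-diag c x le) (sym (hd le)))
  (λ {k} {l} lt e₁ e₂ → trans (potential-step c x lt)
     (trans (cong₂ (λ p q → x (suc k) (suc l) + (p ⊔ q)) e₁ e₂) (sym (hs lt))))

potential-cong : ∀ {c c' x x'} → (∀ k → c k ≡ c' k) → (∀ k l → x k l ≡ x' k l) →
  ∀ k l → potential c x k l ≡ potential c' x' k l
potential-cong {c} {c'} {x} {x'} ec ex = potential-unique c x _
  (λ l → trans (potential-zero c' x' l) (sym (ec 0))) (λ {k} {l} le → trans (potential-diag c' x' le) (sym (ec l)))
  (λ {k} {l} lt → trans (potential-step c' x' lt) (cong (_+ _) (sym (ex (suc k) (suc l)))))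

potential-mono : ∀ {c c' x x'} → (∀ k → c k ≤ c' k) → (∀ k l → x k l ≤ x' k l) →
  ∀ k l → potential c x k l ≤ potential c' x' k l
potential-mono {c} {c'} {x} {x'} hc hx = grid-ind _
  (λ l → subst₂ _≤_ (sym (potential-zero c x l)) (sym (potential-zero c' x' l)) (hc 0))
  (λ {k} {l} le → subst₂ _≤_ (sym (potential-diag c x le)) (sym (potential-diag c' x' le)) (hc l))
  (λ {k} {l} lt h₁ h₂ → subst₂ _≤_ (sym (potential-step c x lt)) (sym (potential-step c' x' lt))
     (+-mono-≤ (hx (suc k) (suc l)) (⊔-mono-≤ h₁ h₂)))

-- A maximum of sums is at most the sum of the maxima. Minkowski sums (`In-+`) and convexity both
-- rest on this.
potential-+ : ∀ c c' x x' k l →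
  potential (λ k → c k + c' k) (λ k l → x k l + x' k l) k l ≤ potential c x k l + potential c' x' k l
potential-+ c c' x x' = grid-ind _
  (λ l → ≤-reflexive (trans (potential-zero _ _ l)
     (sym (cong₂ _+_ (potential-zero c x l) (potential-zero c' x' l)))))
  (λ {k} {l} le → ≤-reflexive (trans (potential-diag _ _ le)
     (sym (cong₂ _+_ (potential-diag c x le) (potential-diag c' x' le)))))
  (λ {k} {l} lt h₁ h₂ → subst₂ _≤_ (sym (potential-step _ _ lt))
     (sym (cong₂ _+_ (potential-step c x lt) (potential-step c' x' lt)))
     (lin-≤ (⊔-least _ _ {below c x (suc k) (suc l) + below c' x' (suc k) (suc l)}
                   (≤-trans h₁ (+-mono-≤ (p≤p⊔q (potential c x k (suc l)) _) (p≤p⊔q (potential c' x' k (suc l)) _)))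
                   (≤-trans h₂ (+-mono-≤ (p≤q⊔p (potential c x k (suc l)) _) (p≤q⊔p (potential c' x' k (suc l)) _))))
            (e (x (suc k) (suc l)) (x' (suc k) (suc l)) (below c x (suc k) (suc l)) (below c' x' (suc k) (suc l)) _)))
  where
  e : ∀ x x' m m' n → (x + m) + (x' + m') + n ≡ x + x' + n + (m + m')
  e = solve-∀ ℚ-ring

potential-* : ∀ {s} → 0ℚ ≤ s → ∀ c x k l →
  potential (λ k → s * c k) (λ k l → s * x k l) k l ≡ s * potential c x k l
potential-* {s} hs c x = potential-unique _ _ _ (λ l → cong (s *_) (potential-zero c x l))
  (λ le → cong (s *_) (potential-diag c x le))
  (λ {k} {l} lt → trans (cong (s *_) (potential-step c x lt))
     (trans (*-distribˡ-+ s (x (suc k) (suc l)) _) (cong (s * x (suc k) (suc l) +_) (*-⊔ hs _ _))))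

-- The potential is a maximum of affine functions of x, hence convex.
potential-midpoint : ∀ c {x y z} → (∀ k l → x k l + x k l ≡ y k l + z k l) →
  ∀ k l → potential c x k l + potential c x k l ≤ potential c y k l + potential c z k l
potential-midpoint c {x} {y} {z} e k l = ≤-trans
  (≤-reflexive (trans (e₁ (potential c x k l)) (trans (sym (potential-* {2ℚ} (0≤p+q 0≤1 0≤1) c x k l))
    (potential-cong (λ k → e₂ (c k)) (λ k l → trans (e₂ (x k l)) (e k l)) k l))))
  (potential-+ c c y z k l)
  where
  e₁ : ∀ p → p + p ≡ (1ℚ + 1ℚ) * p
  e₁ = solve-∀ ℚ-ring
  e₂ : ∀ p → (1ℚ + 1ℚ) * p ≡ p + p
  e₂ = solve-∀ ℚ-ring

-- Marker sequences and the polytope cut out by the potential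

Markers : (ℕ → ℚ) → Set
Markers c = ∀ k → c k ≤ c (suc k)

markers-mono : ∀ {c} → Markers c → ∀ {k l} → k ℕ.≤ l → c k ≤ c l
markers-mono {c} hc {k} {zero}  z≤n = ≤-refl
markers-mono {c} hc {k} {suc l} h with ℕ.m≤n⇒m<n∨m≡n h
... | inj₁ k<sl = ≤-trans (markers-mono hc (ℕ.≤-pred k<sl)) (hc l)
... | inj₂ refl = ≤-refl

NonNeg : Point → Set
NonNeg x = ∀ k l → 0ℚ ≤ x k l

In : (ℕ → ℚ) → Point → Set
In c x = NonNeg x × (∀ k l → potential c x k l ≤ c l)

-- Equality is asked on the whole grid. If `x` is supported on the triangle this is harmless, since
-- off it `y` and `z` are nonnegative with sum zero.
IsVertex : (ℕ → ℚ) → Point → Set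
IsVertex c x = In c x × (∀ y z → In c y → In c z → (∀ k l → x k l + x k l ≡ y k l + z k l) → ∀ k l → y k l ≡ x k l)

Supported : Point → Set
Supported x = ∀ k l → ¬ (1 ℕ.≤ k × k ℕ.< l) → x k l ≡ 0ℚ

In-cong : ∀ {c c' x x'} → (∀ k → c k ≡ c' k) → (∀ k l → x k l ≡ x' k l) → In c x → In c' x'
In-cong ec ex (nn , up) =
  (λ k l → subst (0ℚ ≤_) (ex k l) (nn k l)) ,
  (λ k l → subst₂ _≤_ (potential-cong ec ex k l) (ec l) (up k l))

IsVertex-cong : ∀ {c c' x x'} → (∀ k → c k ≡ c' k) → (∀ k l → x k l ≡ x' k l) → IsVertex c x → IsVertex c' x'
IsVertex-cong ec ex (hx , ext) = In-cong ec ex hx , λ y z hy hz e k l →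
  trans (ext y z (In-cong (λ k → sym (ec k)) (λ _ _ → refl) hy) (In-cong (λ k → sym (ec k)) (λ _ _ → refl) hz)
           (λ k l → trans (cong₂ _+_ (ex k l) (ex k l)) (e k l)) k l) (ex k l)

In-+ : ∀ {c c' x x'} → In c x → In c' x' → In (λ k → c k + c' k) (λ k l → x k l + x' k l)
In-+ {c} {c'} {x} {x'} (nn , up) (nn' , up') =
  (λ k l → 0≤p+q (nn k l) (nn' k l)) ,
  (λ k l → ≤-trans (potential-+ c c' x x' k l) (+-mono-≤ (up k l) (up' k l)))

In-* : ∀ {s c x} → 0ℚ ≤ s → In c x → In (λ k → s * c k) (λ k l → s * x k l)
In-* {s} {c} {x} hs (nn , up) =
  (λ k l → 0≤p*q hs (nn k l)) ,
  (λ k l → subst (_≤ s * c l) (sym (potential-* hs c x k l)) (*-monoˡ-≤-nonNeg s {{nonNegative hs}} (up k l)))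

module _ {c x} (hc : Markers c) (nn : NonNeg x) where

  potential-suc-l : ∀ k l → potential c x k l ≤ potential c x k (suc l)
  potential-suc-l zero    l = ≤-reflexive (trans (potential-zero c x l) (sym (potential-zero c x (suc l))))
  potential-suc-l (suc k) l with suc k ℕ.<? suc l
  ... | yes h = subst (potential c x (suc k) l ≤_) (sym (potential-step c x (ℕ.≤-pred h)))
                  (lin-≤ (p≤q⊔p (potential c x k (suc l)) (potential c x (suc k) l) ⊞ nn (suc k) (suc l))
                    (e (x (suc k) (suc l)) (below c x (suc k) (suc l)) (potential c x (suc k) l)))
    where
    e : ∀ x m y → x + m + (y + 0ℚ) ≡ y + (m + x)
    e = solve-∀ ℚ-ring
  ... | no ¬h = subst₂ _≤_ (sym (potential-diag c x (ℕ.≤-trans (ℕ.n≤1+n l) le))) (sym (potential-diag c x le)) (hc l)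
    where
    le : suc l ℕ.≤ suc k
    le = ℕ.≮⇒≥ ¬h

  c0≤potential : ∀ k l → c 0 ≤ potential c x k l
  c0≤potential k zero    = ≤-reflexive (sym (potential-diag c x {k} z≤n))
  c0≤potential k (suc l) = ≤-trans (c0≤potential k l) (potential-suc-l k l)

  potential-below-≤ : ∀ {k l} → 1 ℕ.≤ k → k ℕ.< l → below c x k l ≤ potential c x k l
  potential-below-≤ {k} {l} h₁ h₂ = lin-≤ (nn k l) (trans (cong (_+ 0ℚ) (potential-below c x h₁ h₂)) (e (x k l) (below c x k l)))
    where
    e : ∀ x m → x + m + 0ℚ ≡ m + x
    e = solve-∀ ℚ-ring

  potential-mono-l : ∀ k {l l'} → l ℕ.≤ l' → potential c x k l ≤ potential c x k l'
  potential-mono-l k = markers-mono (potential-suc-l k)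

module _ {c x} (hc : Markers c) (hx : In c x) where

  -- Inside the triangle this is the recursion. When the next cell reaches the diagonal its value is
  -- the marker `c l`, and the step is exactly the upper bound in `In`.
  potential-suc-k : ∀ k l → potential c x k l ≤ potential c x (suc k) l
  potential-suc-k k l with suc k ℕ.<? l
  potential-suc-k k (suc l) | yes h = ≤-trans (p≤p⊔q _ _) (potential-below-≤ hc (proj₁ hx) (s≤s z≤n) h)
  potential-suc-k k l | no ¬h = ≤-trans (proj₂ hx k l) (≤-reflexive (sym (potential-diag c x (ℕ.≮⇒≥ ¬h))))

  potential-mono-kl : ∀ {k k' l l'} → k ℕ.≤ k' → l ℕ.≤ l' → potential c x k l ≤ potential c x k' l'
  potential-mono-kl {k} {k'} {l} {l'} hk hl = ≤-trans
    (markers-mono {λ k → potential c x k l} (λ k → potential-suc-k k l) hk)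
    (potential-mono-l hc (proj₁ hx) k' hl)

-- Writing `x k l + below` instead of the potential makes the result vanish wherever `x` does, also
-- off the triangle, where the two differ.
push : (ℚ → ℚ) → (ℕ → ℚ) → Point → Point
push ψ c x k l = ψ (x k l + below c x k l) - ψ (below c x k l)

module _ {ψ : ℚ → ℚ} (ψ-mono : Monotone ψ) where

  potential-push : ∀ c x k l → potential (λ k → ψ (c k)) (push ψ c x) k l ≡ ψ (potential c x k l)
  potential-push c x = potential-unique _ _ _ (λ l → cong ψ (potential-zero c x l))
    (λ le → cong ψ (potential-diag c x le))
    (λ {k} {l} lt → trans (cong ψ (potential-step c x lt))
       (trans (e _ (ψ (below c x (suc k) (suc l))))
              (cong (push ψ c x (suc k) (suc l) +_) (mono-≤-distrib-⊔ ψ-mono _ _))))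
    where
    e : ∀ p q → p ≡ p - q + q
    e = solve-∀ ℚ-ring

  push-In : ∀ {c x} → In c x → In (λ k → ψ (c k)) (push ψ c x)
  push-In {c} {x} (nn , up) =
    (λ k l → p≤q⇒0≤q-p (ψ-mono (lin-≤ (nn k l) (e (x k l) (below c x k l))))) ,
    (λ k l → ≤-trans (≤-reflexive (potential-push c x k l)) (ψ-mono (up k l)))
    where
    e : ∀ x m → x + m + 0ℚ ≡ m + x
    e = solve-∀ ℚ-ring

push-zero : ∀ ψ c x {k l} → x k l ≡ 0ℚ → push ψ c x k l ≡ 0ℚ
push-zero ψ c x {k} {l} e = trans (cong (λ p → ψ (p + below c x k l) - ψ (below c x k l)) e)
  (trans (cong (λ p → ψ p - ψ (below c x k l)) (+-identityˡ (below c x k l))) (+-inverseʳ (ψ (below c x k l))))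

push-at : ∀ ψ c x {k l} → 1 ℕ.≤ k → k ℕ.< l → push ψ c x k l ≡ ψ (potential c x k l) - ψ (below c x k l)
push-at ψ c x {k} {l} h₁ h₂ = cong (λ p → ψ p - ψ (below c x k l)) (sym (potential-below c x h₁ h₂))

below-mono-⊔ : ∀ {ψ} → Monotone ψ → ∀ c x k l →
  ψ (below c x k l) ≡ ψ (potential c x (ℕ.pred k) l) ⊔ ψ (potential c x k (ℕ.pred l))
below-mono-⊔ ψ-mono c x k l = mono-≤-distrib-⊔ ψ-mono _ _

value-at : ∀ c x {k l} → 1 ℕ.≤ k → k ℕ.< l → x k l ≡ potential c x k l - below c x k l
value-at c x {k} {l} h₁ h₂ = trans (e (x k l) (below c x k l)) (cong (_- below c x k l) (sym (potential-below c x h₁ h₂)))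
  where
  e : ∀ x m → x ≡ x + m - m
  e = solve-∀ ℚ-ring

value-determined : ∀ c {c'} x y {k l} → (Supported x) → (Supported y) →
  potential c x k l ≡ potential c' y k l →
  potential c x (ℕ.pred k) l ≡ potential c' y (ℕ.pred k) l →
  potential c x k (ℕ.pred l) ≡ potential c' y k (ℕ.pred l) → x k l ≡ y k l
value-determined c {c'} x y {k} {l} sx sy e₁ e₂ e₃ with 1 ℕ.≤? k | k ℕ.<? l
... | yes h₁ | yes h₂ = trans (value-at c x h₁ h₂) (trans (cong₂ _-_ e₁ (cong₂ _⊔_ e₂ e₃)) (sym (value-at c' y h₁ h₂)))
... | no ¬h₁ | _ = trans (sx k l (λ h → ¬h₁ (proj₁ h))) (sym (sy k l (λ h → ¬h₁ (proj₁ h))))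
... | yes _ | no ¬h₂ = trans (sx k l (λ h → ¬h₂ (proj₂ h))) (sym (sy k l (λ h → ¬h₂ (proj₂ h))))

-- What a midpoint decomposition cannot change

mid-zero : ∀ {x y z : Point} → NonNeg y → NonNeg z → (∀ k l → x k l + x k l ≡ y k l + z k l) →
  ∀ {k l} → x k l ≡ 0ℚ → y k l ≡ 0ℚ
mid-zero ny nz e {k} {l} h = +-zero-split (ny k l) (nz k l) (trans (sym (e k l)) (cong₂ _+_ h h))

mid-supported : ∀ {x y z : Point} → NonNeg y → NonNeg z → (∀ k l → x k l + x k l ≡ y k l + z k l) →
  Supported x → Supported y
mid-supported {x} {y} {z} ny nz e sx k l h = mid-zero {x} {y} {z} ny nz e (sx k l h)

module _ {c x y z} (hc : Markers c) (hx : In c x) (hy : In c y) (hz : In c z)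
         (e : ∀ k l → x k l + x k l ≡ y k l + z k l) where

  -- The value `c 0` at a cell above the diagonal forces a zero entry and the value `c 0` at both
  -- predecessors, and `y` inherits the zeros of `x`.
  mid-bottom : ∀ k l → potential c x k l ≡ c 0 → potential c y k l ≡ c 0
  mid-bottom = grid-ind _ (λ l _ → potential-zero c y l)
    (λ le h → trans (potential-diag c y le) (trans (sym (potential-diag c x le)) h))
    step
    where
    step : ∀ {k l} → k ℕ.< l →
      (potential c x k (suc l) ≡ c 0 → potential c y k (suc l) ≡ c 0) →
      (potential c x (suc k) l ≡ c 0 → potential c y (suc k) l ≡ c 0) →
      potential c x (suc k) (suc l) ≡ c 0 → potential c y (suc k) (suc l) ≡ c 0
    step {k} {l} lt ih₁ ih₂ h =
      trans (potential-step c y lt) (trans (cong₂ _+_ (mid-zero {x} {y} {z} (proj₁ hy) (proj₁ hz) e x0)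
        (trans (cong₂ _⊔_ (ih₁ b₁) (ih₂ b₂)) (⊔-idem (c 0)))) (+-identityˡ (c 0)))
      where
      bel : below c x (suc k) (suc l) ≤ c 0
      bel = ≤-trans (potential-below-≤ hc (proj₁ hx) (s≤s z≤n) (s≤s lt)) (≤-reflexive h)
      b₁ : potential c x k (suc l) ≡ c 0
      b₁ = ≤-antisym (≤-trans (p≤p⊔q _ _) bel) (c0≤potential hc (proj₁ hx) k (suc l))
      b₂ : potential c x (suc k) l ≡ c 0
      b₂ = ≤-antisym (≤-trans (p≤q⊔p (potential c x k (suc l)) _) bel) (c0≤potential hc (proj₁ hx) (suc k) l)
      x0 : x (suc k) (suc l) ≡ 0ℚ
      x0 = +-cancelʳ-≡ (c 0) (trans (cong (x (suc k) (suc l) +_) (sym (trans (cong₂ _⊔_ b₁ b₂) (⊔-idem (c 0)))))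
             (trans (sym (potential-step c x lt)) (trans h (sym (+-identityˡ (c 0))))))

  -- By convexity the potentials of `y` and `z` sum to at least `t + t`, and neither exceeds `t`.
  mid-top : ∀ k l {t} → c l ≤ t → potential c x k l ≡ t → potential c y k l ≡ t
  mid-top k l {t} ht h = ≤-antisym (≤-trans (proj₂ hy k l) ht)
    (lin-≤ (potential-midpoint c {x} {y} {z} e k l ⊞ ≤-trans (proj₂ hz k l) ht
              ⊞ ≤-reflexive (sym h) ⊞ ≤-reflexive (sym h)) (eq (potential c x k l) (potential c y k l) (potential c z k l) t))
    where
    eq : ∀ x y z t → y + (x + x + z + t + t) ≡ t + (y + z + t + x + x)
    eq = solve-∀ ℚ-ring

-- Dyck paths and the potential

endpt-≥ : ∀ p ss → proj₁ p ℕ.≤ proj₁ (endpt p ss)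
endpt-≥ p         []           = ℕ.≤-refl
endpt-≥ (i , j) (down  ∷ ss) = ℕ.≤-trans (ℕ.n≤1+n i) (endpt-≥ (suc i , j) ss)
endpt-≥ (i , j) (right ∷ ss) = endpt-≥ (i , suc j) ss

endpt-All : ∀ {P : ℕ × ℕ → Set} p ss → All P (walk p ss) → P (endpt p ss)
endpt-All p []       (h ∷ []) = h
endpt-All p (s ∷ ss) (h ∷ hs) = endpt-All (next s p) ss hs

start-All : ∀ {P : ℕ × ℕ → Set} p ss → All P (walk p ss) → P p
start-All p []       (h ∷ _) = h
start-All p (s ∷ ss) (h ∷ _) = h

midpoint-double : ∀ {p q r} → p ≡ (q + r) * ½ → p + p ≡ q + r
midpoint-double {p} {q} {r} e = trans (cong₂ _+_ e e) (trans (sym (*-distribˡ-+ (q + r) ½ ½)) (*-identityʳ (q + r)))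

double-midpoint : ∀ {p q r} → p + p ≡ q + r → p ≡ (q + r) * ½
double-midpoint {p} e = trans (sym (*-identityʳ p)) (trans (*-distribˡ-+ p ½ ½) (trans (sym (*-distribʳ-+ ½ p p)) (cong (_* ½) e)))

-- `R-up` and `R-left` keep the predecessors of a cell inside the region until row zero or the
-- diagonal is reached, so paths can be traced backwards. The index sets of both types have this
-- shape.
record Region : Set₁ where
  field
    R      : ℕ → ℕ → Set
    R?     : ∀ k l → Dec (R k l)
    R-pos  : ∀ {k l} → R k l → 1 ℕ.≤ k
    R-lt   : ∀ {k l} → R k l → k ℕ.< l
    R-up   : ∀ {k l} → 1 ℕ.≤ k → R (suc k) l → R k l
    R-left : ∀ {k l} → k ℕ.< l → R k (suc l) → R k l

module Extension (𝓡 : Region) where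

  open Region 𝓡

  R² : ℕ × ℕ → Set
  R² p = R (proj₁ p) (proj₂ p)

  ext : Point → Point
  ext x k l with R? k l
  ... | yes _ = x k l
  ... | no  _ = 0ℚ

  ext-in : ∀ x {k l} → R k l → ext x k l ≡ x k l
  ext-in x {k} {l} r with R? k l
  ... | yes _ = refl
  ... | no ¬r = ⊥-elim (¬r r)

  ext-out : ∀ x {k l} → ¬ R k l → ext x k l ≡ 0ℚ
  ext-out x {k} {l} ¬r with R? k l
  ... | yes r = ⊥-elim (¬r r)
  ... | no  _ = refl

  ext-supported : ∀ x → Supported (ext x)
  ext-supported x k l h = ext-out x (λ r → h (R-pos r , R-lt r))

  ext-id : ∀ x → (∀ {k l} → ¬ R k l → x k l ≡ 0ℚ) → ∀ k l → ext x k l ≡ x k l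
  ext-id x h k l with R? k l
  ... | yes _ = refl
  ... | no ¬r = sym (h ¬r)

  ext-nonNeg : ∀ x → (∀ k l → R k l → 0ℚ ≤ x k l) → NonNeg (ext x)
  ext-nonNeg x nn k l with R? k l
  ... | yes r = nn k l r
  ... | no  _ = ≤-refl

  module _ (c : ℕ → ℚ) (x : Point) where

    path-≤-potential : ∀ k l ss → All R² (walk (k , l) ss) →
      below c (ext x) k l + pathSum x (walk (k , l) ss)
        ≤ potential c (ext x) (proj₁ (endpt (k , l) ss)) (proj₂ (endpt (k , l) ss))
    path-≤-potential k l [] (r ∷ []) = ≤-reflexive (trans (e (below c (ext x) k l) (x k l))
      (trans (cong (_+ below c (ext x) k l) (sym (ext-in x r))) (sym (potential-below c (ext x) (R-pos r) (R-lt r)))))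
      where
      e : ∀ m x → m + (x + 0ℚ) ≡ x + m
      e = solve-∀ ℚ-ring
    path-≤-potential k l (s ∷ ss) (r ∷ rs) = ≤-trans (≤-reflexive e')
      (≤-trans (+-monoˡ-≤ S (step s)) (path-≤-potential (proj₁ (next s (k , l))) (proj₂ (next s (k , l))) ss rs))
      where
      S : ℚ
      S = pathSum x (walk (next s (k , l)) ss)
      e : ∀ m x S → m + (x + S) ≡ x + m + S
      e = solve-∀ ℚ-ring
      e' : below c (ext x) k l + (x k l + S) ≡ potential c (ext x) k l + S
      e' = trans (e (below c (ext x) k l) (x k l) S)
        (cong (_+ S) (trans (cong (_+ below c (ext x) k l) (sym (ext-in x r))) (sym (potential-below c (ext x) (R-pos r) (R-lt r)))))
      step : ∀ s → potential c (ext x) k l ≤ below c (ext x) (proj₁ (next s (k , l))) (proj₂ (next s (k , l)))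
      step down  = p≤p⊔q (potential c (ext x) k l) _
      step right = p≤q⊔p (potential c (ext x) (ℕ.pred k) (suc l)) (potential c (ext x) k l)

    start-≤-potential : ∀ i ss → All R² (walk (start i) ss) →
      c i + pathSum x (walk (start i) ss)
        ≤ potential c (ext x) (proj₁ (endpt (start i) ss)) (proj₂ (endpt (start i) ss))
    start-≤-potential i ss rs = ≤-trans
      (+-monoˡ-≤ (pathSum x (walk (start i) ss)) (≤-trans (≤-reflexive (sym (potential-diag c (ext x) (ℕ.≤-refl {i}))))
        (p≤q⊔p (potential c (ext x) (ℕ.pred i) (suc i)) (potential c (ext x) i i))))
      (path-≤-potential i (suc i) ss rs)

    module _ (hc : Markers c) (nn : ∀ k l → R k l → 0ℚ ≤ x k l)
      (End : ℕ × ℕ → Set) (B : ℕ × ℕ → ℚ)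
      (bounded : ∀ i ss → All R² (walk (start i) ss) → End (endpt (start i) ss) →
        c i + pathSum x (walk (start i) ss) ≤ B (endpt (start i) ss))
      (stop : ∀ k l → R k l → R (suc k) l ⊎ (End (k , l) × (B (k , l) ≤ c l))) where

      private
        Y : ℕ → ℕ → ℚ
        Y = potential c (ext x)

        enn : NonNeg (ext x)
        enn = ext-nonNeg x nn

      -- The path is built backwards: `ss` is the part already chosen, and each maximum in the
      -- potential is resolved by prepending a step. At the diagonal the path is complete and
      -- `bounded` applies.
      below-≤-bound : ∀ k l → R k l → ∀ ss → All R² (walk (k , l) ss) → End (endpt (k , l) ss) →
        below c (ext x) k l + pathSum x (walk (k , l) ss) ≤ B (endpt (k , l) ss)
      extend : ∀ k l s → R k l → ∀ ss → All R² (walk (next s (k , l)) ss) → End (endpt (next s (k , l)) ss) →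
        Y k l + pathSum x (walk (next s (k , l)) ss) ≤ B (endpt (next s (k , l)) ss)

      below-≤-bound zero    _       r ss rs en = ⊥-elim (ℕ.1+n≰n (R-pos r))
      below-≤-bound (suc k) zero    r ss rs en = ⊥-elim (ℕ.n≮0 (R-lt r))
      below-≤-bound (suc k) (suc l) r ss rs en =
        ⊔-elim (λ m → m + pathSum x (walk (suc k , suc l) ss) ≤ B (endpt (suc k , suc l) ss)) {Y k (suc l)} {Y (suc k) l} up left
        where
        left : Y (suc k) l + pathSum x (walk (suc k , suc l) ss) ≤ B (endpt (suc k , suc l) ss)
        left with suc k ℕ.<? l
        ... | yes h = extend (suc k) l right (R-left h r) ss rs en
        ... | no ¬h with ℕ.≤-antisym (ℕ.≤-pred (R-lt r)) (ℕ.≮⇒≥ ¬h)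
        ...   | refl = subst (λ q → q + pathSum x (walk (suc k , suc l) ss) ≤ B (endpt (suc k , suc l) ss))
                         (sym (potential-diag c (ext x) (ℕ.≤-refl {l}))) (bounded (suc k) ss rs en)
        up : Y k (suc l) + pathSum x (walk (suc k , suc l) ss) ≤ B (endpt (suc k , suc l) ss)
        up = go k refl
          where
          go : ∀ k' → k' ≡ k → Y k' (suc l) + pathSum x (walk (suc k , suc l) ss) ≤ B (endpt (suc k , suc l) ss)
          -- Row zero carries only `c 0`, which the left neighbour dominates.
          go zero    _    = ≤-trans (+-monoˡ-≤ _ (≤-trans (≤-reflexive (potential-zero c (ext x) (suc l))) (c0≤potential hc enn (suc k) l))) left
          go (suc k') refl = extend (suc k') (suc l) down (R-up (s≤s z≤n) r) ss rs en
      extend k l s r ss rs en = ≤-trans (≤-reflexive e') (below-≤-bound k l r (s ∷ ss) (r ∷ rs) en)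
        where
        S : ℚ
        S = pathSum x (walk (next s (k , l)) ss)
        e : ∀ m x S → x + m + S ≡ m + (x + S)
        e = solve-∀ ℚ-ring
        e' : Y k l + S ≡ below c (ext x) k l + (x k l + S)
        e' = trans (cong (_+ S) (trans (potential-below c (ext x) (R-pos r) (R-lt r)) (cong (_+ below c (ext x) k l) (ext-in x r))))
               (e (below c (ext x) k l) (x k l) S)

      -- Moving down the column does not lower the potential, and by `stop` it ends at a cell where
      -- a Dyck path may end. The fuel `d` bounds the distance to the diagonal.
      potential-≤-on-region : ∀ d {k l} → l ℕ.≤ k ℕ.+ d → R k l → Y k l ≤ c l
      potential-≤-on-region zero {k} {l} h r = ⊥-elim (ℕ.<⇒≱ (R-lt r) (subst (l ℕ.≤_) (ℕ.+-identityʳ k) h))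
      potential-≤-on-region (suc d) {k} {l} h r with stop k l r
      ... | inj₁ r' = ≤-trans (≤-trans (p≤p⊔q (Y k l) _) (potential-below-≤ hc enn (R-pos r') (R-lt r')))
                        (potential-≤-on-region d (subst (l ℕ.≤_) (ℕ.+-suc k d) h) r')
      ... | inj₂ (en , le) = ≤-trans (≤-reflexive e')
              (≤-trans (below-≤-bound k l r [] (r ∷ []) en) le)
        where
        e : ∀ m x → x + m ≡ m + (x + 0ℚ)
        e = solve-∀ ℚ-ring
        e' : Y k l ≡ below c (ext x) k l + (x k l + 0ℚ)
        e' = trans (potential-below c (ext x) (R-pos r) (R-lt r)) (trans (cong (_+ below c (ext x) k l) (ext-in x r))
               (e (below c (ext x) k l) (x k l)))

      ext-In : In c (ext x)
      ext-In = enn , grid-ind _ (λ l → ≤-trans (≤-reflexive (potential-zero c (ext x) l)) (markers-mono hc z≤n)) (λ le → ≤-reflexive (potential-diag c (ext x) le)) step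
        where
        step : ∀ {k l} → k ℕ.< l → Y k (suc l) ≤ c (suc l) → Y (suc k) l ≤ c l → Y (suc k) (suc l) ≤ c (suc l)
        step {k} {l} lt h₁ h₂ with R? (suc k) (suc l)
        ... | yes r = potential-≤-on-region (suc l) (ℕ.m≤n+m (suc l) (suc k)) r
        -- Off the region the entry is zero, so the value comes from a predecessor and its bound is
        -- inherited.
        ... | no ¬r = ≤-trans (≤-reflexive (trans (potential-step c (ext x) lt)
                        (trans (cong (_+ (Y k (suc l) ⊔ Y (suc k) l)) (ext-out x ¬r)) (+-identityˡ (Y k (suc l) ⊔ Y (suc k) l)))))
                        (⊔-least (Y k (suc l)) (Y (suc k) l) h₁ (≤-trans h₂ (hc l)))

  module _ (P : Point → Set) (c : ℕ → ℚ)
    (to : ∀ x → P x → In c (ext x)) (from : ∀ x → In c (ext x) → P x) where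

    Vertex : Point → Set
    Vertex x = P x × (∀ y z → P y → P z → (∀ i j → R i j → x i j ≡ (y i j + z i j) * ½) →
      ∀ i j → R i j → y i j ≡ x i j)

    -- Competitors on the grid vanish off the region together with `ext x`, hence are themselves
    -- extensions of points satisfying `P`.
    vertex⇒ : ∀ x → Vertex x → IsVertex c (ext x)
    vertex⇒ x (px , ex) = to x px , λ y z hy hz e →
      let outy : ∀ {k l} → ¬ R k l → y k l ≡ 0ℚ
          outy ¬r = mid-zero {ext x} {y} {z} (proj₁ hy) (proj₁ hz) e (ext-out x ¬r)
          outz : ∀ {k l} → ¬ R k l → z k l ≡ 0ℚ
          outz {k} {l} ¬r = mid-zero {ext x} {z} {y} (proj₁ hz) (proj₁ hy)
                      (λ k l → trans (e k l) (+-comm (y k l) (z k l))) (ext-out x ¬r)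
          py = from y (In-cong (λ _ → refl) (λ k l → sym (ext-id y outy k l)) hy)
          pz = from z (In-cong (λ _ → refl) (λ k l → sym (ext-id z outz k l)) hz)
          eq = ex y z py pz (λ i j r → double-midpoint {x i j} {y i j} {z i j}
                 (trans (sym (cong₂ _+_ (ext-in x r) (ext-in x r))) (e i j)))
      in λ k l → conclude y outy eq k l
      where
      conclude : ∀ y → (∀ {k l} → ¬ R k l → y k l ≡ 0ℚ) → (∀ i j → R i j → y i j ≡ x i j) →
        ∀ k l → y k l ≡ ext x k l
      conclude y out eq k l with R? k l
      ... | yes r = eq k l r
      ... | no ¬r = out ¬r

    vertex⇐ : ∀ x → IsVertex c (ext x) → Vertex x
    vertex⇐ x (hx , ex) = from x hx , λ y z py pz e i j r →
      trans (sym (ext-in y r)) (trans (ex (ext y) (ext z) (to y py) (to z pz) (double y z e) i j) (ext-in x r))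
      where
      double : ∀ y z → (∀ i j → R i j → x i j ≡ (y i j + z i j) * ½) →
        ∀ k l → ext x k l + ext x k l ≡ ext y k l + ext z k l
      double y z e k l with R? k l
      ... | yes r = midpoint-double {x k l} {y k l} {z k l} (e k l r)
      ... | no ¬r = refl

-- The polytopes in terms of the potential

-- Marker differences telescope. The limit `N` accommodates type C, where the markers follow the
-- weights only up to `n`.
rsumFrom-markers : ∀ {c : ℕ → ℚ} {a N} → (∀ j → 1 ℕ.≤ j → j ℕ.≤ N → c (suc j) ≡ c j + ℕ→ℚ (a j)) →
  ∀ i len → 1 ℕ.≤ i → i ℕ.+ len ℕ.≤ suc N → c (i ℕ.+ len) ≡ c i + ℕ→ℚ (rsumFrom a i len)
rsumFrom-markers {c} hw i zero 1≤i le = trans (cong c (ℕ.+-identityʳ i)) (sym (+-identityʳ (c i)))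
rsumFrom-markers {c} {a} {N} hw i (suc len) 1≤i le =
  trans (cong c (ℕ.+-suc i len))
  (trans (rsumFrom-markers {c} {a} {N} hw (suc i) len (s≤s z≤n) (subst (ℕ._≤ suc N) (ℕ.+-suc i len) le))
  (trans (cong (_+ ℕ→ℚ (rsumFrom a (suc i) len)) (hw i 1≤i (ℕ.≤-trans (ℕ.m≤m+n i len) (ℕ.≤-pred (subst (ℕ._≤ suc N) (ℕ.+-suc i len) le)))))
  (trans (+-assoc (c i) (ℕ→ℚ (a i)) _) (cong (c i +_) (sym (ℕ→ℚ-+ (a i) (rsumFrom a (suc i) len)))))))

rsum-markers : ∀ {c : ℕ → ℚ} {a N} → (∀ j → 1 ℕ.≤ j → j ℕ.≤ N → c (suc j) ≡ c j + ℕ→ℚ (a j)) →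
  ∀ {i k} → 1 ℕ.≤ i → i ℕ.≤ k → k ℕ.≤ N → c (suc k) ≡ c i + ℕ→ℚ (rsum a i k)
rsum-markers {c} {a} {N} hw {i} {k} 1≤i i≤k k≤N =
  trans (cong c (sym i+)) (rsumFrom-markers {c} {a} {N} hw i (suc k ℕ.∸ i) 1≤i (subst (ℕ._≤ suc N) (sym i+) (s≤s k≤N)))
  where
  i+ : i ℕ.+ (suc k ℕ.∸ i) ≡ suc k
  i+ = ℕ.m+[n∸m]≡n (ℕ.≤-trans i≤k (ℕ.n≤1+n k))

cancel-≤ : ∀ c {p q r} → r ≡ c + q → c + p ≤ r → p ≤ q
cancel-≤ c {p} {q} refl h = lin-≤ h (e c p q)
  where
  e : ∀ c p q → q + (c + p) ≡ p + (c + q)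
  e = solve-∀ ℚ-ring

IdxA? : ∀ m k l → Dec (IdxA m k l)
IdxA? m k l = (1 ℕ.≤? k) ×-dec (k ℕ.<? l) ×-dec (l ℕ.≤? m)

regionA : ℕ → Region
regionA m = record
  { R = IdxA m ; R? = IdxA? m ; R-pos = proj₁ ; R-lt = λ r → proj₁ (proj₂ r)
  ; R-up = λ h (_ , lt , le) → h , ℕ.<-trans (ℕ.n<1+n _) lt , le
  ; R-left = λ h (p , _ , le) → p , h , ℕ.≤-trans (ℕ.n≤1+n _) le }

IdxA-stop : ∀ {m k l} → IdxA m k l → IdxA m (suc k) l ⊎ (l ≡ suc k)
IdxA-stop {m} {k} {l} (p , lt , le) with suc k ℕ.<? l
... | yes h = inj₁ (s≤s z≤n , h , le)
... | no ¬h = inj₂ (ℕ.≤-antisym (ℕ.≮⇒≥ ¬h) lt)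

module TypeA (m : ℕ) where

  open Extension (regionA m)

  module _ (b : ℕ → ℕ) (c : ℕ → ℚ) (hc : Markers c) (hw : ∀ j → 1 ℕ.≤ j → c (suc j) ≡ c j + ℕ→ℚ (b j)) where

    private
      weight : ∀ i k → 1 ℕ.≤ i → i ℕ.≤ k → c (suc k) ≡ c i + ℕ→ℚ (rsum b i k)
      weight i k h₁ h₂ = rsum-markers {c} {b} {k} (λ j h _ → hw j h) h₁ h₂ ℕ.≤-refl

    InPA⇒In : ∀ x → InPA m b x → In c (ext x)
    InPA⇒In x (nn , up) = ext-In c x hc nn (λ p → proj₂ p ≡ suc (proj₁ p)) (λ p → c (suc (proj₁ p)))
      (λ i ss rs en → ≤-trans (+-monoʳ-≤ (c i) (up i ss (rs , en)))
        (≤-reflexive (sym (weight i _ (proj₁ (start-All (start i) ss rs)) (endpt-≥ (start i) ss)))))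
      (λ k l r → Sum.map₂ (λ e → e , ≤-reflexive (cong c (sym e))) (IdxA-stop r))

    In⇒InPA : ∀ x → In c (ext x) → InPA m b x
    In⇒InPA x (nn , up) =
      (λ i j r → subst (0ℚ ≤_) (ext-in x r) (nn i j)) ,
      (λ i ss (rs , en) → cancel-≤ (c i) (weight i _ (proj₁ (start-All (start i) ss rs)) (endpt-≥ (start i) ss))
        (≤-trans (start-≤-potential c x i ss rs) (≤-trans (up (proj₁ (endpt (start i) ss)) (proj₂ (endpt (start i) ss))) (≤-reflexive (cong c en)))))

    IsVertexA⇒ : ∀ x → IsVertexA m b x → IsVertex c (ext x)
    IsVertexA⇒ = vertex⇒ (InPA m b) c InPA⇒In In⇒InPA

    IsVertexA⇐ : ∀ x → IsVertex c (ext x) → IsVertexA m b x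
    IsVertexA⇐ = vertex⇐ (InPA m b) c InPA⇒In In⇒InPA

-- The type C triangle

IdxC? : ∀ n k l → Dec (IdxC n k l)
IdxC? n k l = (1 ℕ.≤? k) ×-dec (k ℕ.<? l) ×-dec (k ℕ.+ l ℕ.≤? 2 ℕ.* n ℕ.+ 1)

n+sn : ∀ n → n ℕ.+ suc n ≡ 2 ℕ.* n ℕ.+ 1
n+sn n = trans (ℕ.+-suc n n) (trans (cong (λ t → suc (n ℕ.+ t)) (sym (ℕ.+-identityʳ n))) (ℕ.+-comm 1 (2 ℕ.* n)))

IdxC-≤n : ∀ {n k l} → IdxC n k l → k ℕ.≤ n
IdxC-≤n {n} {k} {l} (_ , lt , le) with k ℕ.≤? n
... | yes h = h
... | no ¬h = ⊥-elim (ℕ.<⇒≱ (subst (ℕ._< k ℕ.+ l) e (ℕ.+-mono-<-≤ (ℕ.≰⇒> ¬h) (ℕ.≤-trans (s≤s (ℕ.<⇒≤ (ℕ.≰⇒> ¬h))) lt))) le)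
  where
  e : n ℕ.+ suc n ≡ 2 ℕ.* n ℕ.+ 1
  e = n+sn n

regionC : ℕ → Region
regionC n = record
  { R = IdxC n ; R? = IdxC? n ; R-pos = proj₁ ; R-lt = λ r → proj₁ (proj₂ r)
  ; R-up = λ h (_ , lt , le) → h , ℕ.<-trans (ℕ.n<1+n _) lt , ℕ.≤-trans (ℕ.n≤1+n _) le
  ; R-left = λ {k} {l} h (p , _ , le) → p , h , ℕ.≤-trans (ℕ.+-monoʳ-≤ k (ℕ.n≤1+n l)) le }

-- A cell of the antidiagonal has `k ≤ n`, hence lies in a column `l ≥ suc n`. Monotone markers
-- there are at least `c (suc n)`, the bound for type C paths that stop on the antidiagonal.
IdxC-stop : ∀ {n k l} → IdxC n k l →
  IdxC n (suc k) l ⊎ (l ≡ suc k) ⊎ (k ℕ.+ l ≡ 2 ℕ.* n ℕ.+ 1 × suc n ℕ.≤ l)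
IdxC-stop {n} {k} {l} r@(p , lt , le) with l ℕ.≟ suc k | suc k ℕ.+ l ℕ.≤? 2 ℕ.* n ℕ.+ 1
... | yes e | _     = inj₂ (inj₁ e)
... | no ¬e | yes h = inj₁ (s≤s z≤n , ℕ.≤∧≢⇒< lt (λ e → ¬e (sym e)) , h)
... | no ¬e | no ¬h = inj₂ (inj₂ (e , n<l))
  where
  e : k ℕ.+ l ≡ 2 ℕ.* n ℕ.+ 1
  e = ℕ.≤-antisym le (ℕ.≤-pred (ℕ.≰⇒> ¬h))
  n<l : suc n ℕ.≤ l
  n<l = ℕ.+-cancelˡ-≤ n (suc n) l (ℕ.≤-trans (ℕ.≤-reflexive (trans (n+sn n) (sym e))) (ℕ.+-monoˡ-≤ l (IdxC-≤n r)))

module TypeC (n : ℕ) where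

  open Extension (regionC n)

  module _ (a : ℕ → ℕ) (c : ℕ → ℚ) (hc : Markers c)
    (hw : ∀ j → 1 ℕ.≤ j → j ℕ.≤ n → c (suc j) ≡ c j + ℕ→ℚ (a j)) (top : ∀ l → c l ≤ c (suc n)) where

    private
      bound : ℕ × ℕ → ℚ
      bound p with proj₂ p ℕ.≟ suc (proj₁ p)
      ... | yes _ = c (suc (proj₁ p))
      ... | no  _ = c (suc n)

      bound-MC : ∀ i ss → All R² (walk (start i) ss) → bound (endpt (start i) ss) ≡ c i + ℕ→ℚ (MC n a i ss)
      bound-MC i ss rs with proj₂ (endpt (start i) ss) ℕ.≟ suc (proj₁ (endpt (start i) ss))
      ... | yes _ = rsum-markers {c} {a} {n} hw (proj₁ (start-All (start i) ss rs)) (endpt-≥ (start i) ss)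
                      (IdxC-≤n (endpt-All {R²} (start i) ss rs))
      ... | no  _ = rsum-markers {c} {a} {n} hw (proj₁ (start-All (start i) ss rs))
                      (IdxC-≤n (start-All (start i) ss rs)) ℕ.≤-refl

      c≤bound : ∀ p → c (proj₂ p) ≤ bound p
      c≤bound p with proj₂ p ℕ.≟ suc (proj₁ p)
      ... | yes e = ≤-reflexive (cong c e)
      ... | no  _ = top (proj₂ p)

      bound≤ : ∀ k l → l ≡ suc k ⊎ suc n ℕ.≤ l → bound (k , l) ≤ c l
      bound≤ k l h with l ℕ.≟ suc k
      bound≤ k l h        | yes e = ≤-reflexive (cong c (sym e))
      bound≤ k l (inj₁ e) | no ¬e = ⊥-elim (¬e e)
      bound≤ k l (inj₂ h) | no _  = markers-mono hc h

    InPC⇒In : ∀ x → InPC n a x → In c (ext x)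
    InPC⇒In x (nn , up) = ext-In c x hc nn
      (λ p → proj₂ p ≡ suc (proj₁ p) ⊎ proj₁ p ℕ.+ proj₂ p ≡ 2 ℕ.* n ℕ.+ 1) bound
      (λ i ss rs en → ≤-trans (+-monoʳ-≤ (c i) (up i ss (rs , en))) (≤-reflexive (sym (bound-MC i ss rs))))
      (λ k l r → Sum.map₂ (finish k l) (IdxC-stop r))
      where
      finish : ∀ k l → l ≡ suc k ⊎ (k ℕ.+ l ≡ 2 ℕ.* n ℕ.+ 1 × suc n ℕ.≤ l) →
        (l ≡ suc k ⊎ k ℕ.+ l ≡ 2 ℕ.* n ℕ.+ 1) × (bound (k , l) ≤ c l)
      finish k l (inj₁ e) = inj₁ e , bound≤ k l (inj₁ e)
      finish k l (inj₂ (e , h)) = inj₂ e , bound≤ k l (inj₂ h)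

    In⇒InPC : ∀ x → In c (ext x) → InPC n a x
    In⇒InPC x (nn , up) =
      (λ i j r → subst (0ℚ ≤_) (ext-in x r) (nn i j)) ,
      (λ i ss (rs , _) → cancel-≤ (c i) (bound-MC i ss rs)
        (≤-trans (start-≤-potential c x i ss rs) (≤-trans (up (proj₁ (endpt (start i) ss)) (proj₂ (endpt (start i) ss))) (c≤bound (endpt (start i) ss)))))

    IsVertexC⇒ : ∀ x → IsVertexC n a x → IsVertex c (ext x)
    IsVertexC⇒ = vertex⇒ (InPC n a) c InPC⇒In In⇒InPC

    IsVertexC⇐ : ∀ x → IsVertex c (ext x) → IsVertexC n a x
    IsVertexC⇐ = vertex⇐ (InPC n a) c InPC⇒In In⇒InPC

-- Antichains

-- The markers of the fundamental weight with index `i`: one jump, between `i` and `suc i`.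
step : ℕ → ℕ → ℚ
step i k with i ℕ.<? k
... | yes _ = 1ℚ
... | no  _ = 0ℚ

step-high : ∀ {i k} → i ℕ.< k → step i k ≡ 1ℚ
step-high {i} {k} h with i ℕ.<? k
... | yes _ = refl
... | no ¬h = ⊥-elim (¬h h)

step-low : ∀ {i k} → k ℕ.≤ i → step i k ≡ 0ℚ
step-low {i} {k} h with i ℕ.<? k
... | yes h' = ⊥-elim (ℕ.<⇒≱ h' h)
... | no  _  = refl

step-markers : ∀ i → Markers (step i)
step-markers i k with i ℕ.<? k
... | yes h = ≤-reflexive (sym (step-high (ℕ.≤-trans h (ℕ.n≤1+n k))))
... | no ¬h with i ℕ.<? suc k
...   | yes _ = 0≤1
...   | no  _ = ≤-refl

abstract

  χℚ : PairSet → Point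
  χℚ A k l = ℕ→ℚ (χ A k l)

  χℚ-def : ∀ A k l → χℚ A k l ≡ ℕ→ℚ (χ A k l)
  χℚ-def A k l = refl

χℚ-true : ∀ A {k l} → A k l ≡ true → χℚ A k l ≡ 1ℚ
χℚ-true A {k} {l} h = trans (χℚ-def A k l) (cong (λ b → ℕ→ℚ (if b then 1 else 0)) h)

χℚ-false : ∀ A {k l} → A k l ≡ false → χℚ A k l ≡ 0ℚ
χℚ-false A {k} {l} h = trans (χℚ-def A k l) (cong (λ b → ℕ→ℚ (if b then 1 else 0)) h)

χℚ-∉ : ∀ A {k l} → ¬ (A k l ≡ true) → χℚ A k l ≡ 0ℚ
χℚ-∉ A h = χℚ-false A (¬-not h)

0≤χℚ : ∀ A k l → 0ℚ ≤ χℚ A k l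
0≤χℚ A k l = subst (0ℚ ≤_) (sym (χℚ-def A k l)) (0≤ℕ→ℚ (χ A k l))

_⊆Q_ : PairSet → ℕ → Set
A ⊆Q i = ∀ {k l} → A k l ≡ true → (1 ℕ.≤ k) × (k ℕ.≤ i) × (i ℕ.< l)

χℚ-supported : ∀ {A i} → A ⊆Q i → Supported (χℚ A)
χℚ-supported {A} {i} hQ k l h = χℚ-∉ A (λ t → let (p , q , r) = hQ t in h (p , ℕ.≤-<-trans q r))

module _ {i A} (hA : IsAntichain A) (hQ : A ⊆Q i) where

  -- The potential of χ_A is the indicator function of the up-set generated by A and the markers beyond i.
  potential-χ : ∀ k l → (potential (step i) (χℚ A) k l ≡ 0ℚ) ⊎
    (potential (step i) (χℚ A) k l ≡ 1ℚ × (i ℕ.< l) ×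
      ((i ℕ.< k) ⊎ ∃ λ p → ∃ λ q → A p q ≡ true × p ℕ.≤ k × q ℕ.≤ l))
  potential-χ = grid-ind _ (λ l → inj₁ (trans (potential-zero (step i) (χℚ A) l) (step-low {i} z≤n))) diag next'
    where
    Good : ℕ → ℕ → Set
    Good k l = (potential (step i) (χℚ A) k l ≡ 0ℚ) ⊎
      (potential (step i) (χℚ A) k l ≡ 1ℚ × (i ℕ.< l) ×
        ((i ℕ.< k) ⊎ ∃ λ p → ∃ λ q → A p q ≡ true × p ℕ.≤ k × q ℕ.≤ l))
    diag : ∀ {k l} → l ℕ.≤ k → Good k l
    diag {k} {l} le with i ℕ.<? l
    ... | yes h = inj₂ (trans (potential-diag (step i) (χℚ A) le) (step-high h) , h , inj₁ (ℕ.≤-trans h le))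
    ... | no ¬h = inj₁ (trans (potential-diag (step i) (χℚ A) le) (step-low (ℕ.≮⇒≥ ¬h)))
    next' : ∀ {k l} → k ℕ.< l → Good k (suc l) → Good (suc k) l → Good (suc k) (suc l)
    next' {k} {l} lt g₁ g₂ with A (suc k) (suc l) in eqA
    -- Both predecessors have potential 0: an element of `A` below either of them would be
    -- comparable to, and different from, the present element.
    ... | true = inj₂ (trans (potential-step (step i) (χℚ A) lt)
                   (cong₂ _+_ (χℚ-true A eqA) (trans (cong₂ _⊔_ (z₁ g₁) (z₂ g₂)) (⊔-idem 0ℚ)))
                 , proj₂ (proj₂ (hQ eqA)) , inj₂ (suc k , suc l , eqA , ℕ.≤-refl , ℕ.≤-refl))
      where
      z₁ : Good k (suc l) → potential (step i) (χℚ A) k (suc l) ≡ 0ℚ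
      z₁ (inj₁ e) = e
      z₁ (inj₂ (_ , _ , inj₁ h)) = ⊥-elim (ℕ.<⇒≱ h (ℕ.≤-trans (ℕ.n≤1+n k) (proj₁ (proj₂ (hQ eqA)))))
      z₁ (inj₂ (_ , _ , inj₂ (p , q , t , h₁ , h₂)))
        with hA (p , q) (suc k , suc l) t eqA (ℕ.≤-trans h₁ (ℕ.n≤1+n k) , h₂)
      ... | refl = ⊥-elim (ℕ.1+n≰n h₁)
      z₂ : Good (suc k) l → potential (step i) (χℚ A) (suc k) l ≡ 0ℚ
      z₂ (inj₁ e) = e
      z₂ (inj₂ (_ , _ , inj₁ h)) = ⊥-elim (ℕ.<⇒≱ h (proj₁ (proj₂ (hQ eqA))))
      z₂ (inj₂ (_ , _ , inj₂ (p , q , t , h₁ , h₂)))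
        with hA (p , q) (suc k , suc l) t eqA (h₁ , ℕ.≤-trans h₂ (ℕ.n≤1+n l))
      ... | refl = ⊥-elim (ℕ.1+n≰n h₂)
    ... | false = combine g₁ g₂
      where
      e₀ : ∀ {p q} → potential (step i) (χℚ A) k (suc l) ≡ p → potential (step i) (χℚ A) (suc k) l ≡ q →
        potential (step i) (χℚ A) (suc k) (suc l) ≡ p ⊔ q
      e₀ {p} {q} e₁ e₂ = trans (potential-step (step i) (χℚ A) lt)
        (trans (cong₂ _+_ (χℚ-false A eqA) (cong₂ _⊔_ e₁ e₂)) (+-identityˡ (p ⊔ q)))
      w₁ : (i ℕ.< k) ⊎ (∃ λ p → ∃ λ q → A p q ≡ true × p ℕ.≤ k × q ℕ.≤ suc l) →
        (i ℕ.< suc k) ⊎ (∃ λ p → ∃ λ q → A p q ≡ true × p ℕ.≤ suc k × q ℕ.≤ suc l)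
      w₁ = Sum.map (λ h → ℕ.≤-trans h (ℕ.n≤1+n k)) (λ (p , q , t , h₁ , h₂) → p , q , t , ℕ.≤-trans h₁ (ℕ.n≤1+n k) , h₂)
      w₂ : (i ℕ.< suc k) ⊎ (∃ λ p → ∃ λ q → A p q ≡ true × p ℕ.≤ suc k × q ℕ.≤ l) →
        (i ℕ.< suc k) ⊎ (∃ λ p → ∃ λ q → A p q ≡ true × p ℕ.≤ suc k × q ℕ.≤ suc l)
      w₂ = Sum.map₂ (λ (p , q , t , h₁ , h₂) → p , q , t , h₁ , ℕ.≤-trans h₂ (ℕ.n≤1+n l))
      combine : Good k (suc l) → Good (suc k) l → Good (suc k) (suc l)
      combine (inj₁ e₁) (inj₁ e₂) = inj₁ (e₀ e₁ e₂)
      combine (inj₁ e₁) (inj₂ (e₂ , h , w)) = inj₂ (e₀ e₁ e₂ , ℕ.≤-trans h (ℕ.n≤1+n l) , w₂ w)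
      combine (inj₂ (e₁ , h , w)) (inj₁ e₂) = inj₂ (e₀ e₁ e₂ , h , w₁ w)
      combine (inj₂ (e₁ , h , w)) (inj₂ (e₂ , _)) = inj₂ (e₀ e₁ e₂ , h , w₁ w)

  potential-χ-01 : ∀ k l → (potential (step i) (χℚ A) k l ≡ 0ℚ) ⊎ (potential (step i) (χℚ A) k l ≡ 1ℚ)
  potential-χ-01 k l = Sum.map₂ proj₁ (potential-χ k l)

  χ-In : In (step i) (χℚ A)
  χ-In = 0≤χℚ A , bound
    where
    bound : ∀ k l → potential (step i) (χℚ A) k l ≤ step i l
    bound k l with potential-χ k l
    ... | inj₁ e = ≤-trans (≤-reflexive e) (≤-trans (≤-reflexive (sym (step-low {i} z≤n))) (markers-mono {step i} (step-markers i) {0} {l} z≤n))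
    ... | inj₂ (e , h , _) = ≤-reflexive (trans e (sym (step-high h)))

  -- The entry 1 already exhausts the cap 1 of its column, leaving 0 for the predecessors.
  potential-χ-∈ : ∀ {k l} → A k l ≡ true → (potential (step i) (χℚ A) k l ≡ 1ℚ) × (below (step i) (χℚ A) k l ≡ 0ℚ)
  potential-χ-∈ {k} {l} t = e₁ , e₂
    where
    Y : ℚ
    Y = potential (step i) (χℚ A) k l
    b : ℚ
    b = below (step i) (χℚ A) k l
    k<l : k ℕ.< l
    k<l = ℕ.≤-<-trans (proj₁ (proj₂ (hQ t))) (proj₂ (proj₂ (hQ t)))
    Y≡ : Y ≡ 1ℚ + b
    Y≡ = trans (potential-below (step i) (χℚ A) (proj₁ (hQ t)) k<l) (cong (_+ b) (χℚ-true A t))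
    0≤b : 0ℚ ≤ b
    0≤b = ≤-trans (≤-trans (≤-reflexive (sym (step-low {i} z≤n))) (c0≤potential (step-markers i) (proj₁ χ-In) (ℕ.pred k) l))
            (p≤p⊔q (potential (step i) (χℚ A) (ℕ.pred k) l) _)
    Y≤1 : Y ≤ 1ℚ
    Y≤1 = ≤-trans (proj₂ χ-In k l) (≤-reflexive (step-high (proj₂ (proj₂ (hQ t)))))
    e₂ : b ≡ 0ℚ
    e₂ = ≤-antisym (lin-≤ (≤-trans (≤-reflexive (sym Y≡)) Y≤1) (e b)) 0≤b
      where
      e : ∀ b → 0ℚ + (1ℚ + b) ≡ b + 1ℚ
      e = solve-∀ ℚ-ring
    e₁ : Y ≡ 1ℚ
    e₁ = trans Y≡ (cong (1ℚ +_) e₂)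

-- Consecutive pairs of fundamental weights

pairMarkers : ℕ → ℕ → ℚ
pairMarkers i k = step i k + step (suc i) k

pair : PairSet → PairSet → Point
pair A B k l = χℚ A k l + χℚ B k l

pairMarkers-markers : ∀ i → Markers (pairMarkers i)
pairMarkers-markers i k = +-mono-≤ (step-markers i k) (step-markers (suc i) k)

pairMarkers-low : ∀ {i k} → k ℕ.≤ i → pairMarkers i k ≡ 0ℚ
pairMarkers-low {i} h = cong₂ _+_ (step-low h) (step-low (ℕ.≤-trans h (ℕ.n≤1+n i)))

pairMarkers-mid : ∀ i → pairMarkers i (suc i) ≡ 1ℚ
pairMarkers-mid i = cong₂ _+_ (step-high (ℕ.≤-refl {suc i})) (step-low (ℕ.≤-refl {suc i}))

pairMarkers-high : ∀ {i k} → suc i ℕ.< k → pairMarkers i k ≡ 2ℚ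
pairMarkers-high {i} h = cong₂ _+_ (step-high (ℕ.<-trans (ℕ.n<1+n i) h)) (step-high h)

pairMarkers-ωω : ∀ i j → pairMarkers i (suc j) ≡ pairMarkers i j + ℕ→ℚ (ωω i j)
pairMarkers-ωω i j with j ℕ.≟ i | j ℕ.≟ suc i
... | yes refl | _ = trans (pairMarkers-mid i) (cong (_+ 1ℚ) (sym (pairMarkers-low (ℕ.≤-refl {i}))))
... | no _ | yes refl = trans (pairMarkers-high (ℕ.≤-refl {suc (suc i)})) (cong (_+ 1ℚ) (sym (pairMarkers-mid i)))
... | no j≢i | no j≢si with ℕ.<-cmp j i
...   | tri< j<i _ _ = trans (pairMarkers-low j<i) (cong (_+ 0ℚ) (sym (pairMarkers-low (ℕ.<⇒≤ j<i))))

...   | tri≈ _ j≡i _ = ⊥-elim (j≢i j≡i)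
...   | tri> _ _ i<j = trans (pairMarkers-high (ℕ.≤-trans si<j (ℕ.n≤1+n j))) (cong (_+ 0ℚ) (sym (pairMarkers-high si<j)))
  where
  si<j : suc i ℕ.< j
  si<j = ℕ.≤∧≢⇒< i<j (λ e → j≢si (sym e))

QC⇒Q : ∀ {n i A} → A ⊆QC[ n , i ] → A ⊆Q i
QC⇒Q hQ {k} {l} t = let (p , q , r , _) = hQ (k , l) t in p , q , r

QC⇒IdxC : ∀ {n i A} → A ⊆QC[ n , i ] → ∀ {k l} → A k l ≡ true → IdxC n k l
QC⇒IdxC hQ {k} {l} t = let (p , q , r , _ , s) = hQ (k , l) t in p , ℕ.≤-<-trans q r , s

QC⇒IdxA : ∀ {n i A} → A ⊆QC[ n , i ] → ∀ {k l} → A k l ≡ true → IdxA (2 ℕ.* n) k l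
QC⇒IdxA hQ {k} {l} t = let (p , q , r , s , _) = hQ (k , l) t in p , ℕ.≤-<-trans q r , s

module _ (n i : ℕ) (A B : PairSet) (hA : A ⊆QC[ n , i ]) (hB : B ⊆QC[ n , suc i ]) where

  open Extension (regionA (2 ℕ.* n))

  ext-χsum : ∀ k l → ext (χsum A B) k l ≡ pair A B k l
  ext-χsum k l with IdxA? (2 ℕ.* n) k l
  ... | yes _ = trans (ℕ→ℚ-+ (χ A k l) (χ B k l)) (sym (cong₂ _+_ (χℚ-def A k l) (χℚ-def B k l)))
  ... | no ¬r = sym (cong₂ _+_ (χℚ-∉ A (λ t → ¬r (QC⇒IdxA {n} {i} {A} hA t)))
                               (χℚ-∉ B (λ t → ¬r (QC⇒IdxA {n} {suc i} {B} hB t))))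

  pair-vertex⇒ : IsVertexA (2 ℕ.* n) (ωω i) (χsum A B) → IsVertex (pairMarkers i) (pair A B)
  pair-vertex⇒ h = IsVertex-cong (λ _ → refl) ext-χsum
    (TypeA.IsVertexA⇒ (2 ℕ.* n) (ωω i) (pairMarkers i) (pairMarkers-markers i) (λ j _ → pairMarkers-ωω i j) (χsum A B) h)

  pair-vertex⇐ : IsVertex (pairMarkers i) (pair A B) → IsVertexA (2 ℕ.* n) (ωω i) (χsum A B)
  pair-vertex⇐ h = TypeA.IsVertexA⇐ (2 ℕ.* n) (ωω i) (pairMarkers i) (pairMarkers-markers i) (λ j _ → pairMarkers-ωω i j) (χsum A B)
    (IsVertex-cong (λ _ → refl) (λ k l → sym (ext-χsum k l)) h)

pair-In : ∀ {i A B} → IsAntichain A → A ⊆Q i → IsAntichain B → B ⊆Q suc i → In (pairMarkers i) (pair A B)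
pair-In hA qA hB qB = In-+ (χ-In hA qA) (χ-In hB qB)

ℕ→ℚ-combo : ∀ n a A k l → ℕ→ℚ (combo n a A k l) ≡ sumTo (λ i → ι (a i) * χℚ (A i) k l) n
ℕ→ℚ-combo n a A k l = trans (ℕ→ℚ-rsumFrom (λ i → a i ℕ.* χ (A i) k l) n) (sumTo-cong n (λ i _ _ →
  trans (ℕ→ℚ-* (a i) (χ (A i) k l)) (sym (cong₂ _*_ (ι-def (a i)) (χℚ-def (A i) k l)))))

-- From vertices to antichains

-- The witness is the smaller of the distances from `s` to the two ends, so that a window of this
-- length fits on either side of `s`.
slack : ∀ {α β s} → α ≤ s → s ≤ β →
  ∃ λ h → 0ℚ ≤ h × α + h ≤ s × s + h ≤ β × (h ≡ 0ℚ → s ≡ α ⊎ s ≡ β)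
slack {α} {β} {s} h₁ h₂ with ≤-total (s - α) (β - s)
... | inj₁ le = s - α , p≤q⇒0≤q-p h₁ , ≤-reflexive (e₁ α s) , lin-≤ le (e₂ α s β) , λ e → inj₁ (lin-≡ e (e₃ α s))
  where
  e₁ : ∀ α s → α + (s - α) ≡ s
  e₁ = solve-∀ ℚ-ring
  e₂ : ∀ α s β → β + (s - α) ≡ s + (s - α) + (β - s)
  e₂ = solve-∀ ℚ-ring
  e₃ : ∀ α s → α + (s - α) ≡ s + 0ℚ
  e₃ = solve-∀ ℚ-ring
... | inj₂ le = β - s , p≤q⇒0≤q-p h₂ , lin-≤ le (e₂ α s β) , ≤-reflexive (e₁ β s) , λ e → inj₂ (sym (lin-≡ e (e₃ β s)))
  where
  e₁ : ∀ β s → s + (β - s) ≡ β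
  e₁ = solve-∀ ℚ-ring
  e₂ : ∀ α s β → s + (β - s) ≡ α + (β - s) + (s - α)
  e₂ = solve-∀ ℚ-ring
  e₃ : ∀ β s → s + (β - s) ≡ β + 0ℚ
  e₃ = solve-∀ ℚ-ring

module Levels {c x} (hc : Markers c) (hv : IsVertex c x) where

  private
    Y : ℕ → ℕ → ℚ
    Y = potential c x

  locate : ∀ l {s} → c 0 ≤ s → s ≤ c l → (∃ λ κ → s ≡ c κ) ⊎ (∃ λ i → c i ≤ s × s ≤ c (suc i))
  locate zero    h₁ h₂ = inj₁ (0 , ≤-antisym h₂ h₁)
  locate (suc l) {s} h₁ h₂ with ≤-total s (c l)
  ... | inj₁ h = locate l h₁ h
  ... | inj₂ h = inj₂ (l , h , h₂)

  -- id ± (clamp (s − h) h − clamp s h) fix all markers, and x is halfway between the two reparametrised points.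
  no-slack : ∀ k l i → c i ≤ Y k l → Y k l ≤ c (suc i) → ∀ h → 0ℚ ≤ h → c i + h ≤ Y k l → Y k l + h ≤ c (suc i) → h ≡ 0ℚ
  no-slack k l i h₁ h₂ h 0≤h hα hβ = h≡0
    where
    s : ℚ
    s = Y k l
    f g φ φ' : ℚ → ℚ
    f = clamp (s - h) h
    g = clamp s h
    φ r = r + f r - g r
    φ' r = r + g r - f r

    -- A clamp never increases faster than the identity, so subtracting one leaves a monotone map.
    mono : ∀ α β → Monotone (λ r → r + clamp α h r - clamp β h r)
    mono α β {r} {t} le = lin-≤ (clamp-contract β h le ⊞ clamp-mono α h le)
      (eq r t (clamp α h r) (clamp α h t) (clamp β h r) (clamp β h t))
      where
      eq : ∀ r t p p' q q' → (t + p' - q') + ((q' - q) + p) ≡ (r + p - q) + ((t - r) + p')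
      eq = solve-∀ ℚ-ring

    -- Both windows lie between the neighbouring markers `c i` and `c (suc i)`, so at any marker
    -- they are both empty or both full.
    f≡g : ∀ κ → f (c κ) ≡ g (c κ)
    f≡g κ with κ ℕ.≤? i
    ... | yes κ≤i = trans (clamp-low h (lin-≤ (hα ⊞ cκ≤) (eq s (c i) (c κ) h))) (sym (clamp-low h (≤-trans cκ≤ h₁)))
      where
      cκ≤ : c κ ≤ c i
      cκ≤ = markers-mono hc κ≤i
      eq : ∀ s α r h → (s - h) + (α + h + r) ≡ r + (s + α)
      eq = solve-∀ ℚ-ring
    ... | no κ≰i = trans (clamp-high 0≤h (≤-trans (≤-reflexive (eq s h)) (≤-trans h₂ ≤cκ)))
                         (sym (clamp-high 0≤h (≤-trans hβ ≤cκ)))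
      where
      ≤cκ : c (suc i) ≤ c κ
      ≤cκ = markers-mono hc (ℕ.≰⇒> κ≰i)
      eq : ∀ s h → s - h + h ≡ s
      eq = solve-∀ ℚ-ring

    fix : ∀ κ → φ (c κ) ≡ c κ
    fix κ = trans (cong (λ p → c κ + p - g (c κ)) (f≡g κ)) (eq (c κ) (g (c κ)))
      where
      eq : ∀ r p → r + p - p ≡ r
      eq = solve-∀ ℚ-ring
    fix' : ∀ κ → φ' (c κ) ≡ c κ
    fix' κ = trans (cong (λ p → c κ + g (c κ) - p) (f≡g κ)) (eq (c κ) (g (c κ)))
      where
      eq : ∀ r p → r + p - p ≡ r
      eq = solve-∀ ℚ-ring

    pushed : ∀ k l → push φ c x k l ≡ x k l
    pushed = proj₂ hv (push φ c x) (push φ' c x)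
      (In-cong fix (λ _ _ → refl) (push-In (mono (s - h) s) (proj₁ hv)))
      (In-cong fix' (λ _ _ → refl) (push-In (mono s (s - h)) (proj₁ hv)))
      (λ k l → eq (x k l) (below c x k l) (f (x k l + below c x k l)) (g (x k l + below c x k l)) (f (below c x k l)) (g (below c x k l)))
      where
      eq : ∀ x b p q p' q' → x + x ≡ (x + b + p - q) - (b + p' - q') + ((x + b + q - p) - (b + q' - p'))
      eq = solve-∀ ℚ-ring

    φs≡s : φ s ≡ s
    φs≡s = trans (sym (potential-push (mono (s - h) s) c x k l)) (potential-cong fix pushed k l)

    fs : f s ≡ h
    fs = trans (clamp-mid (lin-≤ 0≤h (eq₁ s h)) (≤-reflexive (eq₂ s h))) (eq₃ s h)
      where
      eq₁ : ∀ s h → s + 0ℚ ≡ s - h + h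
      eq₁ = solve-∀ ℚ-ring
      eq₂ : ∀ s h → s ≡ s - h + h
      eq₂ = solve-∀ ℚ-ring
      eq₃ : ∀ s h → s - (s - h) ≡ h
      eq₃ = solve-∀ ℚ-ring

    -- At `s` the first window is full and the second empty, so `φ s` is `s + h`; extremality made
    -- it equal to `s`.
    h≡0 : h ≡ 0ℚ
    h≡0 = lin-≡ (trans (sym (cong₂ (λ p q → s + p - q) fs (clamp-low h (≤-refl {s})))) φs≡s) (eq s h)
      where
      eq : ∀ s h → 0ℚ + (s + h - 0ℚ) ≡ h + s
      eq = solve-∀ ℚ-ring

  value-is-marker : ∀ k l → ∃ λ κ → Y k l ≡ c κ
  value-is-marker k l = Sum.[ (λ r → r) , between ]′
    (locate l (c0≤potential hc (proj₁ (proj₁ hv)) k l) (proj₂ (proj₁ hv) k l))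
    where
    between : (∃ λ i → c i ≤ Y k l × Y k l ≤ c (suc i)) → ∃ λ κ → Y k l ≡ c κ
    between (i , h₁ , h₂) =
      let (h , 0≤h , hα , hβ , close) = slack h₁ h₂
      in Sum.[ (λ e → i , e) , (λ e → suc i , e) ]′ (close (no-slack k l i h₁ h₂ h 0≤h hα hβ))

indicator : ∀ {P : Set} → Dec P → ℚ
indicator (yes _) = 1ℚ
indicator (no _)  = 0ℚ

indicator-yes : ∀ {P : Set} (d : Dec P) → P → indicator d ≡ 1ℚ
indicator-yes (yes _) _ = refl
indicator-yes (no ¬p) p = ⊥-elim (¬p p)

indicator-no : ∀ {P : Set} (d : Dec P) → ¬ P → indicator d ≡ 0ℚ
indicator-no (yes p) ¬p = ⊥-elim (¬p p)
indicator-no (no _)  _  = refl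

indicator-mono : ∀ {P Q : Set} (d : Dec P) (d' : Dec Q) → (P → Q) → indicator d ≤ indicator d'
indicator-mono (yes p) d' f = ≤-reflexive (sym (indicator-yes d' (f p)))
indicator-mono (no _) (yes _) f = 0≤1
indicator-mono (no _) (no _)  f = ≤-refl

does-true : ∀ {P : Set} (d : Dec P) → does d ≡ true → P
does-true (yes p) _ = p

-- The case of equality in the subadditivity of the maximum: when both pairs are ordered alike, one
-- side attains both maxima.
⊔-+-comonotone : ∀ {p q p' q'} → (p ≤ q × p' ≤ q') ⊎ (q ≤ p × q' ≤ p') →
  (p ⊔ q) + (p' ⊔ q') ≡ (p + p') ⊔ (q + q')
⊔-+-comonotone (inj₁ (h , h')) = trans (cong₂ _+_ (p≤q⇒p⊔q≡q h) (p≤q⇒p⊔q≡q h')) (sym (p≤q⇒p⊔q≡q (+-mono-≤ h h')))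
⊔-+-comonotone (inj₂ (h , h')) = trans (cong₂ _+_ (p≥q⇒p⊔q≡p h) (p≥q⇒p⊔q≡p h')) (sym (p≥q⇒p⊔q≡p (+-mono-≤ h h')))

-- Level sets of the potential of a vertex

module Forward (N : ℕ → ℕ) (N0 : N 0 ≡ 0) (N1 : 1 ℕ.≤ N 1) (N-suc : ∀ k → N k ℕ.≤ N (suc k))
  (x : Point) (hv : IsVertex (λ k → ι (N k)) x) (sx : Supported x) where

  c : ℕ → ℚ
  c k = ι (N k)

  hc : Markers c
  hc k = ι-mono (N-suc k)

  N-mono : ∀ {k l} → k ℕ.≤ l → N k ℕ.≤ N l
  N-mono h = ι-cancel (markers-mono {c} hc h)

  1≤N : ∀ k → 1 ℕ.≤ N (suc k)
  1≤N k = ℕ.≤-trans N1 (N-mono (s≤s z≤n))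

  Y : ℕ → ℕ → ℚ
  Y = potential c x

  hx : In c x
  hx = proj₁ hv

  Y-mono : ∀ {k k' l l'} → k ℕ.≤ k' → l ℕ.≤ l' → Y k l ≤ Y k' l'
  Y-mono = potential-mono-kl hc hx

  Y-diag : ∀ {k l} → l ℕ.≤ k → Y k l ≡ c l
  Y-diag = potential-diag c x

  value : ∀ k l → ∃ λ κ → Y k l ≡ c κ
  value = Levels.value-is-marker hc hv

  -- If the weight `i` is zero, then `c (suc i)` equals `c i` and is already reached in columns up
  -- to `i`. The condition `i < l` discards these, so that minimal elements stay in the rectangle of
  -- `i`.
  Up : ℕ → ℕ → ℕ → Set
  Up i k l = (i ℕ.< l) × (c (suc i) ≤ Y k l)

  abstract
    Up? : ∀ i k l → Dec (Up i k l)
    Up? i k l = (i ℕ.<? l) ×-dec (c (suc i) ≤? Y k l)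

  Up-mono : ∀ {i k k' l l'} → k ℕ.≤ k' → l ℕ.≤ l' → Up i k l → Up i k' l'
  Up-mono hk hl (h₁ , h₂) = ℕ.≤-trans h₁ hl , ≤-trans h₂ (Y-mono hk hl)

  Up-zero : ∀ {i l} → ¬ Up i 0 l
  Up-zero {i} {l} (_ , h) = ℕ.<⇒≱ (subst (ℕ._< N (suc i)) (sym N0) (1≤N i))
    (ι-cancel (≤-trans h (≤-reflexive (potential-zero c x l))))

  Up-diag : ∀ {i k l} → l ℕ.≤ k → i ℕ.< l → Up i k l
  Up-diag le h = h , ≤-trans (markers-mono hc h) (≤-reflexive (sym (Y-diag le)))

  Up-nested : ∀ {i k l} → Up (suc i) k l → Up i k l
  Up-nested {i} (h₁ , h₂) = ℕ.<-trans (ℕ.n<1+n i) h₁ , ≤-trans (hc (suc i)) h₂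

  Min : ℕ → ℕ → ℕ → Set
  Min i k l = (k ℕ.< l) × Up i k l × (¬ Up i (ℕ.pred k) l) × (¬ Up i k (ℕ.pred l))

  abstract
    Min? : ∀ i k l → Dec (Min i k l)
    Min? i k l = (k ℕ.<? l) ×-dec Up? i k l ×-dec ¬? (Up? i (ℕ.pred k) l) ×-dec ¬? (Up? i k (ℕ.pred l))

  A : ℕ → PairSet
  A i k l = does (Min? i k l)

  A-Min : ∀ {i k l} → A i k l ≡ true → Min i k l
  A-Min {i} {k} {l} = does-true (Min? i k l)

  A-⊆Q : ∀ {i} → A i ⊆Q i
  A-⊆Q {i} {k} {l} t = go k l (A-Min t)
    where
    go : ∀ k l → Min i k l → (1 ℕ.≤ k) × (k ℕ.≤ i) × (i ℕ.< l)
    go zero    l       (_ , u , _ , _) = ⊥-elim (Up-zero u)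
    -- If `i` were smaller than the row, the diagonal cell of this row would be in the up-set and
    -- lie weakly left of the predecessor, contradicting minimality.
    go (suc k) (suc l) (lt , u , _ , ¬u) = s≤s z≤n , ℕ.≮⇒≥ (λ i<sk → ¬u (Up-mono ℕ.≤-refl (ℕ.≤-pred lt) (Up-diag (ℕ.≤-refl {suc k}) i<sk))) , proj₁ u

  A-antichain : ∀ i → IsAntichain (A i)
  A-antichain i (k , l) (k' , l') t t' (hk , hl) = go (ℕ.m≤n⇒m<n∨m≡n hk) (ℕ.m≤n⇒m<n∨m≡n hl)
    where
    go : k ℕ.< k' ⊎ k ≡ k' → l ℕ.< l' ⊎ l ≡ l' → (k , l) ≡ (k' , l')
    go (inj₁ h) _ = ⊥-elim (proj₁ (proj₂ (proj₂ (A-Min t'))) (Up-mono (ℕ.<⇒≤pred h) hl (proj₁ (proj₂ (A-Min t)))))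
    go (inj₂ _) (inj₁ h) = ⊥-elim (proj₂ (proj₂ (proj₂ (A-Min t'))) (Up-mono hk (ℕ.<⇒≤pred h) (proj₁ (proj₂ (A-Min t)))))
    go (inj₂ e) (inj₂ e') = cong₂ _,_ e e'

  I : ℕ → ℕ → ℕ → ℚ
  I i k l = indicator (Up? i k l)

  I-yes : ∀ {i k l} → Up i k l → I i k l ≡ 1ℚ
  I-yes {i} {k} {l} = indicator-yes (Up? i k l)

  I-no : ∀ {i k l} → ¬ Up i k l → I i k l ≡ 0ℚ
  I-no {i} {k} {l} = indicator-no (Up? i k l)

  -- The indicator of an up-set jumps precisely at the cells of the set with no predecessor in it,
  -- and these are its minimal elements.
  I-step : ∀ i {k l} → k ℕ.< l → I i (suc k) (suc l) ≡ χℚ (A i) (suc k) (suc l) + (I i k (suc l) ⊔ I i (suc k) l)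
  I-step i {k} {l} lt = go (Up? i (suc k) (suc l)) (Up? i k (suc l)) (Up? i (suc k) l)
    where
    out : ¬ Min i (suc k) (suc l) → χℚ (A i) (suc k) (suc l) ≡ 0ℚ
    out ¬m = χℚ-∉ (A i) (λ t → ¬m (A-Min t))
    go : Dec (Up i (suc k) (suc l)) → Dec (Up i k (suc l)) → Dec (Up i (suc k) l) →
      I i (suc k) (suc l) ≡ χℚ (A i) (suc k) (suc l) + (I i k (suc l) ⊔ I i (suc k) l)
    go (no ¬u) _ _ = trans (I-no ¬u) (sym (cong₂ _+_ (out (λ m → ¬u (proj₁ (proj₂ m))))
      (cong₂ _⊔_ (I-no (λ u → ¬u (Up-mono (ℕ.n≤1+n k) ℕ.≤-refl u))) (I-no (λ u → ¬u (Up-mono ℕ.≤-refl (ℕ.n≤1+n l) u))))))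
    go (yes u) (yes u₁) (yes u₂) = trans (I-yes u) (sym (cong₂ _+_ (out (λ m → proj₁ (proj₂ (proj₂ m)) u₁)) (cong₂ _⊔_ (I-yes u₁) (I-yes u₂))))
    go (yes u) (yes u₁) (no ¬u₂) = trans (I-yes u) (sym (cong₂ _+_ (out (λ m → proj₁ (proj₂ (proj₂ m)) u₁)) (cong₂ _⊔_ (I-yes u₁) (I-no ¬u₂))))
    go (yes u) (no ¬u₁) (yes u₂) = trans (I-yes u) (sym (cong₂ _+_ (out (λ m → proj₂ (proj₂ (proj₂ m)) u₂)) (cong₂ _⊔_ (I-no ¬u₁) (I-yes u₂))))
    go (yes u) (no ¬u₁) (no ¬u₂) = trans (I-yes u) (sym (cong₂ _+_
      (χℚ-true (A i) (dec-true (Min? i (suc k) (suc l)) (s≤s lt , u , ¬u₁ , ¬u₂))) (cong₂ _⊔_ (I-no ¬u₁) (I-no ¬u₂))))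

  v : ℕ → Point
  v i = pair (A i) (A (suc i))

  V : ℕ → ℕ → ℕ → ℚ
  V i k l = I i k l + I (suc i) k l

  -- The two up-sets are nested, so their indicators never order two cells in opposite ways.
  I-comonotone : ∀ i k l k' l' →
    (I i k l ≤ I i k' l' × I (suc i) k l ≤ I (suc i) k' l') ⊎ (I i k' l' ≤ I i k l × I (suc i) k' l' ≤ I (suc i) k l)
  I-comonotone i k l k' l' = go (Up? (suc i) k l) (Up? (suc i) k' l') (Up? i k l)
    where
    ≤I : ∀ {j p q p' q'} → (Up j p q → Up j p' q') → I j p q ≤ I j p' q'
    ≤I {j} {p} {q} {p'} {q'} = indicator-mono (Up? j p q) (Up? j p' q')
    go : Dec (Up (suc i) k l) → Dec (Up (suc i) k' l') → Dec (Up i k l) →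
      (I i k l ≤ I i k' l' × I (suc i) k l ≤ I (suc i) k' l') ⊎ (I i k' l' ≤ I i k l × I (suc i) k' l' ≤ I (suc i) k l)
    go (yes u) _        _ = inj₂ (≤I (λ _ → Up-nested u) , ≤I (λ _ → u))
    go (no ¬u) (yes u') _ = inj₁ (≤I (λ _ → Up-nested u') , ≤I (λ _ → u'))
    go (no ¬u) (no ¬u') (yes w) = inj₂ (≤I (λ _ → w) , ≤I (λ u' → ⊥-elim (¬u' u')))
    go (no ¬u) (no ¬u') (no ¬w) = inj₁ (≤I (λ w → ⊥-elim (¬w w)) , ≤I (λ u → ⊥-elim (¬u u)))

  potential-v : ∀ i k l → potential (pairMarkers i) (v i) k l ≡ V i k l
  potential-v i = potential-unique (pairMarkers i) (v i) (V i)
    (λ l → trans (cong₂ _+_ (I-no Up-zero) (I-no Up-zero)) (sym (pairMarkers-low {i} z≤n)))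
    (λ le → cong₂ _+_ (I-diag i le) (I-diag (suc i) le))
    (λ {k} {l} lt → trans (cong₂ _+_ (I-step i lt) (I-step (suc i) lt))
       (trans (eq (χℚ (A i) (suc k) (suc l)) (χℚ (A (suc i)) (suc k) (suc l)) _ _)
         (cong (v i (suc k) (suc l) +_) (⊔-+-comonotone (I-comonotone i k (suc l) (suc k) l)))))
    where
    eq : ∀ p q r s → p + r + (q + s) ≡ p + q + (r + s)
    eq = solve-∀ ℚ-ring
    I-diag : ∀ i {k l} → l ℕ.≤ k → I i k l ≡ step i l
    I-diag i {k} {l} le = go (i ℕ.<? l)
      where
      go : Dec (i ℕ.< l) → I i k l ≡ step i l
      go (yes h) = trans (I-yes (Up-diag le h)) (sym (step-high h))
      go (no ¬h) = trans (I-no (λ u → ¬h (proj₁ u))) (sym (step-low (ℕ.≮⇒≥ ¬h)))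

  v-In : ∀ i → In (pairMarkers i) (v i)
  v-In i = pair-In (A-antichain i) A-⊆Q (A-antichain (suc i)) A-⊆Q

  v-supported : ∀ i → Supported (v i)
  v-supported i k l h = cong₂ _+_ (χℚ-supported {A i} A-⊆Q k l h) (χℚ-supported {A (suc i)} A-⊆Q k l h)

  module PairVertex (i : ℕ) (u w : Point) (hu : In (pairMarkers i) u) (hw : In (pairMarkers i) w)
    (mid : ∀ k l → v i k l + v i k l ≡ u k l + w k l) where

    e : ℕ → ℚ
    e = pairMarkers i

    U : ℕ → ℕ → ℚ
    U = potential e u

    su : Supported u
    su = mid-supported {v i} {u} {w} (proj₁ hu) (proj₁ hw) mid (v-supported i)

    bottom : ∀ k l → ¬ Up i k l → U k l ≡ V i k l
    bottom k l ¬u = trans (mid-bottom (pairMarkers-markers i) (v-In i) hu hw mid k l (trans (potential-v i k l) (trans V≡0 (sym e0))))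
        (trans e0 (sym V≡0))
      where
      e0 : e 0 ≡ 0ℚ
      e0 = pairMarkers-low {i} z≤n
      V≡0 : V i k l ≡ 0ℚ
      V≡0 = cong₂ _+_ (I-no ¬u) (I-no (λ u → ¬u (Up-nested u)))

    top : ∀ k l → V i k l ≡ e l → U k l ≡ V i k l
    top k l h = trans (mid-top (pairMarkers-markers i) (v-In i) hu hw mid k l ≤-refl (trans (potential-v i k l) h)) (sym h)

    -- In these columns `V` is either 0 or equal to the cap, and both extreme values survive every
    -- midpoint decomposition.
    agree-low : ∀ k l → l ℕ.≤ suc i → U k l ≡ V i k l
    agree-low k l le = go (Up? i k l)
      where
      go : Dec (Up i k l) → U k l ≡ V i k l
      go (no ¬u) = bottom k l ¬u
      go (yes u) = top k l (trans (cong₂ _+_ (I-yes u) (I-no (λ u' → ℕ.<⇒≱ (proj₁ u') le)))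
        (sym (trans (cong e (ℕ.≤-antisym le (proj₁ u))) (pairMarkers-mid i))))

    determined : ∀ k l → U k l ≡ V i k l → U (ℕ.pred k) l ≡ V i (ℕ.pred k) l → U k (ℕ.pred l) ≡ V i k (ℕ.pred l) → u k l ≡ v i k l
    determined k l h₁ h₂ h₃ = value-determined e {e} u (v i) su (v-supported i)
      (trans h₁ (sym (potential-v i k l))) (trans h₂ (sym (potential-v i (ℕ.pred k) l))) (trans h₃ (sym (potential-v i k (ℕ.pred l))))

    -- With equal markers the two up-sets coincide beyond column `suc i`. Hence `V` takes only
    -- extreme values, and the pair is rigid without recourse to the extremality of `x`.
    flat : N (suc (suc i)) ≡ N (suc i) → ∀ k l → u k l ≡ v i k l
    flat eN k l = determined k l (agree k l) (agree (ℕ.pred k) l) (agree k (ℕ.pred l))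
      where
      agree : ∀ k l → U k l ≡ V i k l
      agree k l = go (l ℕ.≤? suc i) (Up? i k l)
        where
        go : Dec (l ℕ.≤ suc i) → Dec (Up i k l) → U k l ≡ V i k l
        go (yes le) _ = agree-low k l le
        go (no _) (no ¬u) = bottom k l ¬u
        go (no l≰) (yes u) = top k l (trans (cong₂ _+_ (I-yes u) (I-yes (ℕ.≰⇒> l≰ , ≤-trans (≤-reflexive (cong ι eN)) (proj₂ u))))
          (sym (pairMarkers-high (ℕ.≰⇒> l≰))))

  module Steep (i : ℕ) (lt : N (suc i) ℕ.< N (suc (suc i))) where

    e : ℕ → ℚ
    e = pairMarkers i

    t : ℚ
    t = c (suc i)

    -- Markers are natural numbers, so the window of radius 1 around `t` has `t` as its only marker
    -- in the interior: smaller ones go to 0, `t` to 1, and larger ones to 2.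
    ψ : ℚ → ℚ
    ψ = clamp (t - 1ℚ) 2ℚ

    ψ-mono : Monotone ψ
    ψ-mono = clamp-mono (t - 1ℚ) 2ℚ

    ψ-low : ∀ {m} → m ℕ.< N (suc i) → ψ (ι m) ≡ 0ℚ
    ψ-low {m} h = clamp-low 2ℚ (lin-≤ (≤-trans (≤-reflexive (sym (ι-suc m))) (ι-mono h)) (eq (ι m) t))
      where
      eq : ∀ m t → t - 1ℚ + (1ℚ + m) ≡ m + t
      eq = solve-∀ ℚ-ring

    ψ-mid : ψ t ≡ 1ℚ
    ψ-mid = trans (clamp-mid (lin-≤ 0≤1 (eq₁ t)) (lin-≤ 0≤1 (eq₂ t))) (eq₃ t)
      where
      eq₁ : ∀ t → t + 0ℚ ≡ t - 1ℚ + 1ℚ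
      eq₁ = solve-∀ ℚ-ring
      eq₂ : ∀ t → t - 1ℚ + (1ℚ + 1ℚ) + 0ℚ ≡ t + 1ℚ
      eq₂ = solve-∀ ℚ-ring
      eq₃ : ∀ t → t - (t - 1ℚ) ≡ 1ℚ
      eq₃ = solve-∀ ℚ-ring

    ψ-high : ∀ {m} → N (suc (suc i)) ℕ.≤ m → ψ (ι m) ≡ 2ℚ
    ψ-high {m} h = clamp-high (0≤p+q 0≤1 0≤1)
      (lin-≤ (≤-trans (≤-reflexive (sym (ι-suc (N (suc i))))) (ι-mono (ℕ.≤-trans lt h))) (eq (ι m) t))
      where
      eq : ∀ m t → m + (1ℚ + t) ≡ t - 1ℚ + (1ℚ + 1ℚ) + m
      eq = solve-∀ ℚ-ring

    -- The restriction on `l` matters when `c i` equals `t`: then `ψ` can give 1 in columns that `V`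
    -- counts as 0.
    ψY : ∀ k l → i ℕ.< l → ψ (Y k l) ≡ V i k l
    ψY k l i<l = go (value k l)
      where
      go : (∃ λ κ → Y k l ≡ c κ) → ψ (Y k l) ≡ V i k l
      go (κ , eκ) = split (N (suc (suc i)) ℕ.≤? N κ) (N (suc i) ℕ.≤? N κ)
        where
        split : Dec (N (suc (suc i)) ℕ.≤ N κ) → Dec (N (suc i) ℕ.≤ N κ) → ψ (Y k l) ≡ V i k l
        split (yes h) _ = trans (trans (cong ψ eκ) (ψ-high h)) (sym (cong₂ _+_ (I-yes (Up-nested u)) (I-yes u)))
          where
          l≢ : suc i ≢ l
          l≢ refl = ℕ.<⇒≱ lt (ℕ.≤-trans h (ι-cancel (≤-trans (≤-reflexive (sym eκ)) (proj₂ hx k l))))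
          u : Up (suc i) k l
          u = ℕ.≤∧≢⇒< i<l l≢ , ≤-trans (ι-mono h) (≤-reflexive (sym eκ))
        split (no ¬h) (yes h) = trans (trans (cong ψ Y≡t) ψ-mid)
            (sym (cong₂ _+_ (I-yes (i<l , ≤-reflexive (sym Y≡t))) (I-no (λ u → ¬h (ι-cancel (≤-trans (proj₂ u) (≤-reflexive eκ)))))))
          where
          Y≡t : Y k l ≡ t
          Y≡t = trans eκ (cong ι (ℕ.≤-antisym (N-mono (ℕ.≮⇒≥ (λ κ> → ¬h (N-mono κ>)))) h))
        split (no _) (no ¬h) = trans (trans (cong ψ eκ) (ψ-low (ℕ.≰⇒> ¬h)))
            (sym (cong₂ _+_ (I-no ¬u) (I-no (λ u → ¬u (Up-nested u)))))
          where
          ¬u : ¬ Up i k l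
          ¬u u = ¬h (ι-cancel (≤-trans (proj₂ u) (≤-reflexive eκ)))

    x₂ : Point
    x₂ = push ψ c x

    x₂≡v : ∀ k l → suc i ℕ.< l → x₂ k l ≡ v i k l
    x₂≡v k zero    ()
    x₂≡v k (suc l) h = go (1 ℕ.≤? k) (k ℕ.<? suc l)
      where
      outside : ¬ (1 ℕ.≤ k × k ℕ.< suc l) → x₂ k (suc l) ≡ v i k (suc l)
      outside ¬h = trans (push-zero ψ c x (sx k (suc l) ¬h)) (sym (v-supported i k (suc l) ¬h))
      go : Dec (1 ℕ.≤ k) → Dec (k ℕ.< suc l) → x₂ k (suc l) ≡ v i k (suc l)
      go (no ¬h₁) _ = outside (λ p → ¬h₁ (proj₁ p))
      go (yes _) (no ¬h₂) = outside (λ p → ¬h₂ (proj₂ p))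
      go (yes h₁) (yes h₂) = trans (push-at ψ c x h₁ h₂) (trans
        (cong₂ _-_ (trans (ψY k (suc l) (ℕ.<-trans (ℕ.n<1+n i) h)) (sym (potential-v i k (suc l))))
          (trans (below-mono-⊔ ψ-mono c x k (suc l))
            (cong₂ _⊔_ (trans (ψY (ℕ.pred k) (suc l) (ℕ.<-trans (ℕ.n<1+n i) h)) (sym (potential-v i (ℕ.pred k) (suc l))))
                       (trans (ψY k l (ℕ.≤-pred h)) (sym (potential-v i k l))))))
        (sym (value-at e (v i) h₁ h₂)))

    -- Since `ψ (c k)` and `pairMarkers i k` may differ for `k ≤ i`, the low columns keep the
    -- entries of `x₂`. Nothing is lost, because there `u` agrees with `v` anyway.
    cut : Point → Point
    cut u k l with l ℕ.≤? suc i
    ... | yes _ = x₂ k l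
    ... | no  _ = u k l

    cut-low : ∀ u k {l} → l ℕ.≤ suc i → cut u k l ≡ x₂ k l
    cut-low u k {l} h with l ℕ.≤? suc i
    ... | yes _ = refl
    ... | no ¬h = ⊥-elim (¬h h)

    cut-high : ∀ u k {l} → suc i ℕ.< l → cut u k l ≡ u k l
    cut-high u k {l} h with l ℕ.≤? suc i
    ... | yes h' = ⊥-elim (ℕ.<⇒≱ h h')
    ... | no  _  = refl

    cut-case : (P : ℕ → ℕ → Set) → (∀ k l → l ℕ.≤ suc i → P k l) → (∀ k l → suc i ℕ.< l → P k l) → ∀ k l → P k l
    cut-case P f g k l = go (l ℕ.≤? suc i)
      where
      go : Dec (l ℕ.≤ suc i) → P k l
      go (yes h) = f k l h
      go (no ¬h) = g k l (ℕ.≰⇒> ¬h)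

    module Cut (u : Point) (hu : In e u) (low : ∀ k l → l ℕ.≤ suc i → potential e u k l ≡ V i k l) where

      W : ℕ → ℕ → ℚ
      W = potential (λ k → ψ (c k)) (cut u)

      Claim : ℕ → ℕ → Set
      Claim k l = (l ℕ.≤ suc i → W k l ≡ ψ (Y k l)) × (i ℕ.< l → W k l ≡ potential e u k l)

      -- The two descriptions overlap in column `suc i`, where both give `V`. This overlap lets the
      -- recursion pass from `ψ ∘ Y` on the left to the potential of `u` on the right.
      claim : ∀ k l → Claim k l
      claim = grid-ind Claim
        (λ l → (λ _ → trans (potential-zero _ _ l) (sym (cong ψ (potential-zero c x l)))) ,
               (λ _ → trans (potential-zero _ _ l) (trans ψ0 (sym (trans (potential-zero e u l) (pairMarkers-low {i} z≤n))))))
        (λ {k} {l} le → (λ _ → trans (potential-diag _ _ le) (sym (cong ψ (Y-diag le)))) ,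
               (λ h → trans (potential-diag _ _ le) (trans (ψc l h) (sym (potential-diag e u le)))))
        next'
        where
        ψ0 : ψ (c 0) ≡ 0ℚ
        ψ0 = ψ-low (subst (ℕ._< N (suc i)) (sym N0) (1≤N i))
        ψc : ∀ l → i ℕ.< l → ψ (c l) ≡ e l
        ψc l h = Sum.[ (λ h' → trans (ψ-high (N-mono h')) (sym (pairMarkers-high h')))
                     , (λ { refl → trans ψ-mid (sym (pairMarkers-mid i)) }) ]′ (ℕ.m≤n⇒m<n∨m≡n h)
        next' : ∀ {k l} → k ℕ.< l → Claim k (suc l) → Claim (suc k) l → Claim (suc k) (suc l)
        next' {k} {l} k<l (a₁ , b₁) (a₂ , b₂) = low' , high'
          where
          low' : suc l ℕ.≤ suc i → W (suc k) (suc l) ≡ ψ (Y (suc k) (suc l))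
          low' h = trans (potential-step _ _ k<l) (trans
            (cong₂ _+_ (cut-low u (suc k) h) (cong₂ _⊔_
              (trans (a₁ h) (sym (potential-push ψ-mono c x k (suc l))))
              (trans (a₂ (ℕ.≤-trans (ℕ.n≤1+n l) h)) (sym (potential-push ψ-mono c x (suc k) l)))))
            (trans (sym (potential-step (λ k → ψ (c k)) x₂ k<l)) (potential-push ψ-mono c x (suc k) (suc l))))
          high' : i ℕ.< suc l → W (suc k) (suc l) ≡ potential e u (suc k) (suc l)
          high' h = Sum.[ strict , (λ { refl → trans (low' ℕ.≤-refl) (trans (ψY (suc k) (suc l) ℕ.≤-refl) (sym (low (suc k) (suc l) ℕ.≤-refl))) }) ]′
            (ℕ.m≤n⇒m<n∨m≡n h)
            where
            strict : suc i ℕ.< suc l → W (suc k) (suc l) ≡ potential e u (suc k) (suc l)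
            strict h' = trans (potential-step _ _ k<l) (trans
              (cong₂ _+_ (cut-high u (suc k) h') (cong₂ _⊔_ (b₁ h) (b₂ (ℕ.≤-pred h'))))
              (sym (potential-step e u k<l)))

      cut-In : In (λ k → ψ (c k)) (cut u)
      cut-In = cut-case (λ k l → 0ℚ ≤ cut u k l)
          (λ k l h → subst (0ℚ ≤_) (sym (cut-low u k h)) (proj₁ (push-In ψ-mono hx) k l))
          (λ k l h → subst (0ℚ ≤_) (sym (cut-high u k h)) (proj₁ hu k l)) ,
        cut-case (λ k l → W k l ≤ ψ (c l))
          (λ k l h → ≤-trans (≤-reflexive (proj₁ (claim k l) h)) (ψ-mono (proj₂ hx k l)))
          (λ k l h → ≤-trans (≤-reflexive (proj₂ (claim k l) (ℕ.<-trans (ℕ.n<1+n i) h))) (≤-trans (proj₂ hu k l)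
             (≤-reflexive (trans (pairMarkers-high h) (sym (ψ-high (N-mono h)))))))

      -- `rest` and `ψ` are monotone with sum the identity, so `x` is the push by `rest` plus `x₂`.
      -- Replacing `x₂` by `cut u` stays in the polytope of `x`, and the replacements for `u` and
      -- `w` average to `x`.
      rest : ℚ → ℚ
      rest r = r - ψ r

      rest-mono : Monotone rest
      rest-mono {r} {s} h = lin-≤ (clamp-contract (t - 1ℚ) 2ℚ h) (eq r s (ψ r) (ψ s))
        where
        eq : ∀ r s p q → s - q + (q - p) ≡ r - p + (s - r)
        eq = solve-∀ ℚ-ring

      glued : Point
      glued k l = push rest c x k l + cut u k l

      glued-In : In c glued
      glued-In = In-cong (λ k → eq (c k) (ψ (c k))) (λ _ _ → refl) (In-+ (push-In rest-mono hx) cut-In)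
        where
        eq : ∀ r p → r - p + p ≡ r
        eq = solve-∀ ℚ-ring

      glued≡ : ∀ k l → glued k l ≡ x k l - x₂ k l + cut u k l
      glued≡ k l = cong (_+ cut u k l) (eq (x k l) (below c x k l) (ψ (x k l + below c x k l)) (ψ (below c x k l)))
        where
        eq : ∀ x b p q → (x + b - p) - (b - q) ≡ x - (p - q)
        eq = solve-∀ ℚ-ring

    conclude : ∀ u w (hu : In e u) (hw : In e w) → (∀ k l → v i k l + v i k l ≡ u k l + w k l) →
      ∀ k l → u k l ≡ v i k l
    conclude u w hu hw mid = cut-case (λ k l → u k l ≡ v i k l)
        (λ k l h → PU.determined k l (PU.agree-low k l h) (PU.agree-low (ℕ.pred k) l h)
                     (PU.agree-low k (ℕ.pred l) (ℕ.≤-trans ℕ.pred[n]≤n h)))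
        (λ k l h → trans (sym (cut-high u k h)) (trans (lin-≡ (trans (sym (CU.glued≡ k l)) (same k l)) (eq (x k l) (x₂ k l) (cut u k l))) (x₂≡v k l h)))
      where
      module PU = PairVertex i u w hu hw mid
      module PW = PairVertex i w u hw hu (λ k l → trans (mid k l) (+-comm (u k l) (w k l)))
      module CU = Cut u hu PU.agree-low
      module CW = Cut w hw PW.agree-low
      eq : ∀ x p q → p + (x - p + q) ≡ q + x
      eq = solve-∀ ℚ-ring
      eq' : ∀ x p q r → p + p ≡ q + r → x + x ≡ x - p + q + (x - p + r)
      eq' x p q r h = lin-≡ h (eq'' x p q r)
        where
        eq'' : ∀ x p q r → (x - p + q + (x - p + r)) + (p + p) ≡ x + x + (q + r)
        eq'' = solve-∀ ℚ-ring
      cut-mid : ∀ k l → x₂ k l + x₂ k l ≡ cut u k l + cut w k l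
      cut-mid = cut-case (λ k l → x₂ k l + x₂ k l ≡ cut u k l + cut w k l)
        (λ k l h → sym (cong₂ _+_ (cut-low u k h) (cut-low w k h)))
        (λ k l h → trans (cong₂ _+_ (x₂≡v k l h) (x₂≡v k l h)) (trans (mid k l) (sym (cong₂ _+_ (cut-high u k h) (cut-high w k h)))))
      same : ∀ k l → CU.glued k l ≡ x k l
      same = proj₂ hv CU.glued CW.glued CU.glued-In CW.glued-In
        (λ k l → trans (eq' (x k l) (x₂ k l) (cut u k l) (cut w k l) (cut-mid k l)) (sym (cong₂ _+_ (CU.glued≡ k l) (CW.glued≡ k l))))

  pair-vertex : ∀ i → IsVertex (pairMarkers i) (v i)
  pair-vertex i = v-In i , λ u w hu hw mid → Sum.[ (λ lt → Steep.conclude i lt u w hu hw mid)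
      , (λ eN → PairVertex.flat i u w hu hw mid (sym eN)) ]′ (ℕ.m≤n⇒m<n∨m≡n (N-suc (suc i)))

  -- A vertex as the weighted sum of its antichains

  module Formula (n : ℕ) (a : ℕ → ℕ) (Na : ∀ j → 1 ℕ.≤ j → j ℕ.≤ n → N (suc j) ≡ N j ℕ.+ a j)
    (top : ∀ l → N l ℕ.≤ N (suc n)) where

    H : ℕ → ℚ → ℚ
    H i s = indicator (c (suc i) ≤? s)

    H-mono : ∀ i → Monotone (H i)
    H-mono i {s} {t} h = indicator-mono (c (suc i) ≤? s) (c (suc i) ≤? t) (λ h' → ≤-trans h' h)

    levelSum : ℚ → ℕ → ℚ
    levelSum s = sumTo (λ i → ι (a i) * H i s)

    -- Up to index `m` the layers fill the interval from `c 1` to the smaller of `c κ` and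
    -- `c (suc m)`.
    levelSum-≤ : ∀ κ → 1 ℕ.≤ κ → ∀ m → m ℕ.≤ n →
      (suc m ℕ.≤ κ → c 1 + levelSum (c κ) m ≡ c (suc m)) × (κ ℕ.≤ suc m → c 1 + levelSum (c κ) m ≡ c κ)
    levelSum-≤ κ 1≤κ zero _ = (λ _ → +-identityʳ (c 1)) , (λ h → trans (+-identityʳ (c 1)) (cong c (ℕ.≤-antisym 1≤κ h)))
    levelSum-≤ κ 1≤κ (suc m) m<n = hi , lo
      where
      ih : (suc m ℕ.≤ κ → c 1 + levelSum (c κ) m ≡ c (suc m)) × (κ ℕ.≤ suc m → c 1 + levelSum (c κ) m ≡ c κ)
      ih = levelSum-≤ κ 1≤κ m (ℕ.≤-trans (ℕ.n≤1+n m) m<n)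
      c-suc : c (suc (suc m)) ≡ c (suc m) + ι (a (suc m))
      c-suc = trans (cong ι (Na (suc m) (s≤s z≤n) m<n)) (ι-+ (N (suc m)) (a (suc m)))
      eq : ∀ c s a → c + (s + a * 1ℚ) ≡ c + s + a
      eq = solve-∀ ℚ-ring
      eq' : ∀ c s a → c + (s + a * 0ℚ) ≡ c + s
      eq' = solve-∀ ℚ-ring
      hi : suc (suc m) ℕ.≤ κ → c 1 + levelSum (c κ) (suc m) ≡ c (suc (suc m))
      hi h = trans (cong (λ p → c 1 + (levelSum (c κ) m + ι (a (suc m)) * p)) (indicator-yes (c (suc (suc m)) ≤? c κ) (markers-mono hc h)))
        (trans (eq (c 1) (levelSum (c κ) m) (ι (a (suc m)))) (trans (cong (_+ ι (a (suc m))) (proj₁ ih (ℕ.≤-trans (ℕ.n≤1+n (suc m)) h))) (sym c-suc)))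
      lo : κ ℕ.≤ suc (suc m) → c 1 + levelSum (c κ) (suc m) ≡ c κ
      lo h = Sum.[ (λ κ≤ → below' (ℕ.≤-pred κ≤) (c (suc (suc m)) ≤? c κ)) , (λ { refl → hi ℕ.≤-refl }) ]′ (ℕ.m≤n⇒m<n∨m≡n h)
        where
        below' : κ ℕ.≤ suc m → Dec (c (suc (suc m)) ≤ c κ) → c 1 + levelSum (c κ) (suc m) ≡ c κ
        below' κ≤ (no ¬h) = trans (cong (λ p → c 1 + (levelSum (c κ) m + ι (a (suc m)) * p)) (indicator-no (c (suc (suc m)) ≤? c κ) ¬h))
          (trans (eq' (c 1) (levelSum (c κ) m) (ι (a (suc m)))) (proj₂ ih κ≤))
        -- The layer counts although its index is past `κ` only if the markers in between coincide;
        -- its weight is then zero.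
        below' κ≤ (yes h') = trans (cong (λ p → c 1 + (levelSum (c κ) m + ι (a (suc m)) * p)) (indicator-yes (c (suc (suc m)) ≤? c κ) h'))
          (trans (eq (c 1) (levelSum (c κ) m) (ι (a (suc m)))) (trans (cong (_+ ι (a (suc m))) (proj₂ ih κ≤))
            (≤-antisym (≤-trans (+-monoˡ-≤ (ι (a (suc m))) (markers-mono hc κ≤)) (≤-trans (≤-reflexive (sym c-suc)) h'))
               (p≤p+q (0≤ι (a (suc m)))))))

    levelSum-value : ∀ {s} → (∃ λ κ → s ≡ c κ) → c 1 ≤ s → c 1 + levelSum s n ≡ s
    levelSum-value (zero , refl) h = ⊥-elim (ℕ.<⇒≱ N1 (ℕ.≤-trans (ι-cancel h) (ℕ.≤-reflexive N0)))
    levelSum-value (suc κ , refl) h = go (suc n ℕ.≤? suc κ)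
      where
      go : Dec (suc n ℕ.≤ suc κ) → c 1 + levelSum (c (suc κ)) n ≡ c (suc κ)
      go (yes h') = trans (proj₁ (levelSum-≤ (suc κ) (s≤s z≤n) n ℕ.≤-refl) h') (≤-antisym (markers-mono hc h') (ι-mono (top (suc κ))))
      go (no ¬h) = proj₂ (levelSum-≤ (suc κ) (s≤s z≤n) n ℕ.≤-refl) (ℕ.<⇒≤ (ℕ.≰⇒> ¬h))

    -- Where a marker step is nonzero, the condition i < l in Up is implied by the lower bound on the potential.
    H-I : ∀ i k l → N i ℕ.< N (suc i) → H i (Y k l) ≡ I i k l
    H-I i k l lt = ≤-antisym
      (indicator-mono (c (suc i) ≤? Y k l) (Up? i k l) (λ h → ℕ.≰⇒> (λ l≤i → ℕ.<⇒≱ lt (ι-cancel (≤-trans h (≤-trans (proj₂ hx k l) (markers-mono hc l≤i))))) , h))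
      (indicator-mono (Up? i k l) (c (suc i) ≤? Y k l) proj₂)

    -- For a positive weight `H` agrees with the indicator `I`, which satisfies the recursion. For
    -- weight zero they may disagree, but the summand vanishes.
    term : ∀ i → 1 ℕ.≤ i → i ℕ.≤ n → ∀ {k l} → k ℕ.< l →
      ι (a i) * H i (Y (suc k) (suc l)) ≡ ι (a i) * χℚ (A i) (suc k) (suc l) + ι (a i) * H i (below c x (suc k) (suc l))
    term i 1≤i i≤n {k} {l} k<l = go (a i) refl
      where
      go : ∀ m → m ≡ a i → ι m * H i (Y (suc k) (suc l)) ≡ ι m * χℚ (A i) (suc k) (suc l) + ι m * H i (below c x (suc k) (suc l))
      go zero _ = trans (z _) (sym (cong₂ _+_ (z _) (z _)))
        where
        z : ∀ p → ι 0 * p ≡ 0ℚ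
        z p = trans (cong (_* p) ι-0) (*-zeroˡ p)
      go (suc m) em = trans (cong (ι (suc m) *_) (trans (H-I i (suc k) (suc l) lt) (trans (I-step i k<l)
          (cong (χℚ (A i) (suc k) (suc l) +_) (trans (sym (cong₂ _⊔_ (H-I i k (suc l) lt) (H-I i (suc k) l lt))) (sym (mono-≤-distrib-⊔ (H-mono i) _ _)))))))
          (*-distribˡ-+ (ι (suc m)) _ _)
        where
        lt : N i ℕ.< N (suc i)
        lt = ℕ.≤-trans (ℕ.m<m+n (N i) (s≤s z≤n)) (ℕ.≤-reflexive (trans (cong (N i ℕ.+_) em) (sym (Na i 1≤i i≤n))))

    formula : ∀ k l → 1 ℕ.≤ k → k ℕ.< l → x k l ≡ sumTo (λ i → ι (a i) * χℚ (A i) k l) n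
    formula (suc k) (suc l) _ (s≤s k<l) = lin-≡
      (sym (trans (potential-below c x (s≤s z≤n) (s≤s k<l)) (cong (x (suc k) (suc l) +_) (sym below-sum))))
      (trans (eq (x (suc k) (suc l)) S (levelSum b n) (c 1)) (cong (x (suc k) (suc l) +_) (trans (sym (cong (c 1 +_) split)) Y-sum)))
      where
      S b : ℚ
      S = sumTo (λ i → ι (a i) * χℚ (A i) (suc k) (suc l)) n
      b = below c x (suc k) (suc l)
      split : levelSum (Y (suc k) (suc l)) n ≡ S + levelSum b n
      split = trans (sumTo-cong n (λ i h₁ h₂ → term i h₁ h₂ k<l)) (sumTo-+ _ _ n)
      Y-sum : c 1 + levelSum (Y (suc k) (suc l)) n ≡ Y (suc k) (suc l)
      Y-sum = levelSum-value (value (suc k) (suc l)) (≤-trans (≤-reflexive (sym (Y-diag (ℕ.≤-refl {1})))) (Y-mono (s≤s z≤n) (s≤s z≤n)))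
      below-sum : c 1 + levelSum b n ≡ b
      below-sum = levelSum-value (⊔-elim (λ s → ∃ λ κ → s ≡ c κ) (value k (suc l)) (value (suc k) l))
        (≤-trans (≤-reflexive (sym (Y-diag (ℕ.≤-refl {1})))) (≤-trans (Y-mono {1} {suc k} {1} {l} (s≤s z≤n) (ℕ.≤-trans (s≤s z≤n) k<l)) (p≤q⊔p (Y k (suc l)) (Y (suc k) l))))
      eq : ∀ x S L c → S + (x + (c + L)) ≡ x + (c + (S + L))
      eq = solve-∀ ℚ-ring

-- From antichains to vertices

0≢1 : ¬ (0ℚ ≡ 1ℚ)
0≢1 e = 1≰0 (≤-reflexive (sym e))

sumTo-mono : ∀ {g h} n → (∀ i → 1 ℕ.≤ i → i ℕ.≤ n → g i ≤ h i) → sumTo g n ≤ sumTo h n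
sumTo-mono zero    _ = ≤-refl
sumTo-mono (suc n) e = +-mono-≤ (sumTo-mono n (λ i h₁ h₂ → e i h₁ (ℕ.≤-trans h₂ (ℕ.n≤1+n n)))) (e (suc n) (s≤s z≤n) ℕ.≤-refl)

sumTo-zero : ∀ {g} n → (∀ i → 1 ℕ.≤ i → i ℕ.≤ n → g i ≡ 0ℚ) → sumTo g n ≡ 0ℚ
sumTo-zero zero    _ = refl
sumTo-zero (suc n) e = cong₂ _+_ (sumTo-zero n (λ i h₁ h₂ → e i h₁ (ℕ.≤-trans h₂ (ℕ.n≤1+n n)))) (e (suc n) (s≤s z≤n) ℕ.≤-refl)

sumTo-cut : ∀ b {g : ℕ → ℚ} {r n} → r ℕ.≤ n → (∀ i → 1 ℕ.≤ i → i ℕ.≤ r → g i ≡ 1ℚ) →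
  (∀ i → r ℕ.< i → i ℕ.≤ n → g i ≡ 0ℚ) → sumTo (λ i → b i * g i) n ≡ sumTo b r
sumTo-cut b {g} {r} {zero}  z≤n g1 g0 = refl
sumTo-cut b {g} {r} {suc n} r≤ g1 g0 = Sum.[ shorter , full ]′ (ℕ.m≤n⇒m<n∨m≡n r≤)
  where
  shorter : r ℕ.< suc n → sumTo (λ i → b i * g i) (suc n) ≡ sumTo b r
  shorter h = trans (cong₂ _+_ (sumTo-cut b (ℕ.≤-pred h) g1 (λ i h₁ h₂ → g0 i h₁ (ℕ.≤-trans h₂ (ℕ.n≤1+n n))))
    (trans (cong (b (suc n) *_) (g0 (suc n) h ℕ.≤-refl)) (*-zeroʳ (b (suc n))))) (+-identityʳ (sumTo b r))
  full : r ≡ suc n → sumTo (λ i → b i * g i) (suc n) ≡ sumTo b r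
  full refl = sumTo-cong (suc n) (λ i h₁ h₂ → trans (cong (b i *_) (g1 i h₁ h₂)) (*-identityʳ (b i)))

sumTo-mono-n : ∀ {b} → (∀ i → 0ℚ ≤ b i) → ∀ {r s} → r ℕ.≤ s → sumTo b r ≤ sumTo b s
sumTo-mono-n {b} 0≤b = markers-mono {sumTo b} (λ r → p≤p+q (0≤b (suc r)))

IsVertex-scale : ∀ {s s' e v} → 0ℚ ≤ s' → s * s' ≡ 1ℚ → IsVertex e v → ∀ {y z} → In (λ k → s * e k) y → In (λ k → s * e k) z →
  (∀ k l → s * v k l + s * v k l ≡ y k l + z k l) → ∀ k l → y k l ≡ s * v k l
IsVertex-scale {s} {s'} {e} {v} hs' ss' hv {y} {z} hy hz mid k l =
  trans (sym (back (y k l))) (cong (s *_) (proj₂ hv (λ k l → s' * y k l) (λ k l → s' * z k l) (shrink hy) (shrink hz)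
    (λ k l → trans (cong₂ _+_ (sym (forth (v k l))) (sym (forth (v k l)))) (trans (sym (*-distribˡ-+ s' _ _)) (trans (cong (s' *_) (mid k l)) (*-distribˡ-+ s' _ _)))) k l))
  where
  forth : ∀ p → s' * (s * p) ≡ p
  forth p = trans (sym (*-assoc s' s p)) (trans (cong (_* p) (trans (*-comm s' s) ss')) (*-identityˡ p))
  back : ∀ p → s * (s' * p) ≡ p
  back p = trans (sym (*-assoc s s' p)) (trans (cong (_* p) ss') (*-identityˡ p))
  shrink : ∀ {y} → In (λ k → s * e k) y → In e (λ k l → s' * y k l)
  shrink hy = In-cong (λ k → forth (e k)) (λ _ _ → refl) (In-* hs' hy)

clamp-split : ∀ {s} → 0ℚ ≤ s → s ≤ 2ℚ → clamp 0ℚ 1ℚ s + clamp 1ℚ 1ℚ s ≡ s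
clamp-split {s} h₁ h₂ = Sum.[ (λ h → trans (cong₂ _+_ (clamp-mid h₁ h) (clamp-low 1ℚ h)) (eq₁ s))
                            , (λ h → trans (cong₂ _+_ (clamp-high {0ℚ} {1ℚ} 0≤1 h) (clamp-mid h h₂)) (eq₂ s)) ]′ (≤-total s 1ℚ)
  where
  eq₁ : ∀ s → s - 0ℚ + 0ℚ ≡ s
  eq₁ = solve-∀ ℚ-ring
  eq₂ : ∀ s → 1ℚ + (s - 1ℚ) ≡ s
  eq₂ = solve-∀ ℚ-ring

pairMarkers-clamp : ∀ i k → clamp 0ℚ 1ℚ (pairMarkers i k) ≡ step i k × clamp 1ℚ 1ℚ (pairMarkers i k) ≡ step (suc i) k
pairMarkers-clamp i k = go (k ℕ.≤? i) (k ℕ.≤? suc i)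
  where
  go : Dec (k ℕ.≤ i) → Dec (k ℕ.≤ suc i) → clamp 0ℚ 1ℚ (pairMarkers i k) ≡ step i k × clamp 1ℚ 1ℚ (pairMarkers i k) ≡ step (suc i) k
  go (yes h) _ = trans (clamp-low 1ℚ (≤-reflexive (pairMarkers-low h))) (sym (step-low h)) ,
                 trans (clamp-low 1ℚ (≤-trans (≤-reflexive (pairMarkers-low h)) 0≤1)) (sym (step-low (ℕ.≤-trans h (ℕ.n≤1+n i))))
  go (no ¬h) (yes h) = trans (clamp-high 0≤1 (≤-reflexive (sym e))) (sym (step-high (ℕ.≰⇒> ¬h))) ,
                       trans (clamp-low 1ℚ (≤-reflexive e)) (sym (step-low h))
    where
    e : pairMarkers i k ≡ 1ℚ
    e = trans (cong (pairMarkers i) (ℕ.≤-antisym h (ℕ.≰⇒> ¬h))) (pairMarkers-mid i)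
  go (no _) (no ¬h) = trans (clamp-high 0≤1 (≤-trans (p≤p+q {1ℚ} 0≤1) (≤-reflexive (sym e)))) (sym (step-high (ℕ.<-trans (ℕ.n<1+n i) (ℕ.≰⇒> ¬h)))) ,
                      trans (clamp-high 0≤1 (≤-reflexive (sym e))) (sym (step-high (ℕ.≰⇒> ¬h)))
    where
    e : pairMarkers i k ≡ 2ℚ
    e = pairMarkers-high (ℕ.≰⇒> ¬h)

-- Uniqueness of the Minkowski decomposition of a vertex: clamping at [0,1] and [1,2] recovers A and B.
module PairSplit (i : ℕ) (A B : PairSet) (hA : IsAntichain A) (qA : A ⊆Q i) (hB : IsAntichain B) (qB : B ⊆Q suc i)
  (hv : IsVertex (pairMarkers i) (pair A B)) where

  private
    e : ℕ → ℚ
    e = pairMarkers i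
    v : Point
    v = pair A B
    V : ℕ → ℕ → ℚ
    V = potential e v
    p₁ p₂ : Point
    p₁ = push (clamp 0ℚ 1ℚ) e v
    p₂ = push (clamp 1ℚ 1ℚ) e v

  V-nonNeg : ∀ k l → 0ℚ ≤ V k l
  V-nonNeg k l = ≤-trans (≤-reflexive (sym (pairMarkers-low {i} z≤n))) (c0≤potential (pairMarkers-markers i) (proj₁ (proj₁ hv)) k l)

  V≤2 : ∀ k l → V k l ≤ 2ℚ
  V≤2 k l = ≤-trans (proj₂ (proj₁ hv) k l) (+-mono-≤ (step≤1 i) (step≤1 (suc i)))
    where
    step≤1 : ∀ i → step i l ≤ 1ℚ
    step≤1 i = ≤-trans (markers-mono (step-markers i) (ℕ.m≤m+n l (suc i))) (≤-reflexive (step-high (ℕ.m≤n+m (suc i) l)))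

  private
    v-supported : Supported v
    v-supported k l h = cong₂ _+_ (χℚ-supported {A} qA k l h) (χℚ-supported {B} qB k l h)

    p₁+p₂ : ∀ k l → p₁ k l + p₂ k l ≡ v k l
    p₁+p₂ k l = go (1 ℕ.≤? k) (k ℕ.<? l)
      where
      outside : ¬ (1 ℕ.≤ k × k ℕ.< l) → p₁ k l + p₂ k l ≡ v k l
      outside h = trans (cong₂ _+_ (push-zero (clamp 0ℚ 1ℚ) e v v0) (push-zero (clamp 1ℚ 1ℚ) e v v0)) (sym v0)
        where
        v0 : v k l ≡ 0ℚ
        v0 = v-supported k l h
      eq : ∀ p q r s → p - q + (r - s) ≡ (p + r) - (q + s)
      eq = solve-∀ ℚ-ring
      go : Dec (1 ℕ.≤ k) → Dec (k ℕ.< l) → p₁ k l + p₂ k l ≡ v k l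
      go (no ¬h) _ = outside (λ h → ¬h (proj₁ h))
      go (yes _) (no ¬h) = outside (λ h → ¬h (proj₂ h))
      go (yes h₁) (yes h₂) = trans (cong₂ _+_ (push-at (clamp 0ℚ 1ℚ) e v h₁ h₂) (push-at (clamp 1ℚ 1ℚ) e v h₁ h₂))
        (trans (eq (clamp 0ℚ 1ℚ (V k l)) (clamp 0ℚ 1ℚ (below e v k l)) (clamp 1ℚ 1ℚ (V k l)) (clamp 1ℚ 1ℚ (below e v k l)))
        (trans (cong₂ _-_ (clamp-split (V-nonNeg k l) (V≤2 k l))
          (clamp-split (≤-trans (V-nonNeg (ℕ.pred k) l) (p≤p⊔q (V (ℕ.pred k) l) _)) (⊔-least _ _ (V≤2 (ℕ.pred k) l) (V≤2 k (ℕ.pred l)))))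
        (sym (value-at e v h₁ h₂))))

    p₁-In : In (step i) p₁
    p₁-In = In-cong (λ k → proj₁ (pairMarkers-clamp i k)) (λ _ _ → refl) (push-In (clamp-mono 0ℚ 1ℚ) (proj₁ hv))

    p₂-In : In (step (suc i)) p₂
    p₂-In = In-cong (λ k → proj₂ (pairMarkers-clamp i k)) (λ _ _ → refl) (push-In (clamp-mono 1ℚ 1ℚ) (proj₁ hv))

    -- Given two decompositions of `v`, exchanging one summand yields two points of the polytope
    -- with `v` as midpoint.
    eqv : ∀ k l → χℚ A k l + p₂ k l ≡ v k l
    eqv = proj₂ hv (λ k l → χℚ A k l + p₂ k l) (λ k l → p₁ k l + χℚ B k l)
      (In-+ (χ-In hA qA) p₂-In) (In-+ p₁-In (χ-In hB qB))
      (λ k l → trans (cong (v k l +_) (sym (p₁+p₂ k l))) (eq (χℚ A k l) (χℚ B k l) (p₁ k l) (p₂ k l)))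
      where
      eq : ∀ a b p q → a + b + (p + q) ≡ a + q + (p + b)
      eq = solve-∀ ℚ-ring

    p₂≡ : ∀ k l → p₂ k l ≡ χℚ B k l
    p₂≡ k l = lin-≡ (eqv k l) (eq (χℚ A k l) (χℚ B k l) (p₂ k l))
      where
      eq : ∀ a b q → b + (a + q) ≡ q + (a + b)
      eq = solve-∀ ℚ-ring

    p₁≡ : ∀ k l → p₁ k l ≡ χℚ A k l
    p₁≡ k l = lin-≡ (p₁+p₂ k l ⊞≡ sym (p₂≡ k l)) (eq (χℚ A k l) (χℚ B k l) (p₁ k l) (p₂ k l))
      where
      eq : ∀ a b p q → a + (p + q + b) ≡ p + (a + b + q)
      eq = solve-∀ ℚ-ring

  fA : ∀ k l → potential (step i) (χℚ A) k l ≡ clamp 0ℚ 1ℚ (V k l)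
  fA k l = trans (potential-cong (λ k → sym (proj₁ (pairMarkers-clamp i k))) (λ k l → sym (p₁≡ k l)) k l) (potential-push (clamp-mono 0ℚ 1ℚ) e v k l)

  fB : ∀ k l → potential (step (suc i)) (χℚ B) k l ≡ clamp 1ℚ 1ℚ (V k l)
  fB k l = trans (potential-cong (λ k → sym (proj₂ (pairMarkers-clamp i k))) (λ k l → sym (p₂≡ k l)) k l) (potential-push (clamp-mono 1ℚ 1ℚ) e v k l)

  potential-pair : ∀ k l → V k l ≡ potential (step i) (χℚ A) k l + potential (step (suc i)) (χℚ B) k l
  potential-pair k l = sym (trans (cong₂ _+_ (fA k l) (fB k l)) (clamp-split (V-nonNeg k l) (V≤2 k l)))

  -- The window from 1 to 2 receives anything only after the window from 0 to 1 is full.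
  nested : ∀ k l → potential (step (suc i)) (χℚ B) k l ≡ 1ℚ → potential (step i) (χℚ A) k l ≡ 1ℚ
  nested k l h = Sum.[ (λ V≤1 → ⊥-elim (0≢1 (trans (sym (clamp-low 1ℚ V≤1)) (trans (sym (fB k l)) h))))
                     , (λ 1≤V → trans (fA k l) (clamp-high {0ℚ} {1ℚ} 0≤1 1≤V)) ]′ (≤-total (V k l) 1ℚ)

-- An element of A incomparable to all of B could be moved from A to B.
module Isolated (i : ℕ) (A B : PairSet) (hA : IsAntichain A) (qA : A ⊆Q i) (hB : IsAntichain B) (qB : B ⊆Q suc i)
  (hv : IsVertex (pairMarkers i) (pair A B)) (k l : ℕ) (t : A k l ≡ true) (l> : suc i ℕ.< l)
  (¬above : ∀ k' l' → B k' l' ≡ true → ¬ (k ℕ.≤ k' × l ℕ.≤ l'))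
  (¬below : ∀ k' l' → B k' l' ≡ true → ¬ (k' ℕ.≤ k × l' ℕ.≤ l)) where

  private
    here? : ∀ k' l' → Dec (k' ≡ k × l' ≡ l)
    here? k' l' = (k' ℕ.≟ k) ×-dec (l' ℕ.≟ l)

    A⁻ B⁺ : PairSet
    A⁻ k' l' = if does (here? k' l') then false else A k' l'
    B⁺ k' l' = if does (here? k' l') then true else B k' l'

    A⁻-here : ∀ {k' l'} → k' ≡ k × l' ≡ l → A⁻ k' l' ≡ false
    A⁻-here {k'} {l'} h = cong (λ b → if b then false else A k' l') (dec-true (here? k' l') h)
    B⁺-here : ∀ {k' l'} → k' ≡ k × l' ≡ l → B⁺ k' l' ≡ true
    B⁺-here {k'} {l'} h = cong (λ b → if b then true else B k' l') (dec-true (here? k' l') h)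
    A⁻-there : ∀ {k' l'} → ¬ (k' ≡ k × l' ≡ l) → A⁻ k' l' ≡ A k' l'
    A⁻-there {k'} {l'} h = cong (λ b → if b then false else A k' l') (dec-false (here? k' l') h)
    B⁺-there : ∀ {k' l'} → ¬ (k' ≡ k × l' ≡ l) → B⁺ k' l' ≡ B k' l'
    B⁺-there {k'} {l'} h = cong (λ b → if b then true else B k' l') (dec-false (here? k' l') h)

    A⁻⊆A : ∀ {k' l'} → A⁻ k' l' ≡ true → A k' l' ≡ true
    A⁻⊆A {k'} {l'} t' = go (here? k' l')
      where
      go : Dec (k' ≡ k × l' ≡ l) → A k' l' ≡ true
      go (yes (refl , refl)) = t
      go (no h) = trans (sym (A⁻-there h)) t'

    B⁺⊆ : ∀ {k' l'} → B⁺ k' l' ≡ true → (k' ≡ k × l' ≡ l) ⊎ (B k' l' ≡ true)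
    B⁺⊆ {k'} {l'} t' = go (here? k' l')
      where
      go : Dec (k' ≡ k × l' ≡ l) → (k' ≡ k × l' ≡ l) ⊎ (B k' l' ≡ true)
      go (yes h) = inj₁ h
      go (no h)  = inj₂ (trans (sym (B⁺-there h)) t')

    B⁺-antichain : IsAntichain B⁺
    B⁺-antichain (p , q) (p' , q') t₁ t₂ le = go (B⁺⊆ t₁) (B⁺⊆ t₂)
      where
      go : (p ≡ k × q ≡ l) ⊎ (B p q ≡ true) → (p' ≡ k × q' ≡ l) ⊎ (B p' q' ≡ true) → (p , q) ≡ (p' , q')
      go (inj₁ (refl , refl)) (inj₁ (refl , refl)) = refl
      go (inj₁ (refl , refl)) (inj₂ b) = ⊥-elim (¬above p' q' b le)
      go (inj₂ b) (inj₁ (refl , refl)) = ⊥-elim (¬below p q b le)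
      go (inj₂ b) (inj₂ b') = hB (p , q) (p' , q') b b' le

    B⁺⊆Q : B⁺ ⊆Q suc i
    B⁺⊆Q {p} {q} t' = go (B⁺⊆ t')
      where
      go : (p ≡ k × q ≡ l) ⊎ (B p q ≡ true) → (1 ℕ.≤ p) × (p ℕ.≤ suc i) × (suc i ℕ.< q)
      go (inj₁ (refl , refl)) = proj₁ (qA t) , ℕ.≤-trans (proj₁ (proj₂ (qA t))) (ℕ.n≤1+n i) , l>
      go (inj₂ b) = qB b

    ¬B : ¬ (B k l ≡ true)
    ¬B b = ¬above k l b (ℕ.≤-refl , ℕ.≤-refl)

    mid : ∀ k' l' → pair A B k' l' + pair A B k' l' ≡ pair A B⁺ k' l' + pair A⁻ B k' l'
    mid k' l' = go (here? k' l')
      where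
      go : Dec (k' ≡ k × l' ≡ l) → pair A B k' l' + pair A B k' l' ≡ pair A B⁺ k' l' + pair A⁻ B k' l'
      go (yes h@(refl , refl)) = trans (cong₂ _+_ ab ab)
        (sym (cong₂ _+_ (cong₂ _+_ (χℚ-true A t) (χℚ-true B⁺ (B⁺-here h))) (cong₂ _+_ (χℚ-false A⁻ (A⁻-here h)) (χℚ-∉ B ¬B))))
        where
        ab : pair A B k l ≡ 1ℚ + 0ℚ
        ab = cong₂ _+_ (χℚ-true A t) (χℚ-∉ B ¬B)
      go (no h) = sym (cong₂ _+_ (cong (χℚ A k' l' +_) (same B⁺ B (B⁺-there h))) (cong (_+ χℚ B k' l') (same A⁻ A (A⁻-there h))))
        where
        same : ∀ C C' → C k' l' ≡ C' k' l' → χℚ C k' l' ≡ χℚ C' k' l'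
        same C C' e = trans (χℚ-def C k' l') (trans (cong (λ b → ℕ→ℚ (if b then 1 else 0)) e) (sym (χℚ-def C' k' l')))

  absurd : ⊥
  absurd = 0≢1 (sym (trans (sym (χℚ-true B⁺ (B⁺-here (refl , refl)))) (trans (+-cancelˡ-≡ (χℚ A k l) moved) (χℚ-∉ B ¬B))))
    where
    +-cancelˡ-≡ : ∀ p {q r} → p + q ≡ p + r → q ≡ r
    +-cancelˡ-≡ p {q} {r} h = +-cancelʳ-≡ p (trans (+-comm q p) (trans h (+-comm p r)))
    moved : pair A B⁺ k l ≡ pair A B k l
    moved = proj₂ hv (pair A B⁺) (pair A⁻ B)
      (pair-In hA qA B⁺-antichain B⁺⊆Q)
      (pair-In (λ p q t₁ t₂ → hA p q (A⁻⊆A t₁) (A⁻⊆A t₂)) (λ t' → qA (A⁻⊆A t')) hB qB) mid k l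

-- Nested up-sets and the rank of a cell

module Backward (n M : ℕ) (A : ℕ → PairSet)
  (hA : ∀ i → 1 ℕ.≤ i → i ℕ.≤ n → IsAntichain (A i))
  (qA : ∀ i → 1 ℕ.≤ i → i ℕ.≤ n → A i ⊆Q i)
  (bA : ∀ i → 1 ℕ.≤ i → i ℕ.≤ n → ∀ {k l} → A i k l ≡ true → l ℕ.≤ M)
  (pv : ∀ i → 1 ℕ.≤ i → suc i ℕ.≤ n → IsVertex (pairMarkers i) (pair (A i) (A (suc i)))) where

  f : ℕ → ℕ → ℕ → ℚ
  f i = potential (step i) (χℚ (A i))

  module Split (i : ℕ) (h₁ : 1 ℕ.≤ i) (h₂ : suc i ℕ.≤ n) =
    PairSplit i (A i) (A (suc i)) (hA i h₁ (ℕ.≤-trans (ℕ.n≤1+n i) h₂)) (qA i h₁ (ℕ.≤-trans (ℕ.n≤1+n i) h₂))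
      (hA (suc i) (s≤s z≤n) h₂) (qA (suc i) (s≤s z≤n) h₂) (pv i h₁ h₂)

  f-01 : ∀ i → 1 ℕ.≤ i → i ℕ.≤ n → ∀ k l → (f i k l ≡ 0ℚ) ⊎ (f i k l ≡ 1ℚ)
  f-01 i h₁ h₂ = potential-χ-01 (hA i h₁ h₂) (qA i h₁ h₂)

  f-nested : ∀ j → j ℕ.≤ n → ∀ i → 1 ℕ.≤ i → i ℕ.≤ j → ∀ k l → f j k l ≡ 1ℚ → f i k l ≡ 1ℚ
  f-nested zero    _   i h₁ h₂ k l e = ⊥-elim (ℕ.1+n≰n (ℕ.≤-trans h₁ h₂))
  f-nested (suc j) j<n i h₁ h₂ k l e = Sum.[ (λ h → f-nested j (ℕ.≤-trans (ℕ.n≤1+n j) j<n) i h₁ (ℕ.≤-pred h) k l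
      (Split.nested j (ℕ.≤-trans h₁ (ℕ.≤-pred h)) j<n k l e)) , (λ { refl → e }) ]′ (ℕ.m≤n⇒m<n∨m≡n h₂)

  -- By nestedness the indicators at a cell read 1, ..., 1, 0, ..., 0; the rank is the position of
  -- the drop.
  Rank : ℕ → ℕ → ℕ → ℕ → Set
  Rank m k l r = (r ℕ.≤ m) × (∀ i → 1 ℕ.≤ i → i ℕ.≤ r → f i k l ≡ 1ℚ) × (∀ i → r ℕ.< i → i ℕ.≤ m → f i k l ≡ 0ℚ)

  abstract
    find-rank : ∀ m → m ℕ.≤ n → ∀ k l → ∃ (Rank m k l)
    find-rank zero    _   k l = 0 , z≤n , (λ i h₁ h₂ → ⊥-elim (ℕ.1+n≰n (ℕ.≤-trans h₁ h₂))) , (λ i h₁ h₂ → ⊥-elim (ℕ.1+n≰n (ℕ.≤-trans h₁ h₂)))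
    find-rank (suc m) m<n k l = Sum.[ lower , upper ]′ (f-01 (suc m) (s≤s z≤n) m<n k l)
      where
      upper : f (suc m) k l ≡ 1ℚ → ∃ (Rank (suc m) k l)
      upper e = suc m , ℕ.≤-refl , (λ i h₁ h₂ → f-nested (suc m) m<n i h₁ h₂ k l e) , (λ i h₁ h₂ → ⊥-elim (ℕ.<⇒≱ h₁ h₂))
      lower : f (suc m) k l ≡ 0ℚ → ∃ (Rank (suc m) k l)
      lower e =
        let (r , r≤m , g1 , g0) = find-rank m (ℕ.≤-trans (ℕ.n≤1+n m) m<n) k l
        in r , ℕ.≤-trans r≤m (ℕ.n≤1+n m) , g1 , λ i h₁ h₂ → Sum.[ (λ h → g0 i h₁ (ℕ.≤-pred h)) , (λ { refl → e }) ]′ (ℕ.m≤n⇒m<n∨m≡n h₂)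

  rk : ℕ → ℕ → ℕ
  rk k l = proj₁ (find-rank n ℕ.≤-refl k l)

  rk≤n : ∀ k l → rk k l ℕ.≤ n
  rk≤n k l = proj₁ (proj₂ (find-rank n ℕ.≤-refl k l))

  f-1 : ∀ {i} k l → 1 ℕ.≤ i → i ℕ.≤ rk k l → f i k l ≡ 1ℚ
  f-1 {i} k l = proj₁ (proj₂ (proj₂ (find-rank n ℕ.≤-refl k l))) i

  f-0 : ∀ {i} k l → rk k l ℕ.< i → i ℕ.≤ n → f i k l ≡ 0ℚ
  f-0 {i} k l = proj₂ (proj₂ (proj₂ (find-rank n ℕ.≤-refl k l))) i

  rk-≥ : ∀ {i} k l → i ℕ.≤ n → f i k l ≡ 1ℚ → i ℕ.≤ rk k l
  rk-≥ {i} k l h e = ℕ.≮⇒≥ (λ lt → 0≢1 (trans (sym (f-0 k l lt h)) e))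

  rk-< : ∀ {i} k l → 1 ℕ.≤ i → f i k l ≡ 0ℚ → rk k l ℕ.< i
  rk-< {i} k l h e = ℕ.≰⇒> (λ le → 0≢1 (trans (sym e) (f-1 k l h le)))

  f-rank-mono : ∀ {i} {k l k' l'} → 1 ℕ.≤ i → i ℕ.≤ n → rk k l ℕ.≤ rk k' l' → f i k l ≤ f i k' l'
  f-rank-mono {i} {k} {l} {k'} {l'} h₁ h₂ le = go (i ℕ.≤? rk k l) (f-01 i h₁ h₂ k' l')
    where
    go : Dec (i ℕ.≤ rk k l) → (f i k' l' ≡ 0ℚ) ⊎ (f i k' l' ≡ 1ℚ) → f i k l ≤ f i k' l'
    go (yes h) _ = ≤-reflexive (trans (f-1 k l h₁ h) (sym (f-1 k' l' h₁ (ℕ.≤-trans h le))))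
    go (no ¬h) (inj₁ e) = ≤-reflexive (trans (f-0 k l (ℕ.≰⇒> ¬h) h₂) (sym e))
    go (no ¬h) (inj₂ e) = ≤-trans (≤-reflexive (f-0 k l (ℕ.≰⇒> ¬h) h₂)) (≤-trans 0≤1 (≤-reflexive (sym e)))

  cB : (ℕ → ℚ) → ℕ → ℚ
  cB b k = sumTo (λ i → b i * step i k) n

  xB : (ℕ → ℚ) → Point
  xB b k l = sumTo (λ i → b i * χℚ (A i) k l) n

  xB-supported : ∀ b → Supported (xB b)
  xB-supported b k l h = sumTo-zero n (λ i h₁ h₂ → trans (cong (b i *_) (χℚ-supported {A i} (qA i h₁ h₂) k l h)) (*-zeroʳ (b i)))

  module Weights (b : ℕ → ℚ) (0≤b : ∀ i → 0ℚ ≤ b i) where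

    *-mono : ∀ i {p q} → p ≤ q → b i * p ≤ b i * q
    *-mono i h = *-monoˡ-≤-nonNeg (b i) {{nonNegative (0≤b i)}} h

    F : ℕ → ℕ → ℚ
    F k l = sumTo (λ i → b i * f i k l) n

    F-rank : ∀ k l → F k l ≡ sumTo b (rk k l)
    F-rank k l = sumTo-cut b (rk≤n k l) (λ i h₁ h₂ → f-1 k l h₁ h₂) (λ i h₁ h₂ → f-0 k l h₁ h₂)

    cB-markers : Markers (cB b)
    cB-markers k = sumTo-mono n (λ i _ _ → *-mono i (step-markers i k))

    cB-zero : cB b 0 ≡ 0ℚ
    cB-zero = sumTo-zero n (λ i _ _ → trans (cong (b i *_) (step-low {i} z≤n)) (*-zeroʳ (b i)))

    cB-suc : ∀ {r} → r ℕ.≤ n → cB b (suc r) ≡ sumTo b r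
    cB-suc {r} h = sumTo-cut b h (λ i h₁ h₂ → step-high (s≤s h₂)) (λ i h₁ h₂ → step-low h₁)

    cB-top : ∀ l → cB b l ≤ sumTo b n
    cB-top l = ≤-trans (markers-mono cB-markers (ℕ.m≤n+m l (suc n))) (≤-trans
      (sumTo-mono n (λ i _ h → ≤-reflexive (trans (cong (b i *_) (step-high (ℕ.≤-trans (s≤s h) (ℕ.m≤m+n (suc n) l)))) (*-identityʳ (b i))))) ≤-refl)

    private
      below-F : ∀ {k l k' l'} → rk k l ℕ.≤ rk k' l' → sumTo (λ i → b i * (f i k l ⊔ f i k' l')) n ≡ F k l ⊔ F k' l'
      below-F {k} {l} {k'} {l'} le = trans
        (sumTo-cong n (λ i h₁ h₂ → cong (b i *_) (p≤q⇒p⊔q≡q (f-rank-mono h₁ h₂ le))))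
        (sym (p≤q⇒p⊔q≡q (sumTo-mono n (λ i h₁ h₂ → *-mono i (f-rank-mono h₁ h₂ le)))))

      below-F' : ∀ k l k' l' → sumTo (λ i → b i * (f i k l ⊔ f i k' l')) n ≡ F k l ⊔ F k' l'
      below-F' k l k' l' = Sum.[ below-F , (λ le → trans (sumTo-cong n (λ i _ _ → cong (b i *_) (⊔-comm (f i k l) (f i k' l'))))
        (trans (below-F le) (⊔-comm (F k' l') (F k l)))) ]′ (ℕ.≤-total (rk k l) (rk k' l'))

    -- All `f i` order two cells by rank, so their weighted sum commutes with the maximum and
    -- satisfies the recursion.
    potential-F : ∀ k l → potential (cB b) (xB b) k l ≡ F k l
    potential-F = potential-unique (cB b) (xB b) F
      (λ l → sumTo-cong n (λ i _ _ → cong (b i *_) (potential-zero (step i) (χℚ (A i)) l)))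
      (λ le → sumTo-cong n (λ i _ _ → cong (b i *_) (potential-diag (step i) (χℚ (A i)) le)))
      (λ {k} {l} lt → trans (sumTo-cong n (λ i _ _ → trans (cong (b i *_) (potential-step (step i) (χℚ (A i)) lt)) (*-distribˡ-+ (b i) _ _)))
        (trans (sumTo-+ _ _ n) (cong (xB b (suc k) (suc l) +_) (below-F' k (suc l) (suc k) l))))

    potential-rank : ∀ k l → potential (cB b) (xB b) k l ≡ sumTo b (rk k l)
    potential-rank k l = trans (potential-F k l) (F-rank k l)

    xB-In : In (cB b) (xB b)
    xB-In = (λ k l → ≤-trans (≤-reflexive (sym (sumTo-zero n (λ _ _ _ → refl)))) (sumTo-mono n (λ i _ _ → 0≤p*q (0≤b i) (0≤χℚ (A i) k l)))) ,
      (λ k l → ≤-trans (≤-reflexive (potential-F k l)) (sumTo-mono n (λ i h₁ h₂ → *-mono i (proj₂ (χ-In (hA i h₁ h₂) (qA i h₁ h₂)) k l))))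

  -- At an element of `A j` both predecessors have rank below `j`, so every indicator from `j` to
  -- the rank of the cell jumps here. In particular the cell lies in the antichain of its own rank.
  own-rank : ∀ j → 1 ℕ.≤ j → j ℕ.≤ n → ∀ k l → A j k l ≡ true →
    (j ℕ.≤ rk k l) × (A (rk k l) k l ≡ true) × (rk (ℕ.pred k) l ℕ.< j) × (rk k (ℕ.pred l) ℕ.< j)
  own-rank j h₁ h₂ k l t = j≤r , Bool-stable , lt₁ , lt₂
    where
    r : ℕ
    r = rk k l
    k<l : k ℕ.< l
    k<l = ℕ.≤-<-trans (proj₁ (proj₂ (qA j h₁ h₂ t))) (proj₂ (proj₂ (qA j h₁ h₂ t)))
    1≤k : 1 ℕ.≤ k
    1≤k = proj₁ (qA j h₁ h₂ t)
    at : (f j k l ≡ 1ℚ) × (below (step j) (χℚ (A j)) k l ≡ 0ℚ)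
    at = potential-χ-∈ (hA j h₁ h₂) (qA j h₁ h₂) t
    j≤r : j ℕ.≤ r
    j≤r = rk-≥ k l h₂ (proj₁ at)
    zero₀ : ∀ {k' l'} → f j k' l' ≤ below (step j) (χℚ (A j)) k l → f j k' l' ≡ 0ℚ
    zero₀ {k'} {l'} h = Sum.[ (λ e → e) , (λ e → ⊥-elim (1≰0 (≤-trans (≤-reflexive (sym e)) (≤-trans h (≤-reflexive (proj₂ at)))))) ]′ (f-01 j h₁ h₂ k' l')
    lt₁ : rk (ℕ.pred k) l ℕ.< j
    lt₁ = rk-< _ _ h₁ (zero₀ (p≤p⊔q (f j (ℕ.pred k) l) _))
    lt₂ : rk k (ℕ.pred l) ℕ.< j
    lt₂ = rk-< _ _ h₁ (zero₀ (p≤q⊔p (f j (ℕ.pred k) l) (f j k (ℕ.pred l))))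
    χ≡1 : χℚ (A r) k l ≡ 1ℚ
    χ≡1 = trans (value-at (step r) (χℚ (A r)) 1≤k k<l)
      (cong₂ _-_ (f-1 k l (ℕ.≤-trans h₁ j≤r) ℕ.≤-refl)
        (cong₂ _⊔_ (f-0 (ℕ.pred k) l (ℕ.<-≤-trans lt₁ j≤r) (rk≤n k l)) (f-0 k (ℕ.pred l) (ℕ.<-≤-trans lt₂ j≤r) (rk≤n k l))))
    Bool-stable : A r k l ≡ true
    Bool-stable = go (A r k l Bool.≟ true)
      where
      go : Dec (A r k l ≡ true) → A r k l ≡ true
      go (yes h) = h
      go (no ¬h) = ⊥-elim (0≢1 (trans (sym (χℚ-∉ (A r) ¬h)) χ≡1))

  member? : ∀ b k l → (xB b k l ≡ 0ℚ) ⊎ ∃ λ j → 1 ℕ.≤ j × j ℕ.≤ n × A j k l ≡ true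
  member? b k l = go (ℕ.anyUpTo? (λ j → (1 ℕ.≤? j) ×-dec (A j k l Bool.≟ true)) (suc n))
    where
    go : Dec (∃ λ j → j ℕ.< suc n × (1 ℕ.≤ j × A j k l ≡ true)) → (xB b k l ≡ 0ℚ) ⊎ ∃ λ j → 1 ℕ.≤ j × j ℕ.≤ n × A j k l ≡ true
    go (yes (j , h₁ , h₂ , t)) = inj₂ (j , h₂ , ℕ.≤-pred h₁ , t)
    go (no ¬h) = inj₁ (sumTo-zero n (λ i h₁ h₂ → trans (cong (b i *_) (χℚ-∉ (A i) (λ t → ¬h (i , s≤s h₂ , h₁ , t)))) (*-zeroʳ (b i))))

  -- Equality in the convexity of the potential on the support

  module Tight (b : ℕ → ℚ) (0≤b : ∀ i → 0ℚ ≤ b i) (u w : Point) (hu : In (cB b) u) (hw : In (cB b) w)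
    (mid : ∀ k l → xB b k l + xB b k l ≡ u k l + w k l) where

    open Weights b 0≤b

    U W : ℕ → ℕ → ℚ
    U = potential (cB b) u
    W = potential (cB b) w

    X : ℕ → ℕ → ℚ
    X k l = sumTo b (rk k l)

    T : ℕ → ℕ → Set
    T k l = U k l + W k l ≤ X k l + X k l

    T-cap : ∀ k l → cB b l ≤ X k l → T k l
    T-cap k l h = +-mono-≤ (≤-trans (proj₂ hu k l) h) (≤-trans (proj₂ hw k l) h)

    -- Downward induction on the rank: a vertex pair links p to the next marker or to a later element of A (suc r).
    tight : ∀ d r → n ℕ.≤ r ℕ.+ d → 1 ℕ.≤ r → ∀ k l → rk k l ≡ r → A r k l ≡ true → T k l
    tight zero r n≤r 1≤r k l refl t = T-cap k l (≤-trans (cB-top l) (≤-reflexive (cong (sumTo b) (ℕ.≤-antisym (subst (n ℕ.≤_) (ℕ.+-identityʳ r) n≤r) (rk≤n k l)))))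
    tight (suc d) r n≤r 1≤r k l refl t = Sum.[ inner , (λ e → T-cap k l (≤-trans (cB-top l) (≤-reflexive (cong (sumTo b) (sym e))))) ]′ (ℕ.m≤n⇒m<n∨m≡n (rk≤n k l))
      where
      inner : r ℕ.< n → T k l
      inner r<n = cases (l ℕ.≤? suc r)
          (ℕ.anyUpTo? (λ k' → ℕ.anyUpTo? (λ l' → (A (suc r) k' l' Bool.≟ true) ×-dec (k ℕ.≤? k') ×-dec (l ℕ.≤? l')) (suc M)) (suc (suc r)))
        where
        Above : Set
        Above = ∃ λ k' → k' ℕ.< suc (suc r) × ∃ λ l' → l' ℕ.< suc M × (A (suc r) k' l' ≡ true × k ℕ.≤ k' × l ℕ.≤ l')
        cases : Dec (l ℕ.≤ suc r) → Dec Above → T k l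
        cases (yes h) _ = T-cap k l (≤-trans (markers-mono cB-markers h) (≤-reflexive (cB-suc (ℕ.<⇒≤ r<n))))
        cases (no ¬h) (no ¬above) = ⊥-elim (Isolated.absurd r (A r) (A (suc r)) (hA r 1≤r (ℕ.<⇒≤ r<n)) (qA r 1≤r (ℕ.<⇒≤ r<n))
            (hA (suc r) (s≤s z≤n) r<n) (qA (suc r) (s≤s z≤n) r<n) (pv r 1≤r r<n) k l t (ℕ.≰⇒> ¬h)
            (λ k' l' t' (h₁ , h₂) → ¬above (k' , s≤s (proj₁ (proj₂ (qA (suc r) (s≤s z≤n) r<n t'))) , l' , s≤s (bA (suc r) (s≤s z≤n) r<n t') , t' , h₁ , h₂))
            -- The cell has rank exactly `r`, so it cannot lie above an element of `A (suc r)`.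
            (λ k' l' t' (h₁ , h₂) → 1≰0 (≤-trans (≤-reflexive (sym (proj₁ (potential-χ-∈ (hA (suc r) (s≤s z≤n) r<n) (qA (suc r) (s≤s z≤n) r<n) t'))))
              (≤-trans (potential-mono-kl (step-markers (suc r)) (χ-In (hA (suc r) (s≤s z≤n) r<n) (qA (suc r) (s≤s z≤n) r<n)) h₁ h₂)
                (≤-reflexive (f-0 k l (ℕ.n<1+n r) r<n))))))
        -- Write p and q for the lower and the upper cell. Then `U p + u q ≤ U q`, likewise for `w`,
        -- and `X q ≤ xB q + X p` as the predecessors of q have rank at most `r`. Adding the claim
        -- at q and `u q + w q = 2 xB q` gives the claim at p.
        cases (no _) (yes (k' , _ , l' , _ , t' , h₁ , h₂)) = lin-≤ (T' ⊞ U≤ ⊞ W≤ ⊞ (X≤ ⊞ X≤))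
            (eq (U k l) (W k l) (U k' l') (W k' l') (X k' l') (X k l) (u k' l') (w k' l') (xB b k' l') (mid k' l'))
          where
          own = own-rank (suc r) (s≤s z≤n) r<n k' l' t'
          r' : ℕ
          r' = rk k' l'
          q' = qA (suc r) (s≤s z≤n) r<n t'
          k'<l' : k' ℕ.< l'
          k'<l' = ℕ.≤-<-trans (proj₁ (proj₂ q')) (proj₂ (proj₂ q'))
          T' : T k' l'
          T' = tight d r' (ℕ.≤-trans (ℕ.≤-trans n≤r (ℕ.≤-reflexive (ℕ.+-suc r d))) (ℕ.+-monoˡ-≤ d (proj₁ own)))
                 (ℕ.≤-trans (s≤s z≤n) (proj₁ own)) k' l' refl (proj₁ (proj₂ own))
          differ : k ℕ.< k' ⊎ l ℕ.< l'
          differ = Sum.[ inj₁ , (λ ek → Sum.[ inj₂ , (λ el → ⊥-elim (ℕ.<⇒≱ (proj₁ own) (ℕ.≤-reflexive (sym (cong₂ rk ek el))))) ]′ (ℕ.m≤n⇒m<n∨m≡n h₂)) ]′ (ℕ.m≤n⇒m<n∨m≡n h₁)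
          climb : ∀ {y} → In (cB b) y → potential (cB b) y k l + y k' l' ≤ potential (cB b) y k' l'
          climb {y} hy = ≤-trans (≤-trans (≤-reflexive (+-comm (potential (cB b) y k l) (y k' l'))) (+-monoʳ-≤ (y k' l') le)) (≤-reflexive (sym (potential-below (cB b) y (proj₁ q') k'<l')))
            where
            le : potential (cB b) y k l ≤ below (cB b) y k' l'
            le = Sum.[ (λ h → ≤-trans (potential-mono-kl cB-markers hy (ℕ.<⇒≤pred h) h₂) (p≤p⊔q (potential (cB b) y (ℕ.pred k') l') _))
                     , (λ h → ≤-trans (potential-mono-kl cB-markers hy h₁ (ℕ.<⇒≤pred h)) (p≤q⊔p (potential (cB b) y (ℕ.pred k') l') _)) ]′ differ
          U≤ : U k l + u k' l' ≤ U k' l'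
          U≤ = climb hu
          W≤ : W k l + w k' l' ≤ W k' l'
          W≤ = climb hw
          X≤ : X k' l' ≤ xB b k' l' + X k l
          X≤ = ≤-trans (≤-reflexive (trans (sym (potential-rank k' l')) (potential-below (cB b) (xB b) (proj₁ q') k'<l')))
            (+-monoʳ-≤ (xB b k' l') (⊔-least _ _
              (≤-trans (≤-reflexive (potential-rank (ℕ.pred k') l')) (sumTo-mono-n 0≤b (ℕ.≤-pred (proj₁ (proj₂ (proj₂ own))))))
              (≤-trans (≤-reflexive (potential-rank k' (ℕ.pred l'))) (sumTo-mono-n 0≤b (ℕ.≤-pred (proj₂ (proj₂ (proj₂ own))))))))
          eq : ∀ U W U' W' X' X u w x → x + x ≡ u + w →
            (X + X) + (U' + W' + (U + u) + (W + w) + (X' + X')) ≡ U + W + (X' + X' + U' + W' + (x + X + (x + X)))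
          eq U W U' W' X' X u w x e = trans (eq₁ U W U' W' X' X u w) (trans (cong (λ p → (X + X) + (U' + W' + U + W + (X' + X')) + p) (sym e)) (eq₂ U W U' W' X' X x))
            where
            eq₁ : ∀ U W U' W' X' X u w → (X + X) + (U' + W' + (U + u) + (W + w) + (X' + X')) ≡ (X + X) + (U' + W' + U + W + (X' + X')) + (u + w)
            eq₁ = solve-∀ ℚ-ring
            eq₂ : ∀ U W U' W' X' X x → (X + X) + (U' + W' + U + W + (X' + X')) + (x + x) ≡ U + W + (X' + X' + U' + W' + (x + X + (x + X)))
            eq₂ = solve-∀ ℚ-ring

    balanced : ∀ k l → (xB b k l ≡ 0ℚ) ⊎ ((1 ℕ.≤ k × k ℕ.< l) × (U k l + W k l ≡ X k l + X k l))
    balanced k l = Sum.map₂ go (member? b k l)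
      where
      go : (∃ λ j → 1 ℕ.≤ j × j ℕ.≤ n × A j k l ≡ true) → (1 ℕ.≤ k × k ℕ.< l) × (U k l + W k l ≡ X k l + X k l)
      go (j , h₁ , h₂ , t) = (proj₁ q , ℕ.≤-<-trans (proj₁ (proj₂ q)) (proj₂ (proj₂ q))) ,
        ≤-antisym (tight n r (ℕ.m≤n+m n r) (ℕ.≤-trans h₁ (proj₁ own)) k l refl (proj₁ (proj₂ own)))
          (≤-trans (≤-reflexive (sym (cong₂ _+_ (potential-rank k l) (potential-rank k l)))) (potential-midpoint (cB b) {xB b} {u} {w} mid k l))
        where
        r : ℕ
        r = rk k l
        own = own-rank j h₁ h₂ k l t
        q = qA j h₁ h₂ t

  -- Separated levels and windows

  module Perturb (a : ℕ → ℕ) (u₀ w₀ : Point) (hu₀ : In (cB (λ i → ι (a i))) u₀) (hw₀ : In (cB (λ i → ι (a i))) w₀)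
    (mid₀ : ∀ k l → xB (λ i → ι (a i)) k l + xB (λ i → ι (a i)) k l ≡ u₀ k l + w₀ k l) where

    α : ℕ → ℚ
    α i = ι (a i)

    S : ℕ → ℚ
    S = sumTo α

    -- `D` dominates all potentials for the weights `α`, and its summand 1 makes it invertible. A
    -- window of radius `D` has width `K`, so adding `K` to every weight keeps neighbouring ranks
    -- out of its interior.
    D K : ℚ
    D = 1ℚ + S n
    K = D + D

    κ b : ℕ → ℚ
    κ _ = K
    b i = α i + K

    SK : ℕ → ℚ
    SK = sumTo κ

    0≤α : ∀ i → 0ℚ ≤ α i
    0≤α i = 0≤ι (a i)

    0≤S : ∀ r → 0ℚ ≤ S r
    0≤S r = sumTo-mono-n 0≤α (z≤n {r})

    S≤D : ∀ {r} → r ℕ.≤ n → S r ≤ D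
    S≤D h = ≤-trans (sumTo-mono-n 0≤α h) (lin-≤ 0≤1 (eq (S n)))
      where
      eq : ∀ s → 1ℚ + s + 0ℚ ≡ s + 1ℚ
      eq = solve-∀ ℚ-ring

    1≤D : 1ℚ ≤ D
    1≤D = p≤p+q (0≤S n)

    0≤D : 0ℚ ≤ D
    0≤D = ≤-trans 0≤1 1≤D

    0≤K : 0ℚ ≤ K
    0≤K = 0≤p+q 0≤D 0≤D

    0≤b : ∀ i → 0ℚ ≤ b i
    0≤b i = 0≤p+q (0≤α i) 0≤K

    SK-mono : ∀ {r s} → r ℕ.≤ s → SK r ≤ SK s
    SK-mono = sumTo-mono-n (λ _ → 0≤K)

    b-split : ∀ r → sumTo b r ≡ S r + SK r
    b-split = sumTo-+ α κ

    cB-split : ∀ k → cB b k ≡ cB α k + cB κ k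
    cB-split k = trans (sumTo-cong n (λ i _ _ → *-distribʳ-+ (step i k) (α i) K)) (sumTo-+ _ _ n)

    xB-split : ∀ k l → xB b k l ≡ xB α k l + xB κ k l
    xB-split k l = trans (sumTo-cong n (λ i _ _ → *-distribʳ-+ (χℚ (A i) k l) (α i) K)) (sumTo-+ _ _ n)

    module WA = Weights α 0≤α
    module WK = Weights κ (λ _ → 0≤K)
    open Weights b 0≤b

    shift : Point → Point
    shift y k l = y k l + xB κ k l

    shift-In : ∀ {y} → In (cB α) y → In (cB b) (shift y)
    shift-In hy = In-cong (λ k → sym (cB-split k)) (λ _ _ → refl) (In-+ hy WK.xB-In)

    u w : Point
    u = shift u₀
    w = shift w₀

    hu : In (cB b) u
    hu = shift-In hu₀

    hw : In (cB b) w
    hw = shift-In hw₀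

    mid : ∀ k l → xB b k l + xB b k l ≡ u k l + w k l
    mid k l = trans (cong₂ _+_ (xB-split k l) (xB-split k l))
      (trans (eq (xB α k l) (xB κ k l)) (trans (cong (_+ (xB κ k l + xB κ k l)) (mid₀ k l)) (eq' (u₀ k l) (w₀ k l) (xB κ k l))))
      where
      eq : ∀ x z → x + z + (x + z) ≡ x + x + (z + z)
      eq = solve-∀ ℚ-ring
      eq' : ∀ u w z → u + w + (z + z) ≡ u + z + (w + z)
      eq' = solve-∀ ℚ-ring

    open Tight b 0≤b u w hu hw mid

    Near : ℕ → ℚ → Set
    Near r s = SK r ≤ s × s ≤ SK r + D

    -- The lower bound drops `y` from the potential. The upper bound is subadditivity, with `y`
    -- contributing at most `D`.
    near-shift : ∀ {y} → In (cB α) y → ∀ k l → Near (rk k l) (potential (cB b) (shift y) k l)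
    near-shift {y} hy k l =
      ≤-trans (≤-reflexive (sym (WK.potential-rank k l))) (potential-mono
        (λ k → ≤-trans (lin-≤ (≤-trans (≤-reflexive (sym WA.cB-zero)) (markers-mono WA.cB-markers {0} {k} z≤n)) (eq (cB α k) (cB κ k))) (≤-reflexive (sym (cB-split k))))
        (λ k l → lin-≤ (proj₁ hy k l) (eq (y k l) (xB κ k l))) k l) ,
      ≤-trans (≤-reflexive (potential-cong cB-split (λ _ _ → refl) k l)) (≤-trans (potential-+ (cB α) (cB κ) y (xB κ) k l)
        (≤-trans (+-mono-≤ (≤-trans (proj₂ hy k l) (≤-trans (WA.cB-top l) (S≤D ℕ.≤-refl))) (≤-reflexive (WK.potential-rank k l))) (≤-reflexive (+-comm D (SK (rk k l))))))
      where
      eq : ∀ y z → y + z + 0ℚ ≡ z + y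
      eq = solve-∀ ℚ-ring

    near-X : ∀ {r} → r ℕ.≤ n → Near r (sumTo b r)
    near-X {r} h = lin-≤ (0≤S r) (trans (cong (_+ 0ℚ) (b-split r)) (eq (S r) (SK r))) ,
      ≤-trans (≤-reflexive (trans (b-split r) (+-comm (S r) (SK r)))) (+-monoʳ-≤ (SK r) (S≤D h))
      where
      eq : ∀ s z → s + z + 0ℚ ≡ z + s
      eq = solve-∀ ℚ-ring

    near-⊔ : ∀ {r r' s s'} → r ℕ.≤ r' → Near r s → Near r' s' → Near r' (s ⊔ s')
    near-⊔ {s = s} {s'} h (_ , up) (lo' , up') = ≤-trans lo' (p≤q⊔p s s') , ⊔-least s s' (≤-trans up (+-monoˡ-≤ D (SK-mono h))) up'

    -- One rank has to locate the maximum over the predecessors for all shifted points at once, so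
    -- that `ψ` acts on these maxima by the same affine map.
    BelowRank : ℕ → ℕ → ℕ → Set
    BelowRank k l r = r ℕ.≤ n × below (cB b) (xB b) k l ≡ sumTo b r × (∀ y → In (cB α) y → Near r (below (cB b) (shift y) k l))

    below-rank : ∀ k l → ∃ (BelowRank k l)
    below-rank k l = Sum.[ left , up ]′ (ℕ.≤-total r₁ r₂)
      where
      r₁ r₂ : ℕ
      r₁ = rk (ℕ.pred k) l
      r₂ = rk k (ℕ.pred l)
      eq : below (cB b) (xB b) k l ≡ sumTo b r₁ ⊔ sumTo b r₂
      eq = cong₂ _⊔_ (potential-rank (ℕ.pred k) l) (potential-rank k (ℕ.pred l))
      left : r₁ ℕ.≤ r₂ → ∃ (BelowRank k l)
      left le = r₂ , rk≤n k (ℕ.pred l) , trans eq (p≤q⇒p⊔q≡q {sumTo b r₁} {sumTo b r₂} (sumTo-mono-n 0≤b le)) ,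
        λ y hy → near-⊔ {r₁} {r₂} {potential (cB b) (shift y) (ℕ.pred k) l} {potential (cB b) (shift y) k (ℕ.pred l)} le
                   (near-shift hy (ℕ.pred k) l) (near-shift hy k (ℕ.pred l))
      up : r₂ ℕ.≤ r₁ → ∃ (BelowRank k l)
      up le = r₁ , rk≤n (ℕ.pred k) l , trans eq (p≥q⇒p⊔q≡p {sumTo b r₁} {sumTo b r₂} (sumTo-mono-n 0≤b le)) ,
        λ y hy → subst (Near r₁) (⊔-comm (potential (cB b) (shift y) k (ℕ.pred l)) (potential (cB b) (shift y) (ℕ.pred k) l))
          (near-⊔ {r₂} {r₁} {potential (cB b) (shift y) k (ℕ.pred l)} {potential (cB b) (shift y) (ℕ.pred k) l} le
            (near-shift hy k (ℕ.pred l)) (near-shift hy (ℕ.pred k) l))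

    -- Clamping to a window of radius D around the value at rank i isolates the pair (A i , A (suc i)).
    module Window (i : ℕ) (1≤i : 1 ℕ.≤ i) (i<n : suc i ℕ.≤ n) where

      e : ℕ → ℚ
      e = pairMarkers i

      v : Point
      v = pair (A i) (A (suc i))

      lo : ℚ
      lo = SK i + S i - D

      ψ : ℚ → ℚ
      ψ = clamp lo K

      ψ-mono : Monotone ψ
      ψ-mono = clamp-mono lo K

      i≤n : i ℕ.≤ n
      i≤n = ℕ.<⇒≤ i<n

      ψ-below : ∀ {r s} → r ℕ.< i → Near r s → ψ s ≡ 0ℚ
      ψ-below {r} {s} h (_ , up) = clamp-low K (lin-≤ (up ⊞ SK-mono h ⊞ 0≤S i) (eq s (SK r) (SK i) (S i) D))
        where
        eq : ∀ s z z' a d → z' + a - d + (s + (z + (d + d)) + 0ℚ) ≡ s + (z + d + z' + a)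
        eq = solve-∀ ℚ-ring

      ψ-above : ∀ {r s} → i ℕ.< r → Near r s → ψ s ≡ K
      ψ-above {r} {s} h (low , _) = clamp-high 0≤K (lin-≤ (low ⊞ SK-mono h ⊞ S≤D i≤n) (eq s (SK r) (SK i) (S i) D))
        where
        eq : ∀ s z z' a d → s + (z + (z' + (d + d)) + a) ≡ z' + a - d + (d + d) + (s + z + d)
        eq = solve-∀ ℚ-ring

      ψ-at : ∀ {s} → Near i s → ψ s ≡ s - lo
      ψ-at {s} (low , up) = clamp-mid (lin-≤ (low ⊞ S≤D i≤n) (eq s (SK i) (S i) D)) (lin-≤ (up ⊞ 0≤S i) (eq' s (SK i) (S i) D))
        where
        eq : ∀ s z a d → s + (z + a) ≡ z + a - d + (s + d)
        eq = solve-∀ ℚ-ring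
        eq' : ∀ s z a d → z + a - d + (d + d) + (s + 0ℚ) ≡ s + (z + d + a)
        eq' = solve-∀ ℚ-ring

      -- On values near a fixed rank `ψ` is constant, or a translation if the rank is `i`; either
      -- way it respects midpoints.
      ψ-balanced : ∀ {r s s'} → r ℕ.≤ n → Near r s → Near r s' → s + s' ≡ sumTo b r + sumTo b r →
        ψ s + ψ s' ≡ ψ (sumTo b r) + ψ (sumTo b r)
      ψ-balanced {r} {s} {s'} h ns ns' h' = go (ℕ.<-cmp r i)
        where
        nx : Near r (sumTo b r)
        nx = near-X h
        eq : ∀ s s' x l → s + s' ≡ x + x → s - l + (s' - l) ≡ x - l + (x - l)
        eq s s' x l e = lin-≡ e (eq₁ s s' x l)
          where
          eq₁ : ∀ s s' x l → x - l + (x - l) + (s + s') ≡ s - l + (s' - l) + (x + x)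
          eq₁ = solve-∀ ℚ-ring
        go : Tri (r ℕ.< i) (r ≡ i) (i ℕ.< r) → ψ s + ψ s' ≡ ψ (sumTo b r) + ψ (sumTo b r)
        go (tri< lt _ _) = trans (cong₂ _+_ (ψ-below lt ns) (ψ-below lt ns')) (sym (cong₂ _+_ (ψ-below lt nx) (ψ-below lt nx)))
        go (tri> _ _ gt) = trans (cong₂ _+_ (ψ-above gt ns) (ψ-above gt ns')) (sym (cong₂ _+_ (ψ-above gt nx) (ψ-above gt nx)))
        go (tri≈ _ refl _) = trans (cong₂ _+_ (ψ-at ns) (ψ-at ns')) (trans (eq s s' (sumTo b i) lo h') (sym (cong₂ _+_ (ψ-at nx) (ψ-at nx))))

      -- On the support of `xB b` the potentials are balanced, and subtracting entries balances the
      -- maxima over predecessors too. Elsewhere all three entries are zero.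
      push-balanced : ∀ k l → push ψ (cB b) (xB b) k l + push ψ (cB b) (xB b) k l ≡ push ψ (cB b) u k l + push ψ (cB b) w k l
      push-balanced k l = Sum.[ zero-case , (λ (h , bal) → main (proj₁ h) (proj₂ h) bal (below-rank k l)) ]′ (balanced k l)
        where
        zero-case : xB b k l ≡ 0ℚ → push ψ (cB b) (xB b) k l + push ψ (cB b) (xB b) k l ≡ push ψ (cB b) u k l + push ψ (cB b) w k l
        zero-case x0 = trans (cong₂ _+_ (push-zero ψ (cB b) (xB b) x0) (push-zero ψ (cB b) (xB b) x0))
          (sym (cong₂ _+_ (push-zero ψ (cB b) u (mid-zero {xB b} {u} {w} (proj₁ hu) (proj₁ hw) mid x0))
                          (push-zero ψ (cB b) w (mid-zero {xB b} {w} {u} (proj₁ hw) (proj₁ hu) (λ k l → trans (mid k l) (+-comm (u k l) (w k l))) x0))))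
        main : 1 ℕ.≤ k → k ℕ.< l → U k l + W k l ≡ X k l + X k l →
          ∃ (BelowRank k l) →
          push ψ (cB b) (xB b) k l + push ψ (cB b) (xB b) k l ≡ push ψ (cB b) u k l + push ψ (cB b) w k l
        main h₁ h₂ bal (r , r≤n , eb , nb) =
          trans (cong₂ _+_ at-x at-x) (trans (eq (ψ (X k l)) (ψ (sumTo b r)))
          (trans (cong₂ _-_ (sym (ψ-balanced (rk≤n k l) (near-shift hu₀ k l) (near-shift hw₀ k l) bal))
                            (sym (ψ-balanced r≤n (nb u₀ hu₀) (nb w₀ hw₀) bal-below)))
          (trans (eq' (ψ (U k l)) (ψ (W k l)) (ψ bu) (ψ bw)) (sym (cong₂ _+_ (push-at ψ (cB b) u h₁ h₂) (push-at ψ (cB b) w h₁ h₂))))))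
          where
          bu bw : ℚ
          bu = below (cB b) u k l
          bw = below (cB b) w k l
          at-x : push ψ (cB b) (xB b) k l ≡ ψ (X k l) - ψ (sumTo b r)
          at-x = trans (push-at ψ (cB b) (xB b) h₁ h₂) (cong₂ (λ p q → ψ p - ψ q) (potential-rank k l) eb)
          eq : ∀ p q → p - q + (p - q) ≡ p + p - (q + q)
          eq = solve-∀ ℚ-ring
          eq' : ∀ p p' q q' → p + p' - (q + q') ≡ p - q + (p' - q')
          eq' = solve-∀ ℚ-ring
          X≡ : X k l ≡ xB b k l + sumTo b r
          X≡ = trans (sym (potential-rank k l)) (trans (potential-below (cB b) (xB b) h₁ h₂) (cong (xB b k l +_) eb))
          bal-below : bu + bw ≡ sumTo b r + sumTo b r
          bal-below = lin-≡ (trans (sym (cong₂ _+_ (potential-below (cB b) u h₁ h₂) (potential-below (cB b) w h₁ h₂))) (trans bal (cong₂ _+_ X≡ X≡)) ⊞≡ mid k l)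
            (eq'' (u k l) (w k l) bu bw (xB b k l) (sumTo b r))
            where
            eq'' : ∀ u w p q x s → s + s + (u + p + (w + q) + (x + x)) ≡ p + q + (x + s + (x + s) + (u + w))
            eq'' = solve-∀ ℚ-ring

      -- The value at rank `i` is the centre of the window, so ranks below, at and above `i` give 0,
      -- `D` and `D + D`.
      ψX : ∀ k l → ψ (X k l) ≡ D * potential e v k l
      ψX k l = trans (go (ℕ.<-cmp (rk k l) i)) (cong (D *_) (sym (Split.potential-pair i 1≤i i<n k l)))
        where
        nx : Near (rk k l) (X k l)
        nx = near-X (rk≤n k l)
        d0 : ∀ d → 0ℚ ≡ d * (0ℚ + 0ℚ)
        d0 = solve-∀ ℚ-ring
        d1 : ∀ s z d → s + z - (z + s - d) ≡ d * (1ℚ + 0ℚ)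
        d1 = solve-∀ ℚ-ring
        d2 : ∀ d → d + d ≡ d * (1ℚ + 1ℚ)
        d2 = solve-∀ ℚ-ring
        go : Tri (rk k l ℕ.< i) (rk k l ≡ i) (i ℕ.< rk k l) → ψ (X k l) ≡ D * (f i k l + f (suc i) k l)
        go (tri< lt _ _) = trans (ψ-below lt nx) (trans (d0 D) (cong (D *_) (sym (cong₂ _+_ (f-0 k l lt i≤n) (f-0 k l (ℕ.<-trans lt (ℕ.n<1+n i)) i<n)))))
        go (tri> _ _ gt) = trans (ψ-above gt nx) (trans (d2 D) (cong (D *_) (sym (cong₂ _+_ (f-1 k l 1≤i (ℕ.<⇒≤ gt)) (f-1 k l (s≤s z≤n) gt)))))
        go (tri≈ _ eq _) = trans (ψ-at (subst (λ r → Near r (X k l)) eq nx))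
          (trans (cong (_- lo) (trans (cong (sumTo b) eq) (b-split i)))
          (trans (d1 (S i) (SK i) D) (cong (D *_) (sym (cong₂ _+_ (f-1 k l 1≤i (ℕ.≤-reflexive (sym eq))) (f-0 k l (ℕ.≤-reflexive (cong suc eq)) i<n))))))

      ψc : ∀ k → ψ (cB b k) ≡ D * e k
      ψc k = trans (cong ψ (trans (sym (potential-diag (cB b) (xB b) (ℕ.≤-refl {k}))) (potential-rank k k)))
        (trans (ψX k k) (cong (D *_) (potential-diag e v (ℕ.≤-refl {k}))))

      pushed-x : ∀ k l → push ψ (cB b) (xB b) k l ≡ D * v k l
      pushed-x k l = value-determined (λ k → ψ (cB b k)) {λ k → D * e k} (push ψ (cB b) (xB b)) (λ k l → D * v k l)
          (λ k l h → push-zero ψ (cB b) (xB b) (xB-supported b k l h))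
          (λ k l h → trans (cong (D *_) (cong₂ _+_ (χℚ-supported {A i} (qA i 1≤i i≤n) k l h) (χℚ-supported {A (suc i)} (qA (suc i) (s≤s z≤n) i<n) k l h))) (*-zeroʳ D))
          (same k l) (same (ℕ.pred k) l) (same k (ℕ.pred l))
        where
        same : ∀ k l → potential (λ k → ψ (cB b k)) (push ψ (cB b) (xB b)) k l ≡ potential (λ k → D * e k) (λ k l → D * v k l) k l
        same k l = trans (potential-push ψ-mono (cB b) (xB b) k l)
          (trans (cong ψ (potential-rank k l)) (trans (ψX k l) (sym (potential-* 0≤D e v k l))))

      D-positive : Positive D
      D-positive = positive (<-≤-trans (positive⁻¹ 1ℚ) 1≤D)

      1/D : ℚ
      1/D = (1/ D) {{pos⇒nonZero D {{D-positive}}}}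

      pushed-u : ∀ k l → push ψ (cB b) u k l ≡ D * v k l
      pushed-u = IsVertex-scale {D} {1/D} (<⇒≤ (positive⁻¹ 1/D {{1/pos⇒pos D {{D-positive}}}})) (*-inverseʳ D {{pos⇒nonZero D {{D-positive}}}}) (pv i 1≤i i<n)
        (In-cong ψc (λ _ _ → refl) (push-In ψ-mono hu)) (In-cong ψc (λ _ _ → refl) (push-In ψ-mono hw))
        (λ k l → trans (sym (cong₂ _+_ (pushed-x k l) (pushed-x k l))) (push-balanced k l))

      agree : ∀ k l → rk k l ≡ i → U k l ≡ X k l
      agree k l eq = lin-≡ (trans (sym (ψ-at nu)) (trans ψU≡ψX (ψ-at nx))) (eq' (U k l) (X k l) lo)
        where
        nu : Near i (U k l)
        nu = subst (λ r → Near r (U k l)) eq (near-shift hu₀ k l)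
        nx : Near i (X k l)
        nx = subst (λ r → Near r (X k l)) eq (near-X (rk≤n k l))
        ψU≡ψX : ψ (U k l) ≡ ψ (X k l)
        ψU≡ψX = trans (sym (potential-push ψ-mono (cB b) u k l)) (trans
          (potential-cong (λ _ → refl) (λ k l → trans (pushed-u k l) (sym (pushed-x k l))) k l)
          (trans (potential-push ψ-mono (cB b) (xB b) k l) (cong ψ (potential-rank k l))))
        eq' : ∀ u x l → x + (u - l) ≡ u + (x - l)
        eq' = solve-∀ ℚ-ring

    -- Ranks 0 and `n` carry the extreme values of the potential; the windows take care of the ranks
    -- strictly between.
    agree : ∀ k l → U k l ≡ X k l
    agree k l = go (rk k l) refl
      where
      go : ∀ r → rk k l ≡ r → U k l ≡ X k l
      go zero eq = trans (mid-bottom cB-markers xB-In hu hw mid k l (trans (potential-rank k l) (trans X≡0 (sym cB-zero)))) (trans cB-zero (sym X≡0))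
        where
        X≡0 : X k l ≡ 0ℚ
        X≡0 = cong (sumTo b) eq
      go (suc r) eq = Sum.[ (λ lt → Window.agree (suc r) (s≤s z≤n) lt k l eq)
        , (λ r≡n → mid-top cB-markers xB-In hu hw mid k l (≤-trans (cB-top l) (≤-reflexive (cong (sumTo b) (trans (sym r≡n) (sym eq))))) (potential-rank k l)) ]′
          (ℕ.m≤n⇒m<n∨m≡n (subst (ℕ._≤ n) eq (rk≤n k l)))

    conclusion : ∀ k l → u₀ k l ≡ xB α k l
    conclusion k l = +-cancelʳ-≡ (xB κ k l) (trans u≡ (xB-split k l))
      where
      same : ∀ k l → U k l ≡ potential (cB b) (xB b) k l
      same k l = trans (agree k l) (sym (potential-rank k l))
      u≡ : u k l ≡ xB b k l
      u≡ = value-determined (cB b) {cB b} u (xB b) (mid-supported {xB b} {u} {w} (proj₁ hu) (proj₁ hw) mid (xB-supported b)) (xB-supported b)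
        (same k l) (same (ℕ.pred k) l) (same k (ℕ.pred l))

  combination-vertex : ∀ a → IsVertex (cB (λ i → ι (a i))) (xB (λ i → ι (a i)))
  combination-vertex a = Weights.xB-In (λ i → ι (a i)) (λ i → 0≤ι (a i)) ,
    λ y z hy hz mid → Perturb.conclusion a y z hy hz mid

-- The marker 0 lies strictly below the others, so that the column k = 0 of the grid belongs to no up-set.
module NatMarkers (n : ℕ) (a : ℕ → ℕ) where

  N : ℕ → ℕ
  N zero          = 0
  N (suc zero)    = 1
  N (suc (suc k)) = N (suc k) ℕ.+ (if does (suc k ℕ.≤? n) then a (suc k) else 0)

  N-suc : ∀ k → N k ℕ.≤ N (suc k)
  N-suc zero    = z≤n
  N-suc (suc k) = ℕ.m≤m+n (N (suc k)) _

  N-weight : ∀ j → 1 ℕ.≤ j → j ℕ.≤ n → N (suc j) ≡ N j ℕ.+ a j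
  N-weight (suc j) _ h = cong (λ t → N (suc j) ℕ.+ (if t then a (suc j) else 0)) (dec-true (suc j ℕ.≤? n) h)

  N-flat : ∀ j → n ℕ.< j → N (suc j) ≡ N j
  N-flat (suc j) h = trans (cong (λ t → N (suc j) ℕ.+ (if t then a (suc j) else 0)) (dec-false (suc j ℕ.≤? n) (ℕ.<⇒≱ h))) (ℕ.+-identityʳ (N (suc j)))

  N-top : ∀ l → N l ℕ.≤ N (suc n)
  N-top zero    = z≤n
  N-top (suc l) = go (suc l ℕ.≤? suc n)
    where
    go : Dec (suc l ℕ.≤ suc n) → N (suc l) ℕ.≤ N (suc n)
    go (yes h) = mono h
      where
      mono : ∀ {k l} → k ℕ.≤ l → N k ℕ.≤ N l
      mono {k} {zero}  z≤n = ℕ.≤-refl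
      mono {k} {suc l} h = Sum.[ (λ h' → ℕ.≤-trans (mono (ℕ.≤-pred h')) (N-suc l)) , (λ { refl → ℕ.≤-refl }) ]′ (ℕ.m≤n⇒m<n∨m≡n h)
    go (no ¬h) = ℕ.≤-trans (ℕ.≤-reflexive (N-flat l (ℕ.≤-pred (ℕ.≰⇒> ¬h)))) (N-top l)

-- Return to the coordinates of the type C polytope

module _ (n : ℕ) (1≤n : 1 ℕ.≤ n) (a : ℕ → ℕ) (x : Point) where

  open Extension (regionC n)

  Decomposition : Set
  Decomposition = Σ (ℕ → PairSet) (λ A →
    (∀ i → 1 ℕ.≤ i → i ℕ.≤ n → IsAntichain (A i) × A i ⊆QC[ n , i ]) ×
    (∀ i → 1 ℕ.≤ i → i ℕ.≤ n ℕ.∸ 1 → IsVertexA (2 ℕ.* n) (ωω i) (χsum (A i) (A (suc i)))) ×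
    (∀ k l → IdxC n k l → x k l ≡ ℕ→ℚ (combo n a A k l)))

  private
    <n : ∀ {i} → i ℕ.≤ n ℕ.∸ 1 → suc i ℕ.≤ n
    <n h = ℕ.≤-trans (s≤s h) (ℕ.≤-reflexive (ℕ.m+[n∸m]≡n 1≤n))

  vertex⇒decomposition : IsVertexC n a x → Decomposition
  vertex⇒decomposition hv = A , (λ i _ h → A-antichain i , A⊆QC i h) ,
      (λ i _ h → pair-vertex⇐ n i (A i) (A (suc i)) (A⊆QC i (ℕ.<⇒≤ (<n h))) (A⊆QC (suc i) (<n h)) (pair-vertex i)) ,
      (λ k l r → trans (sym (ext-in x r)) (trans (formula k l (proj₁ r) (proj₁ (proj₂ r))) (sym (ℕ→ℚ-combo n a A k l))))
    where
    open NatMarkers n a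
    hv' : IsVertex (λ k → ι (N k)) (ext x)
    hv' = TypeC.IsVertexC⇒ n a (λ k → ι (N k)) (λ k → ι-mono (N-suc k))
      (λ j h₁ h₂ → trans (cong ι (N-weight j h₁ h₂)) (trans (ι-+ (N j) (a j)) (cong (ι (N j) +_) (ι-def (a j)))))
      (λ l → ι-mono (N-top l)) x hv
    open Forward N refl ℕ.≤-refl N-suc (ext x) hv' (ext-supported x)
    open Formula n a N-weight N-top

    -- Off the type C triangle the entry is zero and the potential equals that of a predecessor, so
    -- beyond column `suc i` no new minimal element can appear.
    A⊆Idx : ∀ {i k l} → i ℕ.≤ n → A i k l ≡ true → IdxC n k l
    A⊆Idx {i} {k} {l} i≤n t = go (IdxC? n k l)
      where
      q : (1 ℕ.≤ k) × (k ℕ.≤ i) × (i ℕ.< l)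
      q = A-⊆Q t
      k<l : k ℕ.< l
      k<l = ℕ.≤-<-trans (proj₁ (proj₂ q)) (proj₂ (proj₂ q))
      m : Min i k l
      m = A-Min t
      go : Dec (IdxC n k l) → IdxC n k l
      go (yes r) = r
      -- In column `suc i` minimality may come from the condition `i < l` alone, without a jump of
      -- the potential; there `k ≤ i ≤ n` puts the cell inside the triangle.
      go (no ¬r) = Sum.[ far , (λ e → proj₁ q , k<l , near (sym e)) ]′ (ℕ.m≤n⇒m<n∨m≡n (proj₂ (proj₂ q)))
        where
        near : l ≡ suc i → k ℕ.+ l ℕ.≤ 2 ℕ.* n ℕ.+ 1
        near refl = ℕ.≤-trans (ℕ.+-mono-≤ (ℕ.≤-trans (proj₁ (proj₂ q)) i≤n) (s≤s i≤n)) (ℕ.≤-reflexive (n+sn n))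
        Y≡ : Y k l ≡ Y (ℕ.pred k) l ⊔ Y k (ℕ.pred l)
        Y≡ = trans (potential-below c (ext x) (proj₁ q) k<l) (trans (cong (_+ below c (ext x) k l) (ext-out x ¬r)) (+-identityˡ (below c (ext x) k l)))
        far : suc i ℕ.< l → IdxC n k l
        far h = ⊥-elim (Sum.[
            (λ e → proj₁ (proj₂ (proj₂ m)) (proj₂ (proj₂ q) , ≤-trans (proj₂ (proj₁ (proj₂ m))) (≤-reflexive (trans Y≡ e))))
          , (λ e → proj₂ (proj₂ (proj₂ m)) (ℕ.<⇒≤pred h , ≤-trans (proj₂ (proj₁ (proj₂ m))) (≤-reflexive (trans Y≡ e)))) ]′
          (⊔-sel (Y (ℕ.pred k) l) (Y k (ℕ.pred l))))

    A⊆QC : ∀ i → i ℕ.≤ n → A i ⊆QC[ n , i ]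
    A⊆QC i i≤n (k , l) t =
      let (p , q , s) = A-⊆Q {i} {k} {l} t
          (_ , _ , le) = A⊆Idx {i} {k} {l} i≤n t
      in p , q , s , ℕ.≤-pred (ℕ.≤-trans (ℕ.+-monoˡ-≤ l p) (ℕ.≤-trans le (ℕ.≤-reflexive (ℕ.+-comm (2 ℕ.* n) 1)))) , le

  decomposition⇒vertex : Decomposition → IsVertexC n a x
  -- These markers start with `c 0 = c 1 = 0`, so the potential is a plain weighted sum of
  -- indicators, with no offset.
  decomposition⇒vertex (A , hA , hp , hx) = TypeC.IsVertexC⇐ n a (cB α) cB-markers weight
      (λ l → ≤-trans (cB-top l) (≤-reflexive (sym (cB-suc ℕ.≤-refl)))) x
      (IsVertex-cong (λ _ → refl) x≡ (combination-vertex a))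
    where
    α : ℕ → ℚ
    α i = ι (a i)
    QC : ∀ i → 1 ℕ.≤ i → i ℕ.≤ n → A i ⊆QC[ n , i ]
    QC i h₁ h₂ = proj₂ (hA i h₁ h₂)
    open Backward n (2 ℕ.* n) A (λ i h₁ h₂ → proj₁ (hA i h₁ h₂)) (λ i h₁ h₂ → QC⇒Q {n} {i} {A i} (QC i h₁ h₂))
      (λ i h₁ h₂ t → proj₂ (proj₂ (QC⇒IdxA {n} {i} {A i} (QC i h₁ h₂) t)))
      (λ i h₁ h₂ → pair-vertex⇒ n i (A i) (A (suc i)) (QC i h₁ (ℕ.<⇒≤ h₂)) (QC (suc i) (s≤s z≤n) h₂) (hp i h₁ (ℕ.<⇒≤pred h₂)))
    open Weights α (λ i → 0≤ι (a i))

    weight : ∀ j → 1 ℕ.≤ j → j ℕ.≤ n → cB α (suc j) ≡ cB α j + ℕ→ℚ (a j)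
    weight (suc j) _ h = trans (cB-suc h) (cong₂ _+_ (sym (cB-suc (ℕ.<⇒≤ h))) (ι-def (a (suc j))))

    x≡ : ∀ k l → xB α k l ≡ ext x k l
    x≡ k l = go (IdxC? n k l)
      where
      go : Dec (IdxC n k l) → xB α k l ≡ ext x k l
      go (yes r) = trans (sym (ℕ→ℚ-combo n a A k l)) (trans (sym (hx k l r)) (sym (ext-in x r)))
      go (no ¬r) = trans (sumTo-zero n (λ i h₁ h₂ → trans (cong (α i *_) (χℚ-∉ (A i) (λ t → ¬r (QC⇒IdxC {n} {i} {A i} (QC i h₁ h₂) t)))) (*-zeroʳ (α i)))) (sym (ext-out x ¬r))

theorem5p1 : (n : ℕ) → 1 ℕ.≤ n → (a : ℕ → ℕ) → (x : Point) →
    IsVertexC n a x ⇔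
    Σ (ℕ → PairSet) (λ A →
    (∀ i → 1 ℕ.≤ i → i ℕ.≤ n → IsAntichain (A i) × A i ⊆QC[ n , i ]) ×
    (∀ i → 1 ℕ.≤ i → i ℕ.≤ n ℕ.∸ 1 →
    IsVertexA (2 ℕ.* n) (ωω i) (χsum (A i) (A (suc i)))) ×
    (∀ k l → IdxC n k l → x k l ≡ ℕ→ℚ (combo n a A k l)))
theorem5p1 n 1≤n a x = mk⇔ (vertex⇒decomposition n 1≤n a x) (decomposition⇒vertex n 1≤n a x)
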